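{- Every Tutte cut property is either a min-edge cut property (i.e. equal to the min-edge cut property defined by $(X,\delta)$ for some $X\subseteq\{\emptyset,\{ -\},\{+\}\}$ and $\delta\in\{+,-\}$), or is the property cut weird, or is the property cut co-weird. Analogously, every Tutte cycle property is either a min-edge cycle property, or is cycle weird, or is cycle co-weird.
   Context: Graphs are finite, undirected and connected; loops and multiple edges are allowed. A reference orientation $\mathcal{O}_{\mathrm{ref}}$ of $G$ assigns to each edge $e=\{u,v\}$ one of the ordered pairs $(u,v),(v,u)$. Every edge $e$ has two formal orientations $e^+$ and $e^-$ (treated as distinct even if $e$ is a loop): $e^+$ is directed as $\mathcal{O}_{\mathrm{ref}}(e)$ and $e^-$ is directed oppositely; $e^{\varepsilon}=(u,v)$ means $e^\varepsilon$ is directed from $u$ to $v$. Let $\mathbb{E}(G)=\{e^+,e^-: e\in E(G)\}$. An ordered, oriented graph is a triple $\mathbb{G}=(G,\mathcal{O}_{\mathrm{ref}},<)$ with $<$ a total order on $E(G)$. A fourientation of $\mathbb{G}$ is a subset $\mathcal{O}\subseteq\mathbb{E}(G)$; $e$ is oriented, unoriented, bioriented in $\mathcal{O}$ if exactly one, none, both of $e^+,e^-$ lie in $\mathcal{O}$. A cut is a partition $Cu=\{U,U^c\}$ of $V(G)$ into two nonempty parts, $E(Cu)$ is the set of edges with one endpoint in each part; it is simple if the induced subgraphs on $U$ and $U^c$ are connected. A directed cut is an ordered pair $\overrightarrow{Cu}=(U,U^c)$, with $E(\overrightarrow{Cu})=E(Cu)$; $\mathbb{E}(\overrightarrow{Cu})$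 is the set of edge orientations directed from $U$ to $U^c$. A cycle is a cyclic list $v_1,e_1,\dots,v_k,e_k$ ($k\ge 1$) with distinct edges $e_i=\{v_i,v_{i+1}\}$ (indices mod $k$), up to rotation and reflection; it is simple if the $v_i$ are distinct. A directed cycle $\overrightarrow{Cy}=v_1,e_1^{\delta_1},\dots,v_k,e_k^{\delta_k}$ additionally has $e_i^{\delta_i}=(v_i,v_{i+1})$, up to rotation; $E(\overrightarrow{Cy})=\{e_i\}$, $\mathbb{E}(\overrightarrow{Cy})=\{e_i^{\delta_i}\}$. An isthmus is an edge $e$ with $E(Cu)=\{e\}$ for some cut; a loop is an edge joining a vertex to itself. $\overrightarrow{Cu}$ is a potential cut of $\mathcal{O}$ if $e^{\varepsilon}\in\mathbb{E}(\overrightarrow{Cu})$ implies $e^{ -\varepsilon}\notin\mathcal{O}$; $\overrightarrow{Cy}$ is a potential cycle of $\mathcal{O}$ if $\mathbb{E}(\overrightarrow{Cy})\subseteq\mathcal{O}$. $\mathbb{G}\setminus e$ and $\mathbb{G}/e$ denote deletion and contraction with induced reference orientation and order. A fourientation $\mathcal{O}$ of $\mathbb{G}\setminus e$ or $\mathbb{G}/e$ is also regarded as the fourientation of $\mathbb{G}$ in which $e$ is unoriented. For a simple cut $Cu$, $\mathbb{G}_{Cu}$ is obtained by contracting all edges not in $E(Cu)$; for a simple cycle $Cy$, $\mathbb{G}_{Cy}$ is obtained by deleting all edges not in $E(Cy)$ and removing isolated vertices; $\mathcal{O}_{C}$ is the fourientation of $\mathbb{G}_C$ induced by $\mathcal{O}$.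 A fourientation property is a map from pairs $(\mathbb{G},\mathcal{O})$ ($\mathcal{O}$ a fourientation of $\mathbb{G}$) to $\{\mathrm{good},\mathrm{bad}\}$, invariant under isomorphism (bijections of vertices and edges compatible with incidence, reference orientation, edge order and $\mathcal{O}$); a property is identified with its set of good fourientations. It is a cut (cycle) property if $\mathcal{O}$ is good for $\mathbb{G}$ if and only if $\mathcal{O}_C$ is good for $\mathbb{G}_C$ for every simple cut (cycle) $C$. A cut (cycle) property is a Tutte cut (cycle) property if for all $\mathbb{G}$ (statements for cycle properties in parentheses): T1: $\mathcal{O}$ is bad for $\mathbb{G}$ only if $\mathcal{O}$ has a potential cut (cycle). T2: if the maximum edge $e$ of $\mathbb{G}$ is neither an isthmus nor a loop, then for every fourientation $\mathcal{O}$ of $\mathbb{G}\setminus e$ ($\mathbb{G}/e$): (a) if $\mathcal{O}$ is good for $\mathbb{G}\setminus e$ ($\mathbb{G}/e$), then $\mathcal{O}\cup\{e^+\}$ and $\mathcal{O}\cup\{e^-\}$ are both good for $\mathbb{G}$; (b) if $\mathcal{O}$ is bad for $\mathbb{G}\setminus e$ ($\mathbb{G}/e$) but $\mathcal{O}\cup\{e^+,e^-\}$ ($\mathcal{O}$) is good for $\mathbb{G}$, then exactly one of $\mathcal{O}\cup\{e^+\}$, $\mathcal{O}\cup\{e^-\}$ is good for $\mathbb{G}$; (c) $\mathcal{O}$ is good for $\mathbb{G}\setminus e$ ($\mathbb{G}/e$) if and only if $\mathcal{O}$ ($\mathcal{O}\cup\{e^+,e^-\}$) is good for $\mathbb{G}$.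 Min-edge properties. A min-edge cut (cycle) property is given by a set $X\subseteq\{\emptyset,\{ -\},\{+\}\}$ (for cycles, $X\subseteq\{\{ -\},\{+\},\{ -,+\}\}$) and $\delta\in\{+,-\}$. A potential cut (cycle) $\overrightarrow{C}$ of a fourientation $\mathcal{O}$ of $\mathbb{G}$, with $e_{\min}$ the $<$-minimum edge of $E(\overrightarrow{C})$, is bad with respect to $(X,\delta)$ if both (i) $\{\varepsilon: e_{\min}^{\varepsilon}\in\mathcal{O}\}\in X$, and (ii) if $e_{\min}$ is unoriented (for cycles: bioriented) in $\mathcal{O}$ then $e_{\min}^{\delta}\in\mathbb{E}(\overrightarrow{C})$. Otherwise it is good. $\mathcal{O}$ is good with respect to the min-edge cut (cycle) property $(X,\delta)$ if and only if all of its potential cuts (cycles) are good. Exceptional properties. A fourientation is good for cut weird (cycle weird) if each of its potential cuts (cycles) contains at least one oriented edge and the minimum oriented edge of the cut (cycle) is oriented in agreement with its reference orientation (i.e. as $e^+$). It is good for cut co-weird (cycle co-weird) if each of its potential cuts (cycles) contains at least one oriented edge and the minimum oriented edge of the cut (cycle) is oriented in disagreement with its reference orientation (i.e. as $e^-$). -}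

module Defs where

open import Data.Bool.Base using (Bool; true; false; _∨_)
open import Data.Fin.Base using (Fin)
open import Data.Fin.Properties using (_≟_; any?)
open import Data.Fin.Subset as Sub using (Subset; Nonempty)
open import Data.List.Base using (List; []; _∷_; map)
open import Data.List.Membership.Propositional using () renaming (_∈_ to _∈ˡ_)
open import Data.List.Relation.Unary.Unique.Propositional using (Unique)
open import Data.Nat.Base using (ℕ; NonZero)
open import Data.Product.Base using (∃; ∃-syntax; Σ-syntax; _×_; _,_; proj₁)
open import Data.Product.Properties using (≡-dec)
open import Data.Sign.Base using (Sign; +; -; opposite)
import Data.Sign.Properties as Sign
open import Data.Sum.Base using (_⊎_)
open import Function.Bundles using (_⇔_; _↔_; Inverse)
open import Function.Definitions using (Injective; Surjective)
open import Level using (0ℓ)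
open import Relation.Binary.Construct.Closure.ReflexiveTransitive using (Star; ε; _◅_)
open import Relation.Binary.Core using (Rel)
open import Relation.Binary.Definitions using (DecidableEquality)
open import Relation.Binary.PropositionalEquality.Core using (_≡_; _≢_)
open import Relation.Binary.Structures using (IsStrictTotalOrder)
open import Relation.Nullary.Decidable.Core using (does; yes; no)
open import Relation.Nullary.Negation.Core using (¬_)
open import Relation.Unary using (Pred; _∈_; ∁; ｛_｝)

------------------------------------------------------------------------
-- Ordered, oriented graphs and fourientations

-- The set { s | eˢ ∈ 𝒪 }: unoriented is ∅, oriented s is {s} and
-- bioriented is {- , +}.
data Status : Set where
  unoriented bioriented : Status
  oriented              : Sign → Status

status′ : (plus minus : Bool) → Status
status′ false false = unoriented
status′ true  false = oriented +
status′ false true  = oriented -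
status′ true  true  = bioriented

-- A graph with a reference orientation, which directs e from tail e to
-- head e.  The underlying undirected edge is {tail e , head e}; loops and
-- multiple edges are allowed.

record OrientedGraph : Set where
  field
    #V #E     : ℕ
    nonEmpty  : NonZero #V
    tail head : Fin #E → Fin #V

  V E 𝔼 : Set
  V = Fin #V
  E = Fin #E
  𝔼 = E × Sign            -- (e , s) is the formal orientation eˢ

  src tgt : 𝔼 → V
  src (e , +) = tail e
  src (e , -) = head e
  tgt (e , +) = head e
  tgt (e , -) = tail e

  -- Edges are traversed in either direction.
  Arc : Rel V 0ℓ
  Arc u v = Σ[ a ∈ 𝔼 ] src a ≡ u × tgt a ≡ v

  Walk : Rel V 0ℓ
  Walk = Star Arc

record OOGraph : Set₁ where
  infix 4 _<_
  field
    graph : OrientedGraph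
  open OrientedGraph graph public
  field
    _<_                : Rel E 0ℓ
    isStrictTotalOrder : IsStrictTotalOrder _≡_ _<_
    connected          : ∀ u v → Walk u v

  _≟𝔼_ : DecidableEquality 𝔼
  _≟𝔼_ = ≡-dec _≟_ Sign._≟_

  arcs : ∀ {u v} → Walk u v → List 𝔼
  arcs ε             = []
  arcs ((a , _) ◅ w) = a ∷ arcs w

  -- u and v are joined by a walk all of whose edges lie in S.
  Joined : Pred E 0ℓ → Rel V 0ℓ
  Joined S = Star (λ u v → Σ[ (a , _) ∈ Arc u v ] proj₁ a ∈ S)

  IsMin : Pred E 0ℓ → Pred E 0ℓ
  IsMin S e = e ∈ S × (∀ f → f ∈ S → f ≢ e → e < f)

  IsMax : Pred E 0ℓ
  IsMax e = ∀ f → f ≢ e → f < e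

  IsLoop : Pred E 0ℓ
  IsLoop e = tail e ≡ head e

  edgesOf : Pred 𝔼 0ℓ → Pred E 0ℓ
  edgesOf A e = ∃[ s ] (e , s) ∈ A

  Fourientation : Set
  Fourientation = 𝔼 → Bool

  infix 4 _∈ᶠ_
  _∈ᶠ_ : 𝔼 → Fourientation → Set
  a ∈ᶠ 𝒪 = 𝒪 a ≡ true

  infixl 6 _∪｛_｝
  _∪｛_｝ : Fourientation → 𝔼 → Fourientation
  (𝒪 ∪｛ a ｝) b = 𝒪 b ∨ does (b ≟𝔼 a)

  status : Fourientation → E → Status
  status 𝒪 e = status′ (𝒪 (e , +)) (𝒪 (e , -))

  IsOriented : Fourientation → Pred E 0ℓ
  IsOriented 𝒪 e = ∃[ s ] status 𝒪 e ≡ oriented s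

------------------------------------------------------------------------
-- Cuts

-- The directed cut (U , Uᶜ).  It also represents the undirected cut
-- {U , Uᶜ}: everything defined for undirected cuts is symmetric in
-- U and Uᶜ.

record Cut (G : OOGraph) : Set where
  open OOGraph G
  field
    U         : Subset #V
    nonempty  : Nonempty U
    nonemptyᶜ : Nonempty (Sub.∁ U)

  𝔼Cu : Pred 𝔼 0ℓ
  𝔼Cu a = src a Sub.∈ U × tgt a Sub.∈ Sub.∁ U

  ECu : Pred E 0ℓ
  ECu = edgesOf 𝔼Cu

module _ (G : OOGraph) where
  open OOGraph G

  InducedConnected : Subset #V → Set
  InducedConnected W = ∀ {u v} → u Sub.∈ W → v Sub.∈ W →
    Joined (λ e → tail e Sub.∈ W × head e Sub.∈ W) u v

  IsIsthmus : Pred E 0ℓ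
  IsIsthmus e = Σ[ Cu ∈ Cut G ] (∀ f → f ∈ Cut.ECu Cu ⇔ f ≡ e)

SimpleCut : ∀ G → Cut G → Set
SimpleCut G Cu = InducedConnected G U × InducedConnected G (Sub.∁ U)
  where open Cut Cu

------------------------------------------------------------------------
-- Cycles

-- A representative v₁ , e₁^δ₁ , … , vₖ , eₖ^δₖ of a directed cycle, as a
-- closed walk based at v₁; vᵢ is the source of eᵢ^δᵢ.  It also represents
-- the undirected cycle v₁ , e₁ , … , vₖ , eₖ.  Everything defined below
-- is independent of the choice of representative.

record Cycle (G : OOGraph) : Set where
  open OOGraph G
  field
    base          : V
    walk          : Walk base base
    nonempty      : arcs walk ≢ []
    distinctEdges : Unique (map proj₁ (arcs walk))

  𝔼Cy : Pred 𝔼 0ℓ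
  𝔼Cy a = a ∈ˡ arcs walk

  ECy : Pred E 0ℓ
  ECy = edgesOf 𝔼Cy

SimpleCycle : ∀ G → Cycle G → Set
SimpleCycle G Cy = Unique (map src (arcs walk))
  where open OOGraph G; open Cycle Cy

------------------------------------------------------------------------
-- Potential cuts and cycles

module _ (G : OOGraph) where
  open OOGraph G

  PotentialCut : Fourientation → Cut G → Set
  PotentialCut 𝒪 Cu = ∀ e s → (e , s) ∈ Cut.𝔼Cu Cu → ¬ (e , opposite s) ∈ᶠ 𝒪

  PotentialCycle : Fourientation → Cycle G → Set
  PotentialCycle 𝒪 Cy = ∀ a → a ∈ Cycle.𝔼Cy Cy → a ∈ᶠ 𝒪

------------------------------------------------------------------------
-- Minors

-- Minors are specified up to isomorphism: the records below say that H
-- is (a copy of) the minor in question.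

-- The edges of H are those edges of G that lie in S, with the induced
-- order.
record EdgeEmbedding (G : OOGraph) (S : Pred (OOGraph.E G) 0ℓ) (H : OOGraph) : Set where
  private
    module G = OOGraph G
    module H = OOGraph H
  field
    ι           : H.E → G.E
    ι-injective : Injective _≡_ _≡_ ι
    ι-image     : ∀ e → (∃[ x ] ι x ≡ e) ⇔ e ∈ S
    ι-order     : ∀ x y → (x H.< y) ⇔ (ι x G.< ι y)

  restrict : G.Fourientation → H.Fourientation
  restrict 𝒪 (x , s) = 𝒪 (ι x , s)

  -- A fourientation of H regarded as one of G in which the edges not in
  -- H are unoriented.
  extend : H.Fourientation → G.Fourientation
  extend 𝒪 (e , s) with any? (λ x → ι x ≟ e)
  ... | yes (x , _) = 𝒪 (x , s)
  ... | no  _       = false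

-- H is G with the edges in S deleted.
record Deletion (G : OOGraph) (S : Pred (OOGraph.E G) 0ℓ) (H : OOGraph) : Set where
  private
    module G = OOGraph G
    module H = OOGraph H
  field
    edges : EdgeEmbedding G (∁ S) H
    verts : H.V ↔ G.V
  open EdgeEmbedding edges public
  field
    tail-comm : ∀ x → Inverse.to verts (H.tail x) ≡ G.tail (ι x)
    head-comm : ∀ x → Inverse.to verts (H.head x) ≡ G.head (ι x)

-- H is G with the edges in S contracted.
record Contraction (G : OOGraph) (S : Pred (OOGraph.E G) 0ℓ) (H : OOGraph) : Set where
  private
    module G = OOGraph G
    module H = OOGraph H
  field
    edges        : EdgeEmbedding G (∁ S) H
    π            : G.V → H.V
    π-surjective : Surjective _≡_ _≡_ π
    π-fibres     : ∀ u v → (π u ≡ π v) ⇔ G.Joined S u v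
  open EdgeEmbedding edges public
  field
    tail-comm : ∀ x → H.tail x ≡ π (G.tail (ι x))
    head-comm : ∀ x → H.head x ≡ π (G.head (ι x))

-- H is G with the edges outside S deleted and isolated vertices removed.
record EdgeSubgraph (G : OOGraph) (S : Pred (OOGraph.E G) 0ℓ) (H : OOGraph) : Set where
  private
    module G = OOGraph G
    module H = OOGraph H
  field
    edges       : EdgeEmbedding G S H
    ν           : H.V → G.V
    ν-injective : Injective _≡_ _≡_ ν
    ν-image     : ∀ v → (∃[ y ] ν y ≡ v) ⇔
                        (∃[ e ] e ∈ S × (G.tail e ≡ v ⊎ G.head e ≡ v))
  open EdgeEmbedding edges public
  field
    tail-comm : ∀ x → ν (H.tail x) ≡ G.tail (ι x)
    head-comm : ∀ x → ν (H.head x) ≡ G.head (ι x)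

------------------------------------------------------------------------
-- Fourientation properties

record Isomorphism (G : OOGraph) (𝒪 : OOGraph.Fourientation G)
                   (G′ : OOGraph) (𝒪′ : OOGraph.Fourientation G′) : Set where
  private
    module G  = OOGraph G
    module G′ = OOGraph G′
  field
    verts : G.V ↔ G′.V
    edges : G.E ↔ G′.E
  onV : G.V → G′.V
  onV = Inverse.to verts
  onE : G.E → G′.E
  onE = Inverse.to edges
  field
    tail-comm : ∀ e → onV (G.tail e) ≡ G′.tail (onE e)
    head-comm : ∀ e → onV (G.head e) ≡ G′.head (onE e)
    order     : ∀ e f → (e G.< f) ⇔ (onE e G′.< onE f)
    fourient  : ∀ e s → 𝒪 (e , s) ≡ 𝒪′ (onE e , s)

record FourientationProperty : Set₁ where
  field
    isGood    : (G : OOGraph) → OOGraph.Fourientation G → Bool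
    invariant : ∀ {G 𝒪 G′ 𝒪′} → Isomorphism G 𝒪 G′ 𝒪′ → isGood G 𝒪 ≡ isGood G′ 𝒪′

  Good Bad : (G : OOGraph) → OOGraph.Fourientation G → Set
  Good G 𝒪 = isGood G 𝒪 ≡ true
  Bad  G 𝒪 = isGood G 𝒪 ≡ false

ExactlyOne : Set → Set → Set
ExactlyOne A B = (A × ¬ B) ⊎ (¬ A × B)

module _ (P : FourientationProperty) where
  open FourientationProperty P

  IsCutProperty : Set₁
  IsCutProperty = ∀ G (𝒪 : OOGraph.Fourientation G) → Good G 𝒪 ⇔
    (∀ (Cu : Cut G) → SimpleCut G Cu →
     ∀ H (c : Contraction G (∁ (Cut.ECu Cu)) H) → Good H (Contraction.restrict c 𝒪))

  IsCycleProperty : Set₁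
  IsCycleProperty = ∀ G (𝒪 : OOGraph.Fourientation G) → Good G 𝒪 ⇔
    (∀ (Cy : Cycle G) → SimpleCycle G Cy →
     ∀ H (d : EdgeSubgraph G (Cycle.ECy Cy) H) → Good H (EdgeSubgraph.restrict d 𝒪))

  record IsTutteCutProperty : Set₁ where
    field
      isCutProperty : IsCutProperty
      T1 : ∀ G (𝒪 : OOGraph.Fourientation G) → Bad G 𝒪 → ∃ (PotentialCut G 𝒪)
      T2 : ∀ G e → OOGraph.IsMax G e → ¬ IsIsthmus G e → ¬ OOGraph.IsLoop G e →
           ∀ H (d : Deletion G ｛ e ｝ H) (𝒪 : OOGraph.Fourientation H) →
           let open OOGraph G using (_∪｛_｝)
               𝒪ᴳ = Deletion.extend d 𝒪
           in
             (Good H 𝒪 → Good G (𝒪ᴳ ∪｛ e , + ｝) × Good G (𝒪ᴳ ∪｛ e , - ｝))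
           × (Bad H 𝒪 → Good G (𝒪ᴳ ∪｛ e , + ｝ ∪｛ e , - ｝) →
              ExactlyOne (Good G (𝒪ᴳ ∪｛ e , + ｝)) (Good G (𝒪ᴳ ∪｛ e , - ｝)))
           × (Good H 𝒪 ⇔ Good G 𝒪ᴳ)

  record IsTutteCycleProperty : Set₁ where
    field
      isCycleProperty : IsCycleProperty
      T1 : ∀ G (𝒪 : OOGraph.Fourientation G) → Bad G 𝒪 → ∃ (PotentialCycle G 𝒪)
      T2 : ∀ G e → OOGraph.IsMax G e → ¬ IsIsthmus G e → ¬ OOGraph.IsLoop G e →
           ∀ H (c : Contraction G ｛ e ｝ H) (𝒪 : OOGraph.Fourientation H) →
           let open OOGraph G using (_∪｛_｝)
               𝒪ᴳ = Contraction.extend c 𝒪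
           in
             (Good H 𝒪 → Good G (𝒪ᴳ ∪｛ e , + ｝) × Good G (𝒪ᴳ ∪｛ e , - ｝))
           × (Bad H 𝒪 → Good G 𝒪ᴳ →
              ExactlyOne (Good G (𝒪ᴳ ∪｛ e , + ｝)) (Good G (𝒪ᴳ ∪｛ e , - ｝)))
           × (Good H 𝒪 ⇔ Good G (𝒪ᴳ ∪｛ e , + ｝ ∪｛ e , - ｝))

------------------------------------------------------------------------
-- Min-edge and exceptional properties

-- Below, A is the set 𝔼(C) of a potential cut or cycle C, so that
-- edgesOf A is E(C).

module _ (G : OOGraph) (𝒪 : OOGraph.Fourientation G) where
  open OOGraph G

  -- C is bad with respect to (X , δ); t is unoriented for cuts and
  -- bioriented for cycles.
  BadMinEdge : (t : Status) (X : Status → Bool) (δ : Sign) → Pred 𝔼 0ℓ → Set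
  BadMinEdge t X δ A = ∃[ e ] IsMin (edgesOf A) e
                     × X (status 𝒪 e) ≡ true
                     × (status 𝒪 e ≡ t → (e , δ) ∈ A)

  -- C contains an oriented edge, and the minimum such edge is oriented
  -- as eˢ.
  MinOriented : Sign → Pred 𝔼 0ℓ → Set
  MinOriented s A = ∃[ e ] IsMin (λ f → f ∈ edgesOf A × IsOriented 𝒪 f) e
                  × status 𝒪 e ≡ oriented s

  MinEdgeCutGood : (Status → Bool) → Sign → Set
  MinEdgeCutGood X δ = ∀ Cu → PotentialCut G 𝒪 Cu →
    ¬ BadMinEdge unoriented X δ (Cut.𝔼Cu Cu)

  MinEdgeCycleGood : (Status → Bool) → Sign → Set
  MinEdgeCycleGood X δ = ∀ Cy → PotentialCycle G 𝒪 Cy →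
    ¬ BadMinEdge bioriented X δ (Cycle.𝔼Cy Cy)

  CutWeirdGood CutCoWeirdGood CycleWeirdGood CycleCoWeirdGood : Set
  CutWeirdGood     = ∀ Cu → PotentialCut   G 𝒪 Cu → MinOriented + (Cut.𝔼Cu   Cu)
  CutCoWeirdGood   = ∀ Cu → PotentialCut   G 𝒪 Cu → MinOriented - (Cut.𝔼Cu   Cu)
  CycleWeirdGood   = ∀ Cy → PotentialCycle G 𝒪 Cy → MinOriented + (Cycle.𝔼Cy Cy)
  CycleCoWeirdGood = ∀ Cy → PotentialCycle G 𝒪 Cy → MinOriented - (Cycle.𝔼Cy Cy)

module _ (P : FourientationProperty) where
  open FourientationProperty P

  GoodExactlyWhen : (∀ G → OOGraph.Fourientation G → Set) → Set₁
  GoodExactlyWhen Q = ∀ G (𝒪 : OOGraph.Fourientation G) → Good G 𝒪 ⇔ Q G 𝒪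

  -- X bioriented ≡ false says X ⊆ {∅ , {-} , {+}}.
  IsMinEdgeCutProperty : Set₁
  IsMinEdgeCutProperty = Σ[ X ∈ (Status → Bool) ] Σ[ δ ∈ Sign ]
    X bioriented ≡ false × GoodExactlyWhen (λ G 𝒪 → MinEdgeCutGood G 𝒪 X δ)

  -- X unoriented ≡ false says X ⊆ {{-} , {+} , {- , +}}.
  IsMinEdgeCycleProperty : Set₁
  IsMinEdgeCycleProperty = Σ[ X ∈ (Status → Bool) ] Σ[ δ ∈ Sign ]
    X unoriented ≡ false × GoodExactlyWhen (λ G 𝒪 → MinEdgeCycleGood G 𝒪 X δ)

  IsCutWeird IsCutCoWeird IsCycleWeird IsCycleCoWeird : Set₁
  IsCutWeird     = GoodExactlyWhen CutWeirdGood
  IsCutCoWeird   = GoodExactlyWhen CutCoWeirdGood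
  IsCycleWeird   = GoodExactlyWhen CycleWeirdGood
  IsCycleCoWeird = GoodExactlyWhen CycleCoWeirdGood

{-# OPTIONS --safe #-}

-- A cut (cycle) property is determined by its values on bonds (cycles), that
-- is, on words recording the order, the directions and the statuses of the
-- edges.  By T1 and T2, adding a maximum letter to a good word gives a good
-- word, and adding it to a bad word gives a word whose value is forced, except
-- when all letters before it are free (unoriented for cuts, bioriented for
-- cycles): then exactly one of its two orientations is bad, but T2 does not
-- say which.  Applying T2 (b) to a triangle with multiple edges, or to a cycle
-- with a chord, compares these choices for three circuits that share edges
-- pairwise.  Starting from the words with one free letter, the comparison shows
-- by induction that either the bad direction is determined by the minimum
-- letter, or the bad sign is constant.  In the latter case it also shows that
-- a first letter of this sign is bad and one of the other sign is good, so the
-- property is weird or co-weird.  General potential cuts (cycles) reduce to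
-- simple ones because they contain one through any prescribed edge.

module Submission where

open import Defs
open import Data.Bool.Base using (Bool; true; false; not; _∨_; _∧_; if_then_else_)
import Data.Bool.Properties as Bool
open import Data.Bool.Properties using (∨-identityʳ; ∨-zeroʳ; not-involutive)
open import Data.Empty using (⊥; ⊥-elim)
open import Data.Fin.Base using (Fin; zero; suc; cast; inject₁; fromℕ)
open import Data.Fin.Induction using (<-weakInduction; <-weakInduction-startingFrom)
open import Data.Fin.Properties using (_≟_; any?; cast-is-id; cast-trans; ≤fromℕ; suc-injective)
open import Data.Fin.Relation.Unary.Top using (view; ‵fromℕ; ‵inject₁; view-fromℕ; view-inject₁)
open import Data.Fin.Subset as Sub using (Subset; Nonempty; inside; outside)
open import Data.Fin.Subset.Properties
  using (p⊂q⇒∣p∣<∣q∣; ∣p∣≤n; p⊆p∪q; q⊆p∪q; x∈p∪q⁻; x∈⁅x⁆; x∈⁅y⁆⇒x≡y)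
open import Data.List.Base
  using (List; []; _∷_; _++_; [_]; map; reverse; length; lookup; tabulate; filter; allFin)
open import Data.List.Membership.DecPropositional as DecMem using ()
open import Data.List.Membership.Propositional using () renaming (_∈_ to _∈ˡ_; _∉_ to _∉ˡ_)
open import Data.List.Membership.Propositional.Properties
  using (∈-++⁺ˡ; ∈-++⁺ʳ; ∈-++⁻; ∈-map⁺; ∈-map⁻; ∈-∃++; ∈-lookup; ∈-tabulate⁺; ∈-tabulate⁻;
         ∈-filter⁺; ∈-filter⁻; ∈-allFin)
open import Data.List.Properties
  using (++-assoc; ++-identityʳ; map-++; map-cong; map-cong-local; map-∘; map-id; map-tabulate;
         tabulate-cong; tabulate-lookup; lookup-tabulate; length-tabulate; reverse-map;
         unfold-reverse; ∷-injectiveˡ; ∷-injectiveʳ)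
import Data.List.Relation.Binary.Permutation.Propositional.Properties as Perm
import Data.List.Relation.Binary.Permutation.Setoid.Properties as PermS
open import Data.List.Relation.Binary.Permutation.Propositional
  using (_↭_; ↭⇒↭ₛ; ↭-sym; ↭-trans; ↭-reflexive; prep)
open import Data.List.Relation.Unary.All as All using (All; []; _∷_)
import Data.List.Relation.Unary.All.Properties as Allₚ
import Data.List.Relation.Unary.AllPairs as AllPairs
open import Data.List.Relation.Unary.AllPairs using ([]; _∷_)
open import Data.List.Relation.Unary.Any as Any using (Any; here; there)
import Data.List.Relation.Unary.Any.Properties as Anyₚ
import Data.List.Relation.Unary.Unique.DecPropositional as DecUnique
open import Data.List.Relation.Unary.Unique.Propositional using (Unique)
import Data.List.Relation.Unary.Unique.Propositional.Properties as Uniqueₚ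
open import Data.Nat.Base as ℕ using (ℕ; zero; suc; z≤n; s≤s)
import Data.Nat.Properties as ℕ
open import Data.Product.Base using (∃; ∃-syntax; Σ-syntax; _×_; _,_; proj₁; proj₂)
open import Data.Product.Properties using (,-injectiveˡ; ,-injectiveʳ)
open import Data.Sign.Base using (Sign; +; -; opposite; _*_)
import Data.Sign.Properties as Sign
open import Data.Sign.Properties using (opposite-involutive; s*s≡+) renaming (_≟_ to _≟ˢ_)
open import Data.Sum.Base using (_⊎_; inj₁; inj₂)
open import Data.Vec.Base as Vec using ([]; _∷_)
import Data.Vec.Properties as Vecₚ
open import Data.Vec.Properties using ([]=⇒lookup; lookup⇒[]=; lookup-map; lookup∘tabulate)
open import Function.Base using (_∘_; id)
open import Function.Bundles using (_⇔_; _↔_; mk⇔; mk↔ₛ′; Equivalence; Inverse)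
open import Function.Definitions using (Injective)
open import Function.Properties.Inverse using (↔-refl)
open import Level using (0ℓ)
open import Relation.Binary.Construct.Closure.ReflexiveTransitive as Star using (Star; ε; _◅_; _◅◅_)
open import Relation.Binary.Core using (Rel)
open import Relation.Binary.Definitions using (Tri; tri<; tri≈; tri>)
open import Relation.Binary.PropositionalEquality hiding ([_])
open import Relation.Binary.Structures using (IsStrictTotalOrder)
open import Relation.Nullary using (¬_; ¬?; yes; no; Dec; contradiction; does)
open import Relation.Nullary.Decidable using (dec-true; dec-false; _×-dec_)
open import Relation.Unary using (Pred; ∁; ｛_｝; _∈_; Decidable)

-- Cuts and cycles are classified together: the argument on words sees only a function `f`
-- satisfying `Rules`. For cycles the order of the letters matters, so words may be rotated and
-- mirrored but not sorted; therefore every induction rotates the maximum letter to the front and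
-- removes it. In a graph that consists of one circuit, T2 leaves a sign open whenever an oriented
-- letter is put above free ones, and no such graph relates two of these choices. A graph with three
-- circuits does. Two of them pass through the maximum edge e. When the third is good, the graph is
-- good with e blocked, so T2 leaves some orientation of e good, whether the minor is good (a) or
-- bad (b). Hence the two circuits through e cannot forbid opposite orientations. To use this, the
-- circuits must have known values, and badness spreads from a known word only to compatible letters
-- with larger keys. This is why letters are duplicated with larger keys, or rekeyed above the part
-- A that is already understood.

open Equivalence using (to; from)

-- Words

-- A word lists the edges of a bond (in any order) or of a cycle (in cyclic
-- order).  The key gives the position in the edge order, the edge is directed
-- along the bond or cycle as e^dir, and the mark is its status: free edges
-- impose no condition on a potential cut or cycle, blocked ones exclude it.
data Mark : Set where
  free blocked : Mark
  or           : Sign → Mark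

record Letter : Set where
  constructor ⟨_,_,_⟩
  field
    key  : ℕ
    dir  : Sign
    mark : Mark
open Letter public

flip : Letter → Letter
flip ⟨ k , d , m ⟩ = ⟨ k , opposite d , m ⟩

rekey : (ℕ → ℕ) → Letter → Letter
rekey g ⟨ k , d , m ⟩ = ⟨ g k , d , m ⟩

StrictMono : (ℕ → ℕ) → Set
StrictMono g = ∀ {i j} → i ℕ.< j → g i ℕ.< g j

-- D is + or - as the potential circuit follows the word or its mirror image.
data Compat (D : Sign) (y : Letter) : Set where
  inert   : mark y ≡ free           → Compat D y
  aligned : mark y ≡ or (D * dir y) → Compat D y

Oriented : Letter → Set
Oriented y = ∃[ s ] mark y ≡ or s

infix 4 _≺_ _≻_
_≺_ _≻_ : List Letter → ℕ → Set
l ≺ k = All (λ y → key y ℕ.< k) l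
l ≻ k = All (λ y → k ℕ.< key y) l

UniqueKeys : List Letter → Set
UniqueKeys l = Unique (map key l)

MinKey : Letter → List Letter → Set
MinKey y l = y ∈ˡ l × All (λ z → key y ℕ.≤ key z) l

MinEdgeBad : (Mark → Bool) → Sign → List Letter → Set
MinEdgeBad X δ l = ∃[ D ] All (Compat D) l × ∃[ y ] MinKey y l × X (mark y) ≡ true × (mark y ≡ free → D ≡ δ * dir y)

WeirdBad : Sign → List Letter → Set
WeirdBad s l = l ≢ [] × ∃[ D ] All (Compat D) l ×
  (∀ y → y ∈ˡ l → Oriented y → (∀ z → z ∈ˡ l → Oriented z → key y ℕ.≤ key z) → mark y ≡ or s)

-- The chord rule is T2 (b) for a triangle with multiple edges, or for a cycle
-- with a chord b.  Its three circuits are e P A Q, e P b Q and A b⁻¹.  If the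
-- last one is good, then the first two must force the same sign on the maximum
-- edge e.
record Rules (f : List Letter → Bool) : Set where
  field
    empty-good : f [] ≡ true
    rekey-inv  : ∀ g → StrictMono g → ∀ l → f (map (rekey g) l) ≡ f l
    rotate     : ∀ u v → f (u ++ v) ≡ f (v ++ u)
    mirror     : ∀ l → f (reverse (map flip l)) ≡ f l
    bad-unique : ∀ l → f l ≡ false → UniqueKeys l
    bad-compat : ∀ l → f l ≡ false → ∃[ D ] All (Compat D) l
    max-free   : ∀ k d y l → y ∷ l ≺ k → f (⟨ k , d , free ⟩ ∷ y ∷ l) ≡ f (y ∷ l)
    max-good   : ∀ k d s y l → y ∷ l ≺ k → f (y ∷ l) ≡ true → f (⟨ k , d , or s ⟩ ∷ y ∷ l) ≡ true
    max-bad    : ∀ k d y l → y ∷ l ≺ k → f (y ∷ l) ≡ false →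
                 ∃[ s ] f (⟨ k , d , or s ⟩ ∷ y ∷ l) ≡ false × f (⟨ k , d , or (opposite s) ⟩ ∷ y ∷ l) ≡ true
    chord      : ∀ k d s P A b Q → A ≢ [] → (P ++ A ++ b ∷ Q) ≺ k → key b ∉ˡ map key A →
                 f (⟨ k , d , or s ⟩ ∷ P ++ A ++ Q) ≡ false → f (A ++ [ flip b ]) ≡ true →
                 f (⟨ k , d , or (opposite s) ⟩ ∷ P ++ b ∷ Q) ≡ false → ⊥

-- Signs, compatibility and extremal letters.

sense : ∀ D d → D * (D * d) ≡ d
sense + d = refl
sense - + = refl
sense - - = refl

*-cancelʳ : ∀ {D D′} d → D * d ≡ D′ * d → D ≡ D′
*-cancelʳ {+} {+} d eq = refl
*-cancelʳ { - } { - } d eq = refl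
*-cancelʳ {+} { - } + ()
*-cancelʳ {+} { - } - ()
*-cancelʳ { - } {+} + ()
*-cancelʳ { - } {+} - ()

≢⇒opposite : ∀ {s t : Sign} → s ≢ t → s ≡ opposite t
≢⇒opposite {+} {+} ne = contradiction refl ne
≢⇒opposite {+} { - } ne = refl
≢⇒opposite { - } {+} ne = refl
≢⇒opposite { - } { - } ne = contradiction refl ne

s≢opp : ∀ {s} → s ≢ opposite s
s≢opp {+} ()
s≢opp { - } ()

or-injective : ∀ {s t} → or s ≡ or t → s ≡ t
or-injective refl = refl

sign-cases : ∀ s t → t ≡ s ⊎ t ≡ opposite s
sign-cases + + = inj₁ refl
sign-cases + - = inj₂ refl
sign-cases - + = inj₂ refl
sign-cases - - = inj₁ refl

-- The sign of an oriented letter `y` equals `D * dir y`, and `dir y` cancels.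
compat-unique : ∀ {D D′ l} → All (Compat D) l → All (Compat D′) l → Any Oriented l → D ≡ D′
compat-unique {D} {D′} (_ ∷ c) (_ ∷ c′) (there o) = compat-unique {D} {D′} c c′ o
compat-unique {l = y ∷ _} (inert m ∷ _) (_ ∷ _) (here (s , o)) with trans (sym m) o
... | ()
compat-unique {l = y ∷ _} (aligned _ ∷ _) (inert m ∷ _) (here (s , o)) with trans (sym m) o
... | ()
compat-unique {l = y ∷ _} (aligned m ∷ _) (aligned m′ ∷ _) (here _) = *-cancelʳ (dir y) (or-injective (trans (sym m) m′))

-- Compatibility excludes blocked letters. This is the case distinction of the inductions below:
-- either an oriented letter fixes the direction, or the word is a free prefix whose bad sign has to
-- be determined.
oriented-or-free : ∀ {D} l → All (Compat D) l → Any Oriented l ⊎ All (λ y → mark y ≡ free) l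
oriented-or-free [] [] = inj₂ []
oriented-or-free (y ∷ l) (aligned o ∷ c) = inj₁ (here (_ , o))
oriented-or-free {D} (y ∷ l) (inert m ∷ c) with oriented-or-free {D} l c
... | inj₁ o = inj₁ (there o)
... | inj₂ a = inj₂ (m ∷ a)

module _ {a p} {A : Set a} {P : A → Set p} where
  All-swap : ∀ u {v} → All P (u ++ v) → All P (v ++ u)
  All-swap u h = Allₚ.++⁺ (Allₚ.++⁻ʳ u h) (Allₚ.++⁻ˡ u h)

  Any-swap : ∀ u {v} → Any P (u ++ v) → Any P (v ++ u)
  Any-swap u {v} h with Anyₚ.++⁻ u h
  ... | inj₁ x = Anyₚ.++⁺ʳ v x
  ... | inj₂ x = Anyₚ.++⁺ˡ x

↭-UniqueKeys : ∀ {l l′} → l ↭ l′ → UniqueKeys l → UniqueKeys l′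
↭-UniqueKeys p = PermS.Unique-resp-↭ (setoid ℕ) (↭⇒↭ₛ (Perm.map⁺ key p))

-- The remainder is written `q ++ p` because this is the order in which it follows `x` after
-- rotating `x` to the front.
max-split : ∀ y l → UniqueKeys (y ∷ l) →
  ∃[ p ] ∃[ x ] ∃[ q ] y ∷ l ≡ p ++ x ∷ q × (q ++ p) ≺ key x
max-split y [] u = [] , y , [] , refl , []
max-split y (z ∷ l) (h ∷ u) with max-split z l u
... | p , x , q , eq , lt with ℕ.<-cmp (key y) (key x)
... | tri< y<x _ _ = y ∷ p , x , q , cong (y ∷_) eq , Allₚ.++⁺ (Allₚ.++⁻ˡ q lt) (y<x ∷ Allₚ.++⁻ʳ q lt)
... | tri≈ _ y≡x _ = contradiction y≡x
        (All.lookup h (∈-map⁺ key (subst (x ∈ˡ_) (sym eq) (∈-++⁺ʳ p (here refl)))))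
... | tri> _ _ x<y = [] , y , z ∷ l , refl ,
        subst (_≺ key y) (sym (trans (++-identityʳ _) eq))
          (Allₚ.++⁺ (All.map (λ k → ℕ.<-trans k x<y) (Allₚ.++⁻ʳ q lt))
            (x<y ∷ All.map (λ k → ℕ.<-trans k x<y) (Allₚ.++⁻ˡ q lt)))

min-split : ∀ y l → UniqueKeys (y ∷ l) →
  ∃[ x ] ∃[ p ] ∃[ q ] y ∷ l ≡ p ++ x ∷ q × (p ++ q) ≻ key x
min-split y [] u = y , [] , [] , refl , []
min-split y (z ∷ l) (h ∷ u) with min-split z l u
... | x , p , q , eq , lt with ℕ.<-cmp (key y) (key x)
... | tri> _ _ x<y = x , y ∷ p , q , cong (y ∷_) eq , x<y ∷ lt
... | tri≈ _ y≡x _ = contradiction y≡x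
        (All.lookup h (∈-map⁺ key (subst (x ∈ˡ_) (sym eq) (∈-++⁺ʳ p (here refl)))))
... | tri< y<x _ _ = y , [] , z ∷ l , refl ,
        subst (_≻ key y) (sym eq)
          (Allₚ.++⁺ (All.map (ℕ.<-trans y<x) (Allₚ.++⁻ˡ p lt))
            (y<x ∷ All.map (ℕ.<-trans y<x) (Allₚ.++⁻ʳ p lt)))

max≢min : ∀ l → l ≢ [] → ∀ {k} → l ≺ k → ¬ All (λ z → k ℕ.≤ key z) l
max≢min []      ne _         _         = ne refl
max≢min (w ∷ l) ne (w<k ∷ _) (k≤w ∷ _) = ℕ.<⇒≱ w<k k≤w

-- Lets a rekeyed copy of the minimum letter `y` serve as the chord `flip x`.
rekey-flip : ∀ g y x → g (key y) ≡ key x → dir x ≢ dir y → mark x ≡ free → mark y ≡ free → rekey g y ≡ flip x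
rekey-flip g ⟨ _ , _ , _ ⟩ ⟨ _ , _ , _ ⟩ refl ne refl refl = cong (λ t → ⟨ _ , t , free ⟩) (≢⇒opposite (ne ∘ sym))

opposite-sense : ∀ (δ a b c : Sign) → a ≡ b → δ * opposite a * c ≡ opposite (δ * b * c)
opposite-sense + + _ c refl = refl
opposite-sense + - _ c refl = sym (opposite-involutive c)
opposite-sense - + _ c refl = sym (opposite-involutive c)
opposite-sense - - _ c refl = refl

-- The classification of words

module Consequences (f : List Letter → Bool) (rules : Rules f) where
  open Rules rules

  Bad Good : List Letter → Set
  Bad l  = f l ≡ false
  Good l = f l ≡ true

  good? : ∀ l → Good l ⊎ Bad l
  good? l with f l
  ... | true  = inj₁ refl
  ... | false = inj₂ refl

  ¬good : ∀ {l} → Good l → Bad l → ⊥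
  ¬good g b with trans (sym g) b
  ... | ()

  rot : ∀ u v → Bad (u ++ v) → Bad (v ++ u)
  rot u v = trans (rotate v u)

  rotᵍ : ∀ u v → Good (u ++ v) → Good (v ++ u)
  rotᵍ u v = trans (rotate v u)

  -- Above a bad word the maximum letter has exactly one bad sign, so its value at one sign settles
  -- the other; `other-bad` is the converse reading.
  other-good : ∀ k d s l → l ≺ k → Bad l → Bad (⟨ k , d , or s ⟩ ∷ l) → Good (⟨ k , d , or (opposite s) ⟩ ∷ l)
  other-good k d s [] lt bad _ = ⊥-elim (¬good empty-good bad)
  other-good k d s (y ∷ l) lt bad b with max-bad k d y l lt bad
  ... | t , bt , gt with s ≟ˢ t
  ... | yes refl = gt
  ... | no s≢t = ⊥-elim (¬good (subst (λ r → Good (⟨ k , d , or r ⟩ ∷ y ∷ l)) (sym (≢⇒opposite s≢t)) gt) b)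

  other-bad : ∀ k d s l → l ≺ k → Bad l → Good (⟨ k , d , or s ⟩ ∷ l) → Bad (⟨ k , d , or (opposite s) ⟩ ∷ l)
  other-bad k d s [] lt bad _ = ⊥-elim (¬good empty-good bad)
  other-bad k d s (y ∷ l) lt bad g with max-bad k d y l lt bad
  ... | t , bt , gt with opposite s ≟ˢ t
  ... | yes refl = bt
  ... | no s≢t = ⊥-elim (¬good g (subst (λ r → Bad (⟨ k , d , or r ⟩ ∷ y ∷ l))
                   (sym (trans (sym (opposite-involutive s)) (trans (cong opposite (≢⇒opposite s≢t)) (opposite-involutive t)))) bt))

  -- `max-bad` makes one sign of the new letter bad. The resulting bad word has a direction, and the
  -- oriented letter of `l` forces it to be `D`, so the bad sign is the compatible one.
  append : ∀ {D} x l → l ≺ key x → Any Oriented l → All (Compat D) l → Compat D x → Bad l → Bad (x ∷ l)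
  append ⟨ k , d , _ ⟩ [] lt () c cx bad
  append ⟨ k , d , _ ⟩ (y ∷ l) lt o c (inert refl) bad = trans (max-free k d y l lt) bad
  append {D} ⟨ k , d , _ ⟩ (y ∷ l) lt o c (aligned refl) bad with max-bad k d y l lt bad
  ... | t , bt , gt with bad-compat _ bt
  ... | D′ , aligned eq ∷ c′ with compat-unique {D} {D′} c c′ o
  ... | refl = subst (λ m → Bad (⟨ k , d , m ⟩ ∷ y ∷ l)) eq bt

  bad-tail : ∀ x y l → y ∷ l ≺ key x → Bad (x ∷ y ∷ l) → Bad (y ∷ l)
  bad-tail ⟨ k , d , _ ⟩ y l lt b with good? (y ∷ l) | bad-compat _ b
  ... | inj₂ b′ | _                = b′
  ... | inj₁ g  | _ , inert refl ∷ _ = trans (sym (max-free k d y l lt)) b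
  ... | inj₁ g  | _ , aligned refl ∷ _ = ⊥-elim (¬good (max-good k d _ y l lt g) b)

  -- A parallel copy of an oriented letter is compatible with whatever direction the word has, so
  -- `append` applies without knowing that direction.
  append-twin : ∀ {k k′ d s} l → All (λ y → key y ℕ.< k′) (⟨ k , d , or s ⟩ ∷ l) →
    Bad (⟨ k , d , or s ⟩ ∷ l) → Bad (⟨ k′ , d , or s ⟩ ∷ ⟨ k , d , or s ⟩ ∷ l)
  append-twin l lt bad with bad-compat _ bad
  ... | D , aligned eq ∷ c = append {D} _ _ lt (here (_ , refl)) (aligned eq ∷ c) (aligned eq) bad

  -- The maximum `x` of `C` is also the maximum of the whole word, since `C` lies above `A`. Rotated
  -- to the front it can be removed by `append`. The bound `n` drives the recursion because what
  -- remains of `C` is not a structural part of it.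
  extend : ∀ {D} n C → length C ℕ.≤ n → ∀ A → UniqueKeys C → Any Oriented A → All (Compat D) A → All (Compat D) C →
           All (λ c → A ≺ key c) C → Bad A → Bad (A ++ C)
  extend n [] len A u o cA cC lt bad = subst Bad (sym (++-identityʳ A)) bad
  extend (suc n) (c ∷ C) (s≤s len) A u o cA cC lt bad with max-split c C u
  ... | p , x , q , eq , q≺x = result
    where
    u′ : UniqueKeys (x ∷ q ++ p)
    u′ = ↭-UniqueKeys (Perm.++-comm p (x ∷ q)) (subst UniqueKeys eq u)
    u″ : UniqueKeys (p ++ q)
    u″ with u′
    ... | _ ∷ v = ↭-UniqueKeys (Perm.++-comm q p) v
    swapped : ∀ {P : Letter → Set} → All P (c ∷ C) → All P (x ∷ q ++ p)
    swapped {P} h = All-swap p (subst (All P) eq h)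
    drop-x : ∀ {P : Letter → Set} → All P (c ∷ C) → All P (p ++ q)
    drop-x h with swapped h
    ... | _ ∷ t = All-swap q t
    len′ : length (p ++ q) ℕ.≤ n
    len′ = ℕ.≤-trans (ℕ.≤-reflexive (ℕ.suc-injective
      (trans (cong suc (Perm.↭-length (Perm.++-comm p q)))
        (trans (sym (Perm.↭-length (Perm.++-comm p (x ∷ q)))) (cong length (sym eq)))))) len
    ih : Bad (q ++ A ++ p)
    ih = rot (A ++ p) q (subst Bad (sym (++-assoc A p q)) (extend n (p ++ q) len′ A u″ o cA (drop-x cC) (drop-x lt) bad))
    x≻ : (q ++ A ++ p) ≺ key x
    x≻ = Allₚ.++⁺ (Allₚ.++⁻ˡ q q≺x) (Allₚ.++⁺ (All.head (swapped lt)) (Allₚ.++⁻ʳ q q≺x))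
    compat : All (Compat _) (q ++ A ++ p)
    compat = Allₚ.++⁺ (Allₚ.++⁻ʳ p (drop-x cC)) (Allₚ.++⁺ cA (Allₚ.++⁻ˡ p (drop-x cC)))
    result : Bad (A ++ c ∷ C)
    result = subst (λ z → Bad (A ++ z)) (sym eq) (subst Bad (++-assoc A p (x ∷ q))
      (rot (x ∷ q) (A ++ p) (append x (q ++ A ++ p) x≻ (Anyₚ.++⁺ʳ q (Anyₚ.++⁺ˡ o)) compat (All.head (swapped cC)) ih)))

  -- Closure under rotation replaces sorting: the maximum letter is brought to the front and added
  -- last. As in `extend`, `n` bounds the length for termination.
  max-induction : (P : List Letter → Set) → (∀ u v → P (u ++ v) → P (v ++ u)) → (∀ x → P (x ∷ [])) →
    (∀ x y l → y ∷ l ≺ key x → UniqueKeys (y ∷ l) → P (y ∷ l) → P (x ∷ y ∷ l)) →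
    ∀ n y l → length l ℕ.≤ n → UniqueKeys (y ∷ l) → P (y ∷ l)
  max-induction P swap base step zero y [] z≤n u = base y
  max-induction P swap base step (suc n) y l len u with max-split y l u
  ... | p , x , q , eq , lt = subst P (sym eq) (swap (x ∷ q) p (go (q ++ p) refl))
    where
    u′ : UniqueKeys (x ∷ q ++ p)
    u′ = ↭-UniqueKeys (Perm.++-comm p (x ∷ q)) (subst UniqueKeys eq u)
    len′ : length (q ++ p) ℕ.≤ suc n
    len′ = ℕ.≤-trans (ℕ.≤-reflexive (ℕ.suc-injective
        (trans (sym (Perm.↭-length (Perm.++-comm p (x ∷ q)))) (cong length (sym eq))))) len
    go : ∀ r → r ≡ q ++ p → P (x ∷ r)
    go [] _ = base x
    go (z ∷ r) e with u′ | subst (λ t → length t ℕ.≤ suc n) (sym e) len′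
    ... | _ ∷ v | s≤s len″ = step x z r (subst (_≺ key x) (sym e) lt) (subst UniqueKeys (sym e) v)
            (max-induction P swap base step n z r len″ (subst UniqueKeys (sym e) v))

  -- Shifting all keys accounts for `k`; mirroring a single letter merely flips `d`.
  one-letter : ∀ k d m → f [ ⟨ k , d , m ⟩ ] ≡ f [ ⟨ 0 , + , m ⟩ ]
  one-letter k + m = trans (cong (λ j → f [ ⟨ j , + , m ⟩ ]) (sym (ℕ.+-identityʳ k)))
    (rekey-inv (k ℕ.+_) (ℕ.+-monoʳ-< k) [ ⟨ 0 , + , m ⟩ ])
  one-letter k - m = trans (mirror [ ⟨ k , + , m ⟩ ]) (one-letter k + m)

  two : ℕ → ℕ → Sign → Sign → Sign → List Letter
  two k₁ k₂ d₁ d₂ s = ⟨ k₂ , d₂ , or s ⟩ ∷ ⟨ k₁ , d₁ , free ⟩ ∷ []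

  two-rekey : ∀ {k₁ k₂} → k₁ ℕ.< k₂ → ∀ d₁ d₂ s → f (two k₁ k₂ d₁ d₂ s) ≡ f (two 0 1 d₁ d₂ s)
  two-rekey {k₁} {k₂} lt d₁ d₂ s = trans (cong (λ j → f (two k₁ j d₁ d₂ s)) (sym (ℕ.+-identityʳ k₂)))
    (rekey-inv g mono (two 0 1 d₁ d₂ s))
    where
    -- The keys 0 and 1 go to `k₁` and `k₂`; the values beyond 1 only keep `g` strictly increasing.
    g : ℕ → ℕ
    g zero    = k₁
    g (suc k) = k₂ ℕ.+ k
    mono : StrictMono g
    mono {zero}  {suc j} _         = ℕ.<-≤-trans lt (ℕ.m≤m+n k₂ j)
    mono {suc i} {suc j} (s≤s i<j) = ℕ.+-monoʳ-< k₂ i<j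

  two-mirror : ∀ d₁ d₂ s → f (two 0 1 (opposite d₁) (opposite d₂) s) ≡ f (two 0 1 d₁ d₂ s)
  two-mirror d₁ d₂ s = trans (rotate [ _ ] [ _ ]) (mirror (two 0 1 d₁ d₂ s))

  -- The sign `δ * d₁ * d₂` is compatible with the direction D = `δ * d₁`, in which the free edge is
  -- traversed as e^(D * d₁) = e^δ. This is condition (ii) of a min-edge property for the free
  -- minimum.
  MinEdgeRule WeirdRule : Sign → Set
  MinEdgeRule δ = ∀ d₁ d₂ → Bad (two 0 1 d₁ d₂ (δ * d₁ * d₂))
  WeirdRule s   = ∀ d₁ d₂ → Bad (two 0 1 d₁ d₂ s)

  -- Mirroring reduces to `d₁ = +`, where `max-bad` names a bad sign for each of the two values of
  -- `d₂`. Different signs follow the direction of the free letter, equal signs ignore it.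
  two-letter-cases : Bad [ ⟨ 0 , + , free ⟩ ] → ∃ MinEdgeRule ⊎ ∃ WeirdRule
  two-letter-cases bad with max-bad 1 + ⟨ 0 , + , free ⟩ [] (s≤s z≤n ∷ []) bad
                          | max-bad 1 - ⟨ 0 , + , free ⟩ [] (s≤s z≤n ∷ []) bad
  ... | + , b , _ | + , b′ , _ = inj₂ (+ , λ { + + → b ; + - → b′
        ; - + → trans (two-mirror + - +) b′ ; - - → trans (two-mirror + + +) b })
  ... | - , b , _ | - , b′ , _ = inj₂ (- , λ { + + → b ; + - → b′
        ; - + → trans (two-mirror + - -) b′ ; - - → trans (two-mirror + + -) b })
  ... | + , b , _ | - , b′ , _ = inj₁ (+ , λ { + + → b ; + - → b′
        ; - + → trans (two-mirror + - -) b′ ; - - → trans (two-mirror + + +) b })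
  ... | - , b , _ | + , b′ , _ = inj₁ (- , λ { + + → b ; + - → b′
        ; - + → trans (two-mirror + - +) b′ ; - - → trans (two-mirror + + -) b })

  module FreeBad (free-bad₁ : Bad [ ⟨ 0 , + , free ⟩ ]) where

    -- A free maximum does not change the value of the letters below it, so all such words inherit
    -- the value of a single free letter.
    free-bad : ∀ y l → UniqueKeys (y ∷ l) → All (λ y → mark y ≡ free) (y ∷ l) → Bad (y ∷ l)
    free-bad y l = max-induction (λ l → All (λ y → mark y ≡ free) l → Bad l)
      (λ u v h a → rot u v (h (All-swap v a)))
      (λ { ⟨ k , d , _ ⟩ (refl ∷ []) → trans (one-letter k d free) free-bad₁ })
      (λ { ⟨ k , d , _ ⟩ y l lt u ih (refl ∷ a) → trans (max-free k d y l lt) (ih a) })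
      (length l) y l ℕ.≤-refl

    -- If the word free letters then ⟨ k , d , or s ⟩ were good for the sign s
    -- that the minimum letter y makes bad, move the largest free letter x to
    -- the chord: the circuit q a p (with a in place of the last letter) is bad
    -- by induction and forces the sign s on a new maximum letter.  The circuit
    -- through the chord forces the opposite sign: if x points as y, it is a
    -- word with one free letter, and otherwise it is a copy of the original
    -- word in which the chord takes the place of y.
    module MinEdge (δ : Sign) (rule : MinEdgeRule δ) where

      -- The chord rule for `A = q ++ a ∷ p` and chord `flip x`: then the third circuit is `A x`, a
      -- rotation of the good word `a p x q`. The letters of `Q`, `e`, `P` lie above `k`, hence
      -- above `A`, and `extend` makes the first circuit bad. The second circuit is left to the
      -- caller.
      closing : ∀ {D k d s} p x q P Q k′ → let a = ⟨ k , d , or s ⟩ ; A = q ++ a ∷ p in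
        (q ++ p) ≺ key x → key x ℕ.< k → k ℕ.< k′ → P ≺ k′ → Q ≺ k′ → P ≻ k → Q ≻ k →
        All (λ y → mark y ≡ free) P → All (λ y → mark y ≡ free) Q →
        All (Compat D) A → Bad A → Good (a ∷ p ++ x ∷ q) →
        Bad (⟨ k′ , d , or (opposite s) ⟩ ∷ P ++ flip x ∷ Q) → ⊥
      closing {D} {k} {d} {s} p x q P Q k′ lt x<k k<k′ P≺ Q≺ P≻ Q≻ Pf Qf cA badA good bad =
        chord k′ d s P A (flip x) Q (λ e → nonempty q e)
          (Allₚ.++⁺ P≺ (Allₚ.++⁺ (All.map (λ h → ℕ.≤-<-trans h k<k′) A≤k) (ℕ.<-trans x<k k<k′ ∷ Q≺)))
          x∉A
          (subst Bad (cong (e ∷_) refl) (rot (A ++ Q) (e ∷ P) (subst Bad (sym (++-assoc A Q (e ∷ P))) badAC)))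
          (subst Good eqA (rotᵍ (a ∷ p ++ [ x ]) q (subst Good (cong (a ∷_) (sym (++-assoc p [ x ] q))) good)))
          bad
        where
        nonempty : ∀ q → q ++ ⟨ k , d , or s ⟩ ∷ p ≢ []
        nonempty []      ()
        nonempty (_ ∷ _) ()
        a e : Letter
        a = ⟨ k , d , or s ⟩
        e = ⟨ k′ , d , or s ⟩
        A C : List Letter
        A = q ++ a ∷ p
        C = Q ++ e ∷ P
        qp≺k : (q ++ p) ≺ k
        qp≺k = All.map (λ h → ℕ.<-trans h x<k) lt
        A≤k : All (λ y → key y ℕ.≤ k) A
        A≤k = Allₚ.++⁺ (All.map ℕ.<⇒≤ (Allₚ.++⁻ˡ q qp≺k)) (ℕ.≤-refl ∷ All.map ℕ.<⇒≤ (Allₚ.++⁻ʳ q qp≺k))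
        A≢x : All (λ y → key y ≢ key x) A
        A≢x = Allₚ.++⁺ (All.map ℕ.<⇒≢ (Allₚ.++⁻ˡ q lt)) (ℕ.>⇒≢ x<k ∷ All.map ℕ.<⇒≢ (Allₚ.++⁻ʳ q lt))
        x∉A : key x ∉ˡ map key A
        x∉A m with ∈-map⁻ key m
        ... | y , y∈A , eq = All.lookup A≢x y∈A (sym eq)
        uC : UniqueKeys C
        uC with ↭-UniqueKeys (Perm.++-comm (⟨ k′ , d , or (opposite s) ⟩ ∷ P) (flip x ∷ Q)) (bad-unique _ bad)
        ... | _ ∷ u = subst Unique (trans (map-++ key Q (⟨ k′ , d , or (opposite s) ⟩ ∷ P)) (sym (map-++ key Q (e ∷ P)))) u
        aD : Compat D a
        aD = All.head (Allₚ.++⁻ʳ q cA)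
        eD : Compat D e
        eD with aD
        ... | aligned m = aligned m
        C≻k : All (λ c → k ℕ.< key c) C
        C≻k = Allₚ.++⁺ Q≻ (k<k′ ∷ P≻)
        badAC : Bad (A ++ C)
        badAC = extend (length C) C ℕ.≤-refl A uC (Anyₚ.++⁺ʳ q (here (s , refl))) cA
          (Allₚ.++⁺ (All.map inert Qf) (eD ∷ All.map inert Pf))
          (All.map (λ k<c → All.map (λ y≤k → ℕ.≤-<-trans y≤k k<c) A≤k) C≻k) badA
        eqA : q ++ a ∷ p ++ [ x ] ≡ A ++ [ flip (flip x) ]
        eqA = trans (sym (++-assoc q (a ∷ p) [ x ]))
          (cong (λ z → A ++ [ ⟨ key x , z , mark x ⟩ ]) (sym (opposite-involutive (dir x))))

      -- The sign is the one compatible with the direction `δ * dir y`, in which the minimum `y` is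
      -- traversed as e^δ.
      free-prefix : ∀ n l → length l ℕ.≤ n → ∀ y → All (λ y → mark y ≡ free) l → UniqueKeys l → MinKey y l →
        ∀ k d → l ≺ k → Bad (⟨ k , d , or (δ * dir y * d) ⟩ ∷ l)

      free-prefix-step : ∀ n p x q → (q ++ p) ≺ key x → q ++ p ≢ [] → length (q ++ p) ℕ.≤ n →
        ∀ y → All (λ y → mark y ≡ free) (p ++ x ∷ q) → UniqueKeys (p ++ x ∷ q) → Bad (p ++ x ∷ q) → MinKey y (p ++ x ∷ q) →
        ∀ k d → p ++ x ∷ q ≺ k → Bad (⟨ k , d , or (δ * dir y * d) ⟩ ∷ p ++ x ∷ q)

      free-prefix n [] len y fr u (() , _) k d lt
      free-prefix n (⟨ k₁ , d₁ , _ ⟩ ∷ []) len y (refl ∷ []) u (here refl , _) k d (lt ∷ []) =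
        trans (two-rekey lt d₁ d _) (rule d₁ d)
      free-prefix (suc n) l@(z ∷ z′ ∷ l′) (s≤s len) y fr u min k d lt with max-split z (z′ ∷ l′) u
      ... | p , x , q , eq , lx = subst (λ l → Bad (⟨ k , d , or (δ * dir y * d) ⟩ ∷ l)) (sym eq)
              (free-prefix-step n p x q lx
                (λ e → contradiction (trans len-qp (cong (suc ∘ length) e)) (λ ()))
                (subst (ℕ._≤ n) (ℕ.suc-injective len-qp) len)
                y (subst (All _) eq fr) (subst UniqueKeys eq u) (subst Bad eq (free-bad z (z′ ∷ l′) u fr))
                (subst (MinKey y) eq min) k d (subst (_≺ k) eq lt))
        where
        len-qp : length l ≡ suc (length (q ++ p))
        len-qp = trans (cong length eq) (Perm.↭-length (Perm.++-comm p (x ∷ q)))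

      free-prefix-step n p x q lx ne len y fr u bad-l (y∈ , y≤) k d lt = result
        where
        s D : Sign
        D = δ * dir y
        s = D * d
        cmpl : ∀ {P : Letter → Set} → All P (p ++ x ∷ q) → All P (p ++ q)
        cmpl h = Allₚ.++⁺ (Allₚ.++⁻ˡ p h) (All.tail (Allₚ.++⁻ʳ p h))
        u-qp : UniqueKeys (q ++ p)
        u-qp with ↭-UniqueKeys (Perm.++-comm p (x ∷ q)) u
        ... | _ ∷ v = v
        u-pq : UniqueKeys (p ++ q)
        u-pq = ↭-UniqueKeys (Perm.++-comm q p) u-qp
        len-pq : length (p ++ q) ℕ.≤ n
        len-pq = ℕ.≤-trans (ℕ.≤-reflexive (Perm.↭-length (Perm.++-comm p q))) len
        y≢x : ¬ y ≡ x
        y≢x refl = max≢min (q ++ p) ne lx (All-swap p (cmpl y≤))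
        y∈pq : y ∈ˡ p ++ q
        y∈pq with ∈-++⁻ p y∈
        ... | inj₁ h = ∈-++⁺ˡ h
        ... | inj₂ (here h) = contradiction h y≢x
        ... | inj₂ (there h) = ∈-++⁺ʳ p h
        a : Letter
        a = ⟨ k , d , or s ⟩
        x<k : key x ℕ.< k
        x<k = All.lookup lt (∈-++⁺ʳ p (here refl))
        -- Removing the maximum `x` keeps the minimum `y`, so the induction hypothesis yields the
        -- same bad sign `s`.
        badA : Bad (q ++ a ∷ p)
        badA = rot (a ∷ p) q (free-prefix n (p ++ q) len-pq y (cmpl fr) u-pq (y∈pq , cmpl y≤) k d (cmpl lt))
        cA : All (Compat D) (q ++ a ∷ p)
        cA = Allₚ.++⁺ (All.map inert (Allₚ.++⁻ʳ p (cmpl fr))) (aligned refl ∷ All.map inert (Allₚ.++⁻ˡ p fr))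
        x-free : mark x ≡ free
        x-free = All.lookup fr (∈-++⁺ʳ p (here refl))
        absurd : Good (a ∷ p ++ x ∷ q) → ⊥
        absurd good with dir x ≟ˢ dir y
        -- The second circuit has two letters, the new maximum and `flip x`. As `flip x` points
        -- against `y`, the two-letter rule makes the opposite of `s` bad.
        ... | yes dx≡dy = closing p x q [] [] (suc k) lx x<k ℕ.≤-refl [] [] [] [] [] [] cA badA good
                (subst₂ (λ m t → Bad (⟨ suc k , d , or t ⟩ ∷ ⟨ key x , opposite (dir x) , m ⟩ ∷ []))
                  (sym x-free) (opposite-sense δ (dir x) (dir y) d dx≡dy)
                  (trans (two-rekey (ℕ.m<n⇒m<1+n x<k) _ _ _) (rule (opposite (dir x)) d)))
        ... | no dx≢dy with ∈-∃++ y∈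
        -- Here `flip x` points as `y` does. The second circuit is the original word, rekeyed so
        -- that `y` becomes the chord. With the opposite sign it is bad, because with the sign `s`
        -- it is assumed good.
        ... | p₁ , p₂ , eq₂ = closing p x q (map (rekey g) p₁) (map (rekey g) p₂) (g k) lx x<k k<gk
                (g≺ (Allₚ.++⁻ˡ p₁ lt₂)) (g≺ (All.tail (Allₚ.++⁻ʳ p₁ lt₂)))
                (g≻ (Allₚ.++⁻ˡ p₁ y<₂)) (g≻ (Allₚ.++⁻ʳ p₁ y<₂))
                (g-free (Allₚ.++⁻ˡ p₁ fr₂)) (g-free (All.tail (Allₚ.++⁻ʳ p₁ fr₂)))
                cA badA good bad-g
          where
          ky kx : ℕ
          ky = key y
          kx = key x
          lt₂ : (p₁ ++ y ∷ p₂) ≺ k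
          lt₂ = subst (_≺ k) eq₂ lt
          fr₂ : All (λ y → mark y ≡ free) (p₁ ++ y ∷ p₂)
          fr₂ = subst (All _) eq₂ fr
          y<k : ky ℕ.< k
          y<k = All.lookup lt y∈
          y<₂ : (p₁ ++ p₂) ≻ ky
          y<₂ with ↭-UniqueKeys (Perm.shift y p₁ p₂) (subst UniqueKeys eq₂ u)
          ... | ne ∷ _ = All.zipWith (λ (≤y , ≢y) → ℕ.≤∧≢⇒< ≤y ≢y)
                 (Allₚ.++⁺ (Allₚ.++⁻ˡ p₁ y≤₂) (All.tail (Allₚ.++⁻ʳ p₁ y≤₂)) , Allₚ.map⁻ ne)
            where
            y≤₂ : All (λ z → ky ℕ.≤ key z) (p₁ ++ y ∷ p₂)
            y≤₂ = subst (All _) eq₂ y≤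
          -- Keys up to that of `y` are shifted so that `y` receives the key of `x`. The offset
          -- `suc k` lifts all other letters above `k`, the largest key of `A`, as `extend` demands.
          g : ℕ → ℕ
          g j with j ℕ.≤? ky
          ... | yes _ = j ℕ.+ (kx ℕ.∸ ky)
          ... | no  _ = j ℕ.+ suc k
          g-high : ∀ {j} → ky ℕ.< j → g j ≡ j ℕ.+ suc k
          g-high {j} y<j with j ℕ.≤? ky
          ... | yes j≤y = contradiction j≤y (ℕ.<⇒≱ y<j)
          ... | no _ = refl
          g-mono : StrictMono g
          g-mono {i} {j} i<j with i ℕ.≤? ky | j ℕ.≤? ky
          ... | yes _ | yes _ = ℕ.+-monoˡ-< (kx ℕ.∸ ky) i<j
          ... | yes _ | no  _ = ℕ.+-mono-< i<j (s≤s (ℕ.≤-trans (ℕ.m∸n≤m kx ky) (ℕ.<⇒≤ x<k)))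
          ... | no i≰ | yes j≤ = contradiction (ℕ.≤-trans (ℕ.<⇒≤ i<j) j≤) i≰
          ... | no  _ | no  _ = ℕ.+-monoˡ-< (suc k) i<j
          g-y : g ky ≡ kx
          g-y with ky ℕ.≤? ky
          ... | yes _ = ℕ.m+[n∸m]≡n (All.lookup y≤ (∈-++⁺ʳ p (here refl)))
          ... | no ¬r = contradiction ℕ.≤-refl ¬r
          k<gk : k ℕ.< g k
          k<gk = subst (k ℕ.<_) (sym (g-high y<k)) (ℕ.m≤n+m (suc k) k)
          g≺ : ∀ {l} → l ≺ k → map (rekey g) l ≺ g k
          g≺ h = Allₚ.map⁺ (All.map g-mono h)
          g≻ : ∀ {l} → l ≻ ky → map (rekey g) l ≻ k
          g≻ h = Allₚ.map⁺ (All.map (λ {z} y<z → subst (k ℕ.<_) (sym (g-high y<z)) (ℕ.m≤n+m (suc k) (key z))) h)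
          g-free : ∀ {l} → All (λ y → mark y ≡ free) l → All (λ y → mark y ≡ free) (map (rekey g) l)
          g-free h = Allₚ.map⁺ h
          y↦x : rekey g y ≡ flip x
          y↦x = rekey-flip g y x g-y dx≢dy x-free (All.lookup fr y∈)
          bad-g : Bad (⟨ g k , d , or (opposite s) ⟩ ∷ map (rekey g) p₁ ++ flip x ∷ map (rekey g) p₂)
          bad-g = subst (λ z → Bad (⟨ g k , d , or (opposite s) ⟩ ∷ z))
            (trans (map-++ (rekey g) p₁ (y ∷ p₂)) (cong (λ z → map (rekey g) p₁ ++ z ∷ map (rekey g) p₂) y↦x))
            (trans (rekey-inv g g-mono (⟨ k , d , or (opposite s) ⟩ ∷ p₁ ++ y ∷ p₂))
              (subst (λ z → Bad (⟨ k , d , or (opposite s) ⟩ ∷ z)) eq₂ (other-bad k d s _ lt bad-l good)))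
        result : Bad (a ∷ p ++ x ∷ q)
        result with good? (a ∷ p ++ x ∷ q)
        ... | inj₁ g = ⊥-elim (absurd g)
        ... | inj₂ b = b

    -- Here the chord is a copy b of the letter with the sign s, and the new
    -- maximum letter would be forced to agree both with e and with b.
    module Weird (s : Sign) (rule : WeirdRule s) where

      two-bad : ∀ {k₁ k₂} → k₁ ℕ.< k₂ → ∀ d₁ d₂ → Bad (two k₁ k₂ d₁ d₂ s)
      two-bad lt d₁ d₂ = trans (two-rekey lt d₁ d₂ s) (rule d₁ d₂)

      two-good : ∀ {k₁ k₂} → k₁ ℕ.< k₂ → ∀ d₁ d₂ → Good (two k₁ k₂ d₁ d₂ (opposite s))
      two-good {k₁} {k₂} lt d₁ d₂ = other-good k₂ d₂ s _ (lt ∷ [])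
        (trans (one-letter k₁ d₁ free) free-bad₁) (two-bad lt d₁ d₂)

      free-prefix : ∀ z l → All (λ y → mark y ≡ free) (z ∷ l) → UniqueKeys (z ∷ l) →
        ∀ k d → z ∷ l ≺ k → Bad (⟨ k , d , or s ⟩ ∷ z ∷ l)
      free-prefix ⟨ k₁ , d₁ , _ ⟩ [] (refl ∷ []) u k d (lt ∷ []) = two-bad lt d₁ d
      free-prefix z@(⟨ kz , dz , _ ⟩) (c ∷ l) (refl ∷ fr) (ne ∷ u) k d (z<k ∷ lt) with good? (⟨ k , d , or s ⟩ ∷ z ∷ c ∷ l)
      ... | inj₂ b = b
      -- `e`, `b` and the new maximum have keys k, k+1 and k+2. The circuit of `e`, `z` and the
      -- reversed chord is good because `e` has the good sign over the single free letter `z`. In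
      -- the other two circuits the new maximum is a twin of `e` and of `b`, respectively.
      ... | inj₁ g = ⊥-elim (chord (suc (suc k)) d (opposite s) [] (e ∷ z ∷ []) b (c ∷ l) (λ ())
              (k<2+k ∷ ℕ.<-trans z<k k<2+k ∷ ℕ.≤-refl ∷ lt₂)
              (λ { (here 1+k≡k) → ℕ.1+n≢n 1+k≡k
                 ; (there (here 1+k≡z)) → ℕ.<⇒≢ (ℕ.m<n⇒m<1+n z<k) (sym 1+k≡z) })
              (append-twin _ (k<2+k ∷ ℕ.<-trans z<k k<2+k ∷ lt₂)
                (other-bad k d s (z ∷ c ∷ l) (z<k ∷ lt) (free-bad z (c ∷ l) (ne ∷ u) (refl ∷ fr)) g))
              (rotᵍ [ flip b ] (e ∷ z ∷ [])
                (max-good (suc k) (opposite d) s e (z ∷ []) (ℕ.≤-refl ∷ ℕ.m<n⇒m<1+n z<k ∷ []) (two-good z<k dz d)))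
              (subst (λ t → Bad (⟨ suc (suc k) , d , or t ⟩ ∷ b ∷ c ∷ l)) (sym (opposite-involutive s))
                (append-twin _ (ℕ.≤-refl ∷ lt₂)
                  (free-prefix c l fr u (suc k) d (All.map ℕ.m<n⇒m<1+n lt)))))
        where
        e b : Letter
        e = ⟨ k , d , or (opposite s) ⟩
        b = ⟨ suc k , d , or s ⟩
        k<2+k : k ℕ.< suc (suc k)
        k<2+k = ℕ.m<n⇒m<1+n ℕ.≤-refl
        lt₂ : c ∷ l ≺ suc (suc k)
        lt₂ = All.map (λ h → ℕ.<-trans h k<2+k) lt

      -- Two letters of sign `s` and opposite directions, each put together with the free letter of
      -- key 0, give bad words with opposite directions, which force opposite signs on the letter of
      -- key 3. The chord rule forbids this if the circuit formed by the two letters is good, as it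
      -- would be if a single letter of sign `s` were good.
      same-sign-bad : Bad [ ⟨ 0 , + , or s ⟩ ]
      same-sign-bad with good? [ ⟨ 0 , + , or s ⟩ ]
      ... | inj₂ b = b
      ... | inj₁ g = ⊥-elim (chord 3 - s [ ⟨ 0 , + , free ⟩ ] [ ⟨ 1 , - , or s ⟩ ] ⟨ 2 , + , or s ⟩ [] (λ ())
              (s≤s z≤n ∷ s≤s (s≤s z≤n) ∷ s≤s (s≤s (s≤s z≤n)) ∷ [])
              (λ { (here ()) })
              (append {opposite s} ⟨ 3 , - , or s ⟩ (⟨ 0 , + , free ⟩ ∷ ⟨ 1 , - , or s ⟩ ∷ [])
                (s≤s z≤n ∷ s≤s (s≤s z≤n) ∷ []) (there (here (s , refl)))
                (inert refl ∷ aligned (cong or (neg s)) ∷ []) (aligned (cong or (neg s)))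
                (rot [ ⟨ 1 , - , or s ⟩ ] [ ⟨ 0 , + , free ⟩ ] (rule + -)))
              (rotᵍ [ ⟨ 2 , - , or s ⟩ ] [ ⟨ 1 , - , or s ⟩ ]
                (max-good 2 - s ⟨ 1 , - , or s ⟩ [] (s≤s (s≤s z≤n) ∷ []) (trans (one-letter 1 - (or s)) g)))
              (append {s} ⟨ 3 , - , or (opposite s) ⟩ (⟨ 0 , + , free ⟩ ∷ ⟨ 2 , + , or s ⟩ ∷ [])
                (s≤s z≤n ∷ s≤s (s≤s (s≤s z≤n)) ∷ []) (there (here (s , refl)))
                (inert refl ∷ aligned (cong or (pos s)) ∷ []) (aligned (cong or (neg′ s)))
                (rot [ ⟨ 2 , + , or s ⟩ ] [ ⟨ 0 , + , free ⟩ ] (two-bad (s≤s z≤n) + +))))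
        where
        neg : ∀ s → s ≡ opposite s * -
        neg + = refl
        neg - = refl
        pos : ∀ s → s ≡ s * +
        pos + = refl
        pos - = refl
        neg′ : ∀ s → opposite s ≡ s * -
        neg′ + = refl
        neg′ - = refl

      -- If a single letter of the other sign were bad, its twin of key 2 would be forced to that
      -- sign, while the free letter of key 0 forces `s` on it. The circuit of the free letter and
      -- the chord is good by `two-good`, so the chord rule applies.
      other-sign-good : Good [ ⟨ 0 , + , or (opposite s) ⟩ ]
      other-sign-good with good? [ ⟨ 0 , + , or (opposite s) ⟩ ]
      ... | inj₁ g = g
      ... | inj₂ b = ⊥-elim (chord 2 + s [] [ ⟨ 0 , + , free ⟩ ] ⟨ 1 , + , or (opposite s) ⟩ [] (λ ())
              (s≤s z≤n ∷ s≤s (s≤s z≤n) ∷ []) (λ { (here ()) })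
              (two-bad (s≤s z≤n) + +)
              (rotᵍ [ _ ] [ _ ] (two-good (s≤s z≤n) + -))
              (append-twin [] (s≤s (s≤s z≤n) ∷ []) (trans (one-letter 1 + (or (opposite s))) b)))

  -- When a maximum letter is added above an oriented one, the first oriented letter does not change
  -- and compatibility decides. Above free letters only, an oriented new letter is the first
  -- oriented one and `free-prefix` decides.
  weird : ∀ s → Bad [ ⟨ 0 , + , free ⟩ ] → WeirdRule s → ∀ l → UniqueKeys l → Bad l ⇔ WeirdBad s l
  weird s free-bad₁ rule [] u = mk⇔ (λ b → ⊥-elim (¬good empty-good b)) (λ (ne , _) → contradiction refl ne)
  weird s free-bad₁ rule (y ∷ l) u = max-induction (λ l → Bad l ⇔ WeirdBad s l) swap base step (length l) y l ℕ.≤-refl u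
    where
    open FreeBad free-bad₁
    open Weird s rule
    swap-std : ∀ u v → WeirdBad s (u ++ v) → WeirdBad s (v ++ u)
    swap-std u v (ne , D , c , h) =
      (λ e → ne (empty-swap u v e)) , D , All-swap u c ,
      λ y y∈ o m → h y (∈-swap v y∈) o (λ z z∈ → m z (∈-swap u z∈))
      where
      ∈-swap : ∀ u {v y} → y ∈ˡ u ++ v → y ∈ˡ v ++ u
      ∈-swap u = Any-swap u
      empty-swap : ∀ (u v : List Letter) → v ++ u ≡ [] → u ++ v ≡ []
      empty-swap [] [] e = refl
      empty-swap (x ∷ u) [] ()
      empty-swap u (x ∷ v) ()
    swap : ∀ u v → Bad (u ++ v) ⇔ WeirdBad s (u ++ v) → Bad (v ++ u) ⇔ WeirdBad s (v ++ u)
    swap u v e = mk⇔ (λ b → swap-std u v (to e (rot v u b))) (λ h → rot u v (from e (swap-std v u h)))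
    base : ∀ x → Bad [ x ] ⇔ WeirdBad s [ x ]
    base ⟨ k , d , m ⟩ = mk⇔
      (λ b → (λ ()) , _ , proj₂ (bad-compat _ b) , λ { _ (here refl) (t , refl) _ → cong or (sign t b) })
      (λ (_ , D , c , h) → bad m c h)
      where
      sign : ∀ t → Bad [ ⟨ k , d , or t ⟩ ] → t ≡ s
      sign t b with t ≟ˢ s
      ... | yes eq = eq
      ... | no ne = ⊥-elim (¬good (trans (one-letter k d (or (opposite s))) other-sign-good)
                      (subst (λ r → Bad [ ⟨ k , d , or r ⟩ ]) (≢⇒opposite ne) b))
      bad : ∀ m {D} → All (Compat D) [ ⟨ k , d , m ⟩ ] →
        (∀ y → y ∈ˡ [ ⟨ k , d , m ⟩ ] → Oriented y → (∀ z → z ∈ˡ [ ⟨ k , d , m ⟩ ] → Oriented z → key y ℕ.≤ key z) → mark y ≡ or s) →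
        Bad [ ⟨ k , d , m ⟩ ]
      bad free c h = trans (one-letter k d free) free-bad₁
      bad blocked (inert () ∷ []) h
      bad blocked (aligned () ∷ []) h
      bad (or t) c h with h _ (here refl) (t , refl) (λ { _ (here refl) _ → ℕ.≤-refl })
      ... | refl = trans (one-letter k d (or s)) same-sign-bad
    step : ∀ x y l → y ∷ l ≺ key x → UniqueKeys (y ∷ l) → Bad (y ∷ l) ⇔ WeirdBad s (y ∷ l) → Bad (x ∷ y ∷ l) ⇔ WeirdBad s (x ∷ y ∷ l)
    step x@(⟨ k , d , m ⟩) y l lt u ih = mk⇔ fwd bwd
      where
      fwd : Bad (x ∷ y ∷ l) → WeirdBad s (x ∷ y ∷ l)
      fwd b with bad-compat _ b
      ... | D , c₀ ∷ c = (λ ()) , D , (c₀ ∷ c) , sign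
        where
        bad-yl : Bad (y ∷ l)
        bad-yl = bad-tail x y l lt b
        sign : ∀ z → z ∈ˡ x ∷ y ∷ l → Oriented z → (∀ w → w ∈ˡ x ∷ y ∷ l → Oriented w → key z ℕ.≤ key w) → mark z ≡ or s
        sign z (there z∈) o min = proj₂ (proj₂ (proj₂ (to ih bad-yl))) z z∈ o (λ w w∈ → min w (there w∈))
        sign z (here refl) (t , refl) min with oriented-or-free (y ∷ l) c
        ... | inj₁ o with All.lookupAny lt o
        ...   | w<k , ow = contradiction (min (Any.lookup o) (there (∈-lookup (Any.index o))) ow) (ℕ.<⇒≱ w<k)
        sign z (here refl) (t , refl) min | inj₂ fr with t ≟ˢ s
        ... | yes eq = cong or eq
        ... | no ne = ⊥-elim (¬good (other-good k d s (y ∷ l) lt bad-yl (free-prefix y l fr u k d lt))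
                        (subst (λ r → Bad (⟨ k , d , or r ⟩ ∷ y ∷ l)) (≢⇒opposite ne) b))
      bwd : WeirdBad s (x ∷ y ∷ l) → Bad (x ∷ y ∷ l)
      bwd (_ , D , c₀ ∷ c , h) = res c₀ h
        where
        bad-yl : Bad (y ∷ l)
        bad-yl = from ih ((λ ()) , D , c , λ z z∈ o min → h z (there z∈) o
          (λ { w (here refl) ow → ℕ.<⇒≤ (All.lookup lt z∈) ; w (there w∈) ow → min w w∈ ow }))
        res : Compat D x → (∀ z → z ∈ˡ x ∷ y ∷ l → Oriented z → (∀ w → w ∈ˡ x ∷ y ∷ l → Oriented w → key z ℕ.≤ key w) → mark z ≡ or s) →
          Bad (x ∷ y ∷ l)
        res c₀ h with oriented-or-free (y ∷ l) c
        ... | inj₁ o = append x (y ∷ l) lt o c c₀ bad-yl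
        res (inert refl) h | inj₂ fr = trans (max-free k d y l lt) bad-yl
        res (aligned refl) h | inj₂ fr with h x (here refl) (_ , refl)
           (λ { w (here refl) _ → ℕ.≤-refl ; w (there w∈) (t , ow) → contradiction (trans (sym (All.lookup fr w∈)) ow) (λ ()) })
        ... | refl = free-prefix y l fr u k d lt

  -- In a one-letter word the letter is its own minimum, and condition (ii) can be met by choosing
  -- the direction, so the set of bad statuses is visible there.
  X : Mark → Bool
  X m = not (f [ ⟨ 0 , + , m ⟩ ])

  X⇒bad : ∀ k d m → X m ≡ true → Bad [ ⟨ k , d , m ⟩ ]
  X⇒bad k d m h = trans (one-letter k d m) (not-true _ h)
    where
    not-true : ∀ b → not b ≡ true → b ≡ false
    not-true false _ = refl

  bad⇒X : ∀ k d m → Bad [ ⟨ k , d , m ⟩ ] → X m ≡ true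
  bad⇒X k d m b = cong not (trans (sym (one-letter k d m)) b)

  -- The knowledge about free prefixes is requested only when a free letter is bad. This lets one
  -- lemma also cover the case in which a free letter is good and no sign is ever left open.
  min-edge : ∀ δ →
    (X free ≡ true → ∀ l y → All (λ y → mark y ≡ free) l → UniqueKeys l → MinKey y l →
       ∀ k d → l ≺ k → Bad (⟨ k , d , or (δ * dir y * d) ⟩ ∷ l)) →
    ∀ l → UniqueKeys l → Bad l ⇔ MinEdgeBad X δ l
  min-edge δ prefix [] u = mk⇔ (λ b → ⊥-elim (¬good empty-good b)) (λ { (_ , _ , _ , (() , _) , _) })
  min-edge δ prefix (y ∷ l) u = max-induction (λ l → Bad l ⇔ MinEdgeBad X δ l) swap base step (length l) y l ℕ.≤-refl u
    where
    swap-std : ∀ u v → MinEdgeBad X δ (u ++ v) → MinEdgeBad X δ (v ++ u)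
    swap-std u v (D , c , y , (y∈ , y≤) , h) = D , All-swap u c , y , (Any-swap u y∈ , All-swap u y≤) , h
    swap : ∀ u v → Bad (u ++ v) ⇔ MinEdgeBad X δ (u ++ v) → Bad (v ++ u) ⇔ MinEdgeBad X δ (v ++ u)
    swap u v e = mk⇔ (λ b → swap-std u v (to e (rot v u b))) (λ h → rot u v (from e (swap-std v u h)))
    base : ∀ x → Bad [ x ] ⇔ MinEdgeBad X δ [ x ]
    base x@(⟨ k , d , m ⟩) = mk⇔ (λ b → fwd m b (bad-compat _ b)) (λ { (_ , _ , _ , (here refl , _) , h , _) → X⇒bad k d m h })
      where
      fwd : ∀ m → Bad [ ⟨ k , d , m ⟩ ] → ∃[ D ] All (Compat D) [ ⟨ k , d , m ⟩ ] → MinEdgeBad X δ [ ⟨ k , d , m ⟩ ]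
      fwd free b _ = δ * d , (inert refl ∷ []) , _ , (here refl , ℕ.≤-refl ∷ []) , bad⇒X k d free b , λ _ → refl
      fwd blocked b (_ , inert () ∷ [])
      fwd blocked b (_ , aligned () ∷ [])
      fwd (or t) b (D , c) = D , c , _ , (here refl , ℕ.≤-refl ∷ []) , bad⇒X k d (or t) b , λ ()
    step : ∀ x y l → y ∷ l ≺ key x → UniqueKeys (y ∷ l) → Bad (y ∷ l) ⇔ MinEdgeBad X δ (y ∷ l) → Bad (x ∷ y ∷ l) ⇔ MinEdgeBad X δ (x ∷ y ∷ l)
    step x@(⟨ k , d , m ⟩) y l lt u ih = mk⇔ fwd bwd
      where
      fwd : Bad (x ∷ y ∷ l) → MinEdgeBad X δ (x ∷ y ∷ l)
      fwd b with to ih (bad-tail x y l lt b) | bad-compat _ b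
      ... | D , c , z , (z∈ , z≤) , Xz , h | D′ , c₀ ∷ c′ =
            D , (compat-x c₀ ∷ c) , z , (there z∈ , ℕ.<⇒≤ (All.lookup lt z∈) ∷ z≤) , Xz , h
        where
        compat-x : Compat D′ x → Compat D x
        compat-x c₀ with oriented-or-free (y ∷ l) c
        ... | inj₁ o = subst (λ D → Compat D x) (compat-unique c′ c o) c₀
        compat-x (inert refl) | inj₂ fr = inert refl
        compat-x (aligned refl) | inj₂ fr with D′ * d ≟ˢ D * d
        ... | yes eq = aligned (cong or eq)
        ... | no ne = ⊥-elim (¬good (other-good k d (D * d) (y ∷ l) lt (bad-tail x y l lt b)
                (subst (λ E → Bad (⟨ k , d , or (E * d) ⟩ ∷ y ∷ l)) (sym (h (All.lookup fr z∈)))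
                  (prefix (subst (λ m → X m ≡ true) (All.lookup fr z∈) Xz) (y ∷ l) z fr u (z∈ , z≤) k d lt)))
                (subst (λ t → Bad (⟨ k , d , or t ⟩ ∷ y ∷ l)) (≢⇒opposite ne) b))
      bwd : MinEdgeBad X δ (x ∷ y ∷ l) → Bad (x ∷ y ∷ l)
      bwd (D , _ ∷ _ , z , (here refl , _ ∷ z≤) , _) = contradiction z≤ (max≢min (y ∷ l) (λ ()) lt)
      bwd (D , c₀ ∷ c , z , (there z∈ , _ ∷ z≤) , Xz , h) = res c₀
        where
        bad-yl : Bad (y ∷ l)
        bad-yl = from ih (D , c , z , (z∈ , z≤) , Xz , h)
        res : Compat D x → Bad (x ∷ y ∷ l)
        res c₀ with oriented-or-free (y ∷ l) c
        ... | inj₁ o = append x (y ∷ l) lt o c c₀ bad-yl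
        res (inert refl) | inj₂ fr = trans (max-free k d y l lt) bad-yl
        res (aligned refl) | inj₂ fr =
          subst (λ E → Bad (⟨ k , d , or (E * d) ⟩ ∷ y ∷ l)) (sym (h (All.lookup fr z∈)))
            (prefix (subst (λ m → X m ≡ true) (All.lookup fr z∈) Xz) (y ∷ l) z fr u (z∈ , z≤) k d lt)

  X-blocked : X blocked ≡ false
  X-blocked with good? [ ⟨ 0 , + , blocked ⟩ ]
  ... | inj₁ g = cong not g
  ... | inj₂ b with bad-compat _ b
  ...   | _ , inert () ∷ []
  ...   | _ , aligned () ∷ []

  classification : (∃[ δ ] (∀ l → UniqueKeys l → Bad l ⇔ MinEdgeBad X δ l)) ⊎ (∃[ s ] (∀ l → UniqueKeys l → Bad l ⇔ WeirdBad s l))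
  classification with good? [ ⟨ 0 , + , free ⟩ ]
  -- A free minimum is never bad in this case, so either value of `δ` would do.
  ... | inj₁ g = inj₁ (+ , min-edge + (λ h → contradiction (trans (sym (cong not g)) h) λ ()))
  ... | inj₂ b with two-letter-cases b
  ...   | inj₁ (δ , rule) = inj₁ (δ , min-edge δ (λ _ l y → FreeBad.MinEdge.free-prefix b δ rule (length l) l ℕ.≤-refl y))
  ...   | inj₂ (s , rule) = inj₂ (s , weird s b rule)

-- Graphs and paths

⇔-refl : ∀ {A : Set} → A ⇔ A
⇔-refl = mk⇔ id id

⇔-sym : ∀ {A B : Set} → A ⇔ B → B ⇔ A
⇔-sym e = mk⇔ (from e) (to e)

⇔-trans : ∀ {A B C : Set} → A ⇔ B → B ⇔ C → A ⇔ C
⇔-trans e f = mk⇔ (to f ∘ to e) (from e ∘ from f)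

has : Status → Sign → Bool
has unoriented   _ = false
has bioriented   _ = true
has (oriented t) s = does (s Sign.≟ t)

status-has : ∀ t → status′ (has t +) (has t -) ≡ t
status-has unoriented   = refl
status-has bioriented   = refl
status-has (oriented +) = refl
status-has (oriented -) = refl

has-status : ∀ p m → has (status′ p m) + ≡ p × has (status′ p m) - ≡ m
has-status false false = refl , refl
has-status true  false = refl , refl
has-status false true  = refl , refl
has-status true  true  = refl , refl

opp : ∀ {A : Set} → A × Sign → A × Sign
opp (e , s) = e , opposite s

opp-opp : ∀ {A : Set} (a : A × Sign) → opp (opp a) ≡ a
opp-opp (e , s) = cong (e ,_) (opposite-involutive s)

module _ (G : OrientedGraph) where
  open OrientedGraph G

  -- A walk indexed by its list of arcs, so that rotating, splitting and reversing circuits become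
  -- operations on lists.
  data Path : V → List 𝔼 → V → Set where
    []   : ∀ {u} → Path u [] u
    step : ∀ {u a as v} → src a ≡ u → Path (tgt a) as v → Path u (a ∷ as) v

module _ {G : OrientedGraph} where
  open OrientedGraph G

  src-opp : ∀ a → src (opp a) ≡ tgt a
  src-opp (e , +) = refl
  src-opp (e , -) = refl

  tgt-opp : ∀ a → tgt (opp a) ≡ src a
  tgt-opp (e , +) = refl
  tgt-opp (e , -) = refl

  path-++ : ∀ {u as v bs w} → Path G u as v → Path G v bs w → Path G u (as ++ bs) w
  path-++ []         q = q
  path-++ (step e p) q = step e (path-++ p q)

  path-split : ∀ {u} as {bs w} → Path G u (as ++ bs) w → ∃[ v ] Path G u as v × Path G v bs w
  path-split []       p          = _ , [] , p
  path-split (a ∷ as) (step e p) with path-split as p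
  ... | v , q , r = v , step e q , r

  path-start : ∀ {u a as v} → Path G u (a ∷ as) v → src a ≡ u
  path-start (step e _) = e

  path-[]  : ∀ {u v} → Path G u [] v → u ≡ v
  path-[] [] = refl

  path-reverse : ∀ {u as v} → Path G u as v → Path G v (reverse (map opp as)) u
  path-reverse {as = []} [] = []
  path-reverse {as = a ∷ as} (step refl p) =
    subst (λ l → Path G _ l _) (sym (unfold-reverse (opp a) (map opp as)))
      (path-++ (path-reverse p) (step (src-opp a) (subst (λ w → Path G (tgt (opp a)) [] w) (tgt-opp a) [])))

  path-tabulate : ∀ k (g : Fin (suc k) → 𝔼) → (∀ i → tgt (g (inject₁ i)) ≡ src (g (suc i))) →
                  Path G (src (g zero)) (tabulate g) (tgt (g (fromℕ k)))
  path-tabulate zero    g h = step refl []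
  path-tabulate (suc k) g h = step refl
    (subst (λ v → Path G v (tabulate (g ∘ suc)) (tgt (g (fromℕ (suc k))))) (sym (h zero)) (path-tabulate k (g ∘ suc) (h ∘ suc)))

  walk-sym : ∀ {u v} → Walk u v → Walk v u
  walk-sym = Star.reverse (λ (a , p , q) → opp a , trans (src-opp a) q , trans (tgt-opp a) p)

  path-crosses : (U : V → Bool) → ∀ {u as v} → Path G u as v → U u ≡ true → U v ≡ false →
                 ∃[ a ] a ∈ˡ as × U (src a) ≡ true × U (tgt a) ≡ false
  path-crosses U [] hu hv with trans (sym hu) hv
  ... | ()
  path-crosses U (step {a = a} refl p) hu hv with U (tgt a) in eq
  ... | false = a , here refl , hu , eq
  ... | true  with path-crosses U p eq hv
  ...   | b , b∈ , h = b , there b∈ , h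

module _ (g : OrientedGraph) (κ : OrientedGraph.E g → ℕ) (inj : Injective _≡_ _≡_ κ)
         (conn : ∀ u v → OrientedGraph.Walk g u v) where

  keyed : OOGraph
  keyed = record
    { graph = g
    ; _<_   = λ e f → κ e ℕ.< κ f
    ; isStrictTotalOrder = record
      { isStrictPartialOrder = record
        { isEquivalence = isEquivalence
        ; irrefl = λ { refl → ℕ.<-irrefl refl }
        ; trans = ℕ.<-trans
        ; <-resp-≈ = (λ { refl h → h }) , (λ { refl h → h })
        }
      ; compare = λ e f → cmp e f (ℕ.<-cmp (κ e) (κ f))
      }
    ; connected = conn
    }
    where
    cmp : ∀ e f → Tri (κ e ℕ.< κ f) (κ e ≡ κ f) (κ f ℕ.< κ e) → Tri (κ e ℕ.< κ f) (e ≡ f) (κ f ℕ.< κ e)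
    cmp e f (tri< a ¬b ¬c) = tri< a (¬b ∘ cong κ) ¬c
    cmp e f (tri≈ ¬a b ¬c) = tri≈ ¬a (inj b) ¬c
    cmp e f (tri> ¬a ¬b c) = tri> ¬a (¬b ∘ cong κ) c

-- Replaces the abstract edge order by natural numbers, which serve as the keys of letters.
EdgeKey : (G : OOGraph) → (OOGraph.E G → ℕ) → Set
EdgeKey G κ = ∀ e f → let open OOGraph G in (e < f) ⇔ (κ e ℕ.< κ f)

module _ {G : OOGraph} where
  open OOGraph G

  key-injective : ∀ {κ} → EdgeKey G κ → Injective _≡_ _≡_ κ
  key-injective {κ} K {e} {f} eq with IsStrictTotalOrder.compare isStrictTotalOrder e f
  ... | tri< e<f _ _ = contradiction (to (K e f) e<f) (ℕ.<-irrefl eq)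
  ... | tri≈ _ e≡f _ = e≡f
  ... | tri> _ _ f<e = contradiction (to (K f e) f<e) (ℕ.<-irrefl (sym eq))

  infix 20 _[_≔_]
  _[_≔_] : Fourientation → E → Status → Fourientation
  (O [ e ≔ t ]) (f , s) with f ≟ e
  ... | yes _ = has t s
  ... | no  _ = O (f , s)

  ≔-on : ∀ O e t s → (O [ e ≔ t ]) (e , s) ≡ has t s
  ≔-on O e t s with e ≟ e
  ... | yes _ = refl
  ... | no ne = contradiction refl ne

  ≔-off : ∀ O e t {f} → f ≢ e → ∀ s → (O [ e ≔ t ]) (f , s) ≡ O (f , s)
  ≔-off O e t {f} ne s with f ≟ e
  ... | yes eq = contradiction eq ne
  ... | no _ = refl

  status-at : ∀ O e t → status (O [ e ≔ t ]) e ≡ t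
  status-at O e t with e ≟ e
  ... | yes _ = status-has t
  ... | no ne = contradiction refl ne

  status-off : ∀ O e t {f} → f ≢ e → status (O [ e ≔ t ]) f ≡ status O f
  status-off O e t {f} ne with f ≟ e
  ... | yes eq = contradiction eq ne
  ... | no _ = refl

  has-status-at : ∀ (O : Fourientation) e s → has (status O e) s ≡ O (e , s)
  has-status-at O e + = proj₁ (has-status (O (e , +)) (O (e , -)))
  has-status-at O e - = proj₂ (has-status (O (e , +)) (O (e , -)))

module _ (P : FourientationProperty) where
  open FourientationProperty P

  -- Fourientations are functions; the identity isomorphism makes the value depend only on their
  -- pointwise behaviour.
  isGood-cong : ∀ G {O O′ : OOGraph.Fourientation G} → O ≗ O′ → isGood G O ≡ isGood G O′
  isGood-cong G h = invariant {G} {_} {G} record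
    { verts = ↔-refl ; edges = ↔-refl
    ; tail-comm = λ _ → refl ; head-comm = λ _ → refl ; order = λ _ _ → ⇔-refl ; fourient = λ e s → h (e , s) }

module Extension {G S H} (d : EdgeEmbedding G S H) (O : OOGraph.Fourientation G) where
  open OOGraph G
  open EdgeEmbedding d

  extend-on : ∀ e → e ∈ S → ∀ s → extend (restrict O) (e , s) ≡ O (e , s)
  extend-on e e∈S s with any? (λ x → ι x ≟ e)
  ... | yes (x , refl) = refl
  ... | no ¬x = contradiction (from (ι-image e) e∈S) ¬x

  extend-off : ∀ e → ¬ e ∈ S → ∀ s → extend (restrict O) (e , s) ≡ false
  extend-off e e∉S s with any? (λ x → ι x ≟ e)
  ... | yes x = contradiction (to (ι-image e) x) e∉S
  ... | no _ = refl

module _ {G H e} (d : EdgeEmbedding G (∁ ｛ e ｝) H) (O : OOGraph.Fourientation G) where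
  open OOGraph G
  open EdgeEmbedding d
  open Extension d O

  private
    O₀ : Fourientation
    O₀ = extend (restrict O)
    ⁺-off : ∀ {f} (O′ : Fourientation) s t → f ≢ e → (O′ ∪｛ e , t ｝) (f , s) ≡ O′ (f , s)
    ⁺-off {f} O′ s t f≢e rewrite dec-false ((f , s) ≟𝔼 (e , t)) (f≢e ∘ ,-injectiveˡ) = ∨-identityʳ _
    ⁺-on : (O′ : Fourientation) → ∀ s t → (O′ ∪｛ e , t ｝) (e , s) ≡ O′ (e , s) ∨ does (s Sign.≟ t)
    ⁺-on O′ s t with s Sign.≟ t
    ... | yes refl rewrite dec-true ((e , s) ≟𝔼 (e , s)) refl = refl
    ... | no ne rewrite dec-false ((e , s) ≟𝔼 (e , t)) (ne ∘ ,-injectiveʳ) = refl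
    off : ∀ f → f ≢ e → ∀ s → extend (restrict O) (f , s) ≡ O (f , s)
    off f f≢e s = extend-on f (λ e≡f → f≢e (sym e≡f)) s
    on : ∀ s → extend (restrict O) (e , s) ≡ false
    on = extend-off e (λ k → k refl)

  -- T2 is stated for fourientations extended from the minor. This lemma and the next two rewrite
  -- them as one fourientation of `G` in which only the status of `e` varies.
  extend-unoriented : extend (restrict O) ≗ O [ e ≔ unoriented ]
  extend-unoriented (f , s) = case (f ≟ e)
    where
    case : Dec (f ≡ e) → O₀ (f , s) ≡ (O [ e ≔ unoriented ]) (f , s)
    case (yes refl) = trans (on s) (sym (≔-on {G} O f unoriented s))
    case (no f≢e)   = trans (off f f≢e s) (sym (≔-off {G} O e unoriented f≢e s))

  extend-oriented : ∀ t → extend (restrict O) ∪｛ e , t ｝ ≗ O [ e ≔ oriented t ]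
  extend-oriented t (f , s) = case (f ≟ e)
    where
    case : Dec (f ≡ e) → (O₀ ∪｛ e , t ｝) (f , s) ≡ (O [ e ≔ oriented t ]) (f , s)
    case (yes refl) = trans (⁺-on O₀ s t) (trans (cong (_∨ does (s Sign.≟ t)) (on s))
                        (sym (≔-on {G} O f (oriented t) s)))
    case (no f≢e)   = trans (⁺-off O₀ s t f≢e) (trans (off f f≢e s) (sym (≔-off {G} O e (oriented t) f≢e s)))

  extend-bioriented : extend (restrict O) ∪｛ e , + ｝ ∪｛ e , - ｝ ≗ O [ e ≔ bioriented ]
  extend-bioriented (f , s) = case (f ≟ e)
    where
    both : ∀ s → (extend (restrict O) ∪｛ e , + ｝ ∪｛ e , - ｝) (e , s) ≡ true
    both + = trans (⁺-on (O₀ ∪｛ e , + ｝) + -) (trans (∨-identityʳ _) (trans (⁺-on O₀ + +) (∨-zeroʳ _)))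
    both - = trans (⁺-on (O₀ ∪｛ e , + ｝) - -) (∨-zeroʳ _)
    case : Dec (f ≡ e) → (O₀ ∪｛ e , + ｝ ∪｛ e , - ｝) (f , s) ≡ (O [ e ≔ bioriented ]) (f , s)
    case (yes refl) = trans (both s) (sym (≔-on {G} O f bioriented s))
    case (no f≢e)   = trans (⁺-off (O₀ ∪｛ e , + ｝) s - f≢e) (trans (⁺-off O₀ s + f≢e)
                        (trans (off f f≢e s) (sym (≔-off {G} O e bioriented f≢e s))))

module _ {G S H S′ H′} (d : EdgeEmbedding G S H) (d′ : EdgeEmbedding G S′ H′) (S⇔S′ : ∀ e → e ∈ S ⇔ e ∈ S′) where
  private
    module d = EdgeEmbedding d
    module d′ = EdgeEmbedding d′
    fwd : ∀ x → ∃[ y ] d′.ι y ≡ d.ι x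
    fwd x = from (d′.ι-image _) (to (S⇔S′ _) (to (d.ι-image _) (x , refl)))
    bwd : ∀ y → ∃[ x ] d.ι x ≡ d′.ι y
    bwd y = from (d.ι-image _) (from (S⇔S′ _) (to (d′.ι-image _) (y , refl)))

  embedding-↔ : OOGraph.E H ↔ OOGraph.E H′
  embedding-↔ = mk↔ₛ′ (proj₁ ∘ fwd) (proj₁ ∘ bwd)
    (λ y → d′.ι-injective (trans (proj₂ (fwd _)) (proj₂ (bwd y))))
    (λ x → d.ι-injective (trans (proj₂ (bwd _)) (proj₂ (fwd x))))

  embedding-ι : ∀ x → d′.ι (Inverse.to embedding-↔ x) ≡ d.ι x
  embedding-ι x = proj₂ (fwd x)

  embedding-order : ∀ x y → OOGraph._<_ H x y ⇔ OOGraph._<_ H′ (Inverse.to embedding-↔ x) (Inverse.to embedding-↔ y)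
  embedding-order x y = ⇔-trans (d.ι-order x y)
    (subst₂ (λ u v → OOGraph._<_ G u v ⇔ OOGraph._<_ H′ (Inverse.to embedding-↔ x) (Inverse.to embedding-↔ y)) (embedding-ι x) (embedding-ι y) (⇔-sym (d′.ι-order _ _)))

suc-image : ∀ {n} (e : Fin (suc n)) → (∃[ x ] suc x ≡ e) ⇔ e ∈ ∁ ｛ zero ｝
suc-image zero    = mk⇔ (λ ()) (λ h → contradiction refl h)
suc-image (suc x) = mk⇔ (λ _ ()) (λ _ → x , refl)

lookup-injective : ∀ {A B : Set} (g : A → B) l → Unique (map g l) → ∀ {i j} → g (lookup l i) ≡ g (lookup l j) → i ≡ j
lookup-injective g (x ∷ l) (ne ∷ u) {zero}  {zero}  eq = refl
lookup-injective g (x ∷ l) (ne ∷ u) {zero}  {suc j} eq = contradiction eq (All.lookup ne (∈-map⁺ g (∈-lookup j)))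
lookup-injective g (x ∷ l) (ne ∷ u) {suc i} {zero}  eq = contradiction (sym eq) (All.lookup ne (∈-map⁺ g (∈-lookup i)))
lookup-injective g (x ∷ l) (ne ∷ u) {suc i} {suc j} eq = cong suc (lookup-injective g l u eq)

uniqueKeys? : ∀ l → Dec (UniqueKeys l)
uniqueKeys? l = DecUnique.unique? ℕ._≟_ (map key l)

-- Free is unoriented for cuts and bioriented for cycles; blocked is the
-- reverse.
record Polarity : Set where
  field
    ⟦_⟧   : Mark → Status
    mk    : Status → Mark
    mk-st : ∀ m → mk ⟦ m ⟧ ≡ m
    st-mk : ∀ t → ⟦ mk t ⟧ ≡ t
    mk-or : ∀ s → mk (oriented s) ≡ or s

-- The family of bonds (two vertices) or of cycles (suc n vertices); the
-- ith arc of the member with suc n edges goes from fro n i to into n i.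
record Shape : Set₁ where
  field
    vert      : ℕ → ℕ
    fro into  : ∀ n → Fin (suc n) → Fin (suc (vert n))
    reach     : ∀ n (R : Rel (Fin (suc (vert n))) 0ℓ) → (∀ i → R (fro n i) (into n i)) →
                (∀ i → R (into n i) (fro n i)) → ∀ u v → Star R u v

-- Graphs realising words, and the values of words.

module Words (pol : Polarity) (shape : Shape) where
  open Polarity pol public
  open Shape shape public

  letter : ∀ {G} → (OOGraph.E G → ℕ) → OOGraph.Fourientation G → OOGraph.𝔼 G → Letter
  letter {G} κ O (e , s) = ⟨ κ e , s , mk (OOGraph.status G O e) ⟩

  word : ∀ {G} → (OOGraph.E G → ℕ) → OOGraph.Fourientation G → List (OOGraph.𝔼 G) → List Letter
  word {G} κ O = map (letter {G} κ O)

  -- The arc with sign `dir (φ i)` has to run along the circuit, from `fro n i` to `into n i`; for a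
  -- letter of direction - the reference orientation therefore runs against it.
  tl hd : ∀ n → Sign → Fin (suc n) → Fin (suc (vert n))
  tl n + i = fro n i
  tl n - i = into n i
  hd n + i = into n i
  hd n - i = fro n i

  module _ (n : ℕ) (φ : Fin (suc n) → Letter) where

    shapeGraph : OrientedGraph
    shapeGraph = record
      { #V = suc (vert n) ; #E = suc n ; nonEmpty = _
      ; tail = λ i → tl n (dir (φ i)) i ; head = λ i → hd n (dir (φ i)) i }

    open OrientedGraph shapeGraph

    nat : Fin (suc n) → 𝔼
    nat i = i , dir (φ i)

    src-nat : ∀ i → src (nat i) ≡ fro n i
    src-nat i with dir (φ i) in eq
    ... | + rewrite eq = refl
    ... | - rewrite eq = refl

    tgt-nat : ∀ i → tgt (nat i) ≡ into n i
    tgt-nat i with dir (φ i) in eq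
    ... | + rewrite eq = refl
    ... | - rewrite eq = refl

    shapeConnected : ∀ u v → Walk u v
    shapeConnected = reach n Arc (λ i → nat i , src-nat i , tgt-nat i)
      (λ i → opp (nat i) , trans (src-opp {shapeGraph} (nat i)) (tgt-nat i) , trans (tgt-opp {shapeGraph} (nat i)) (src-nat i))

    wordGraph : Injective _≡_ _≡_ (key ∘ φ) → OOGraph
    wordGraph inj = keyed shapeGraph (key ∘ φ) inj shapeConnected

    marks : Fin (suc n) × Sign → Bool
    marks (i , s) = has ⟦ mark (φ i) ⟧ s

  module Value (P : FourientationProperty) where
    open FourientationProperty P

    value : ∀ l → Dec (UniqueKeys l) → Bool
    value []      _       = true
    value (x ∷ l) (no _)  = true
    value (x ∷ l) (yes u) = isGood (wordGraph (length l) (lookup (x ∷ l)) (lookup-injective key (x ∷ l) u))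
                                   (marks (length l) (lookup (x ∷ l)))

    -- Words with repeated keys are good by convention.
    abstract
      f : List Letter → Bool
      f l = value l (uniqueKeys? l)

      f-empty : f [] ≡ true
      f-empty = refl

      f-unique : ∀ l → f l ≡ false → UniqueKeys l
      f-unique (x ∷ l) bad with uniqueKeys? (x ∷ l)
      ... | yes u = u

      f-nonunique : ∀ l → ¬ UniqueKeys l → f l ≡ true
      f-nonunique [] ¬u = refl
      f-nonunique (x ∷ l) ¬u with uniqueKeys? (x ∷ l)
      ... | yes u = contradiction u ¬u
      ... | no _  = refl

      f-word : ∀ x l (inj : Injective _≡_ _≡_ (key ∘ lookup (x ∷ l))) →
               f (x ∷ l) ≡ isGood (wordGraph (length l) (lookup (x ∷ l)) inj) (marks (length l) (lookup (x ∷ l)))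
      f-word x l inj with uniqueKeys? (x ∷ l)
      ... | yes u = invariant record
        { verts = ↔-refl ; edges = ↔-refl
        ; tail-comm = λ _ → refl ; head-comm = λ _ → refl ; order = λ _ _ → ⇔-refl ; fourient = λ e s → refl }
      ... | no ¬u = contradiction
        (subst Unique (trans (sym (map-tabulate (lookup (x ∷ l)) key)) (cong (map key) (tabulate-lookup (x ∷ l))))
          (Uniqueₚ.tabulate⁺ {f = key ∘ lookup (x ∷ l)} inj)) ¬u

    -- Two lengths are allowed because the length of a tabulated list equals the number of letters
    -- only propositionally.
    relabel : ∀ {m n} (eq : m ≡ n) (φ : Fin (suc m) → Letter) (ψ : Fin (suc n) → Letter) →
      (∀ i → φ i ≡ ψ (cast (cong suc eq) i)) →
      (inj : Injective _≡_ _≡_ (key ∘ φ)) (inj′ : Injective _≡_ _≡_ (key ∘ ψ)) →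
      isGood (wordGraph m φ inj) (marks m φ) ≡ isGood (wordGraph n ψ inj′) (marks n ψ)
    relabel {m} refl φ ψ h inj inj′ = invariant record
      { verts = ↔-refl ; edges = ↔-refl
      ; tail-comm = λ i → cong (λ a → tl m (dir a) i) (h′ i)
      ; head-comm = λ i → cong (λ a → hd m (dir a) i) (h′ i)
      ; order = λ i j → subst₂ (λ a b → (key (φ i) ℕ.< key (φ j)) ⇔ (key a ℕ.< key b)) (h′ i) (h′ j) ⇔-refl
      ; fourient = λ i s → cong (λ a → has ⟦ mark a ⟧ s) (h′ i) }
      where
      h′ : ∀ i → φ i ≡ ψ i
      h′ i = trans (h i) (cong ψ (cast-is-id refl i))

    f-tabulate : ∀ n (φ : Fin (suc n) → Letter) (inj : Injective _≡_ _≡_ (key ∘ φ)) → f (tabulate φ) ≡ isGood (wordGraph n φ inj) (marks n φ)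
    f-tabulate n φ inj = trans (f-word (φ zero) (tabulate (φ ∘ suc)) inj′)
      (relabel (length-tabulate (φ ∘ suc)) (lookup (tabulate φ)) φ h inj′ inj)
      where
      h : ∀ i → lookup (tabulate φ) i ≡ φ (cast (length-tabulate φ) i)
      h i = trans (cong (lookup (tabulate φ)) (sym (cast-round i))) (lookup-tabulate φ (cast (length-tabulate φ) i))
        where
        cast-round : ∀ i → cast (sym (length-tabulate φ)) (cast (length-tabulate φ) i) ≡ i
        cast-round i = trans (cast-trans (length-tabulate φ) (sym (length-tabulate φ)) i) (cast-is-id refl i)
      inj′ : Injective _≡_ _≡_ (key ∘ lookup (tabulate φ))
      inj′ = lookup-injective key (tabulate φ) (subst Unique (sym (map-tabulate φ key)) (Uniqueₚ.tabulate⁺ inj))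

    -- Marks and statuses correspond bijectively, so reading a word off a fourientation and
    -- rebuilding the fourientation from it loses nothing.
    f-natural : ∀ n φ (inj : Injective _≡_ _≡_ (key ∘ φ)) (O : OOGraph.Fourientation (wordGraph n φ inj)) →
      f (tabulate (letter {wordGraph n φ inj} (key ∘ φ) O ∘ nat n φ)) ≡ isGood (wordGraph n φ inj) O
    f-natural n φ inj O = trans (f-tabulate n ψ inj) (invariant record
      { verts = ↔-refl ; edges = ↔-refl ; tail-comm = λ _ → refl ; head-comm = λ _ → refl
      ; order = λ _ _ → ⇔-refl ; fourient = λ i s → same (i , s) })
      where
      ψ : Fin (suc n) → Letter
      ψ = letter {wordGraph n φ inj} (key ∘ φ) O ∘ nat n φ
      same : ∀ a → marks n ψ a ≡ O a
      same (i , s) = trans (cong (λ t → has t s) (st-mk _)) (has-status-at {wordGraph n φ inj} O i s)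

-- From graphs to words

map-split : ∀ {A B : Set} (h : A → B) as u {v} → map h as ≡ u ++ v →
  ∃[ bs ] ∃[ cs ] as ≡ bs ++ cs × map h bs ≡ u × map h cs ≡ v
map-split h as       []      eq = [] , as , refl , refl , eq
map-split h (a ∷ as) (x ∷ u) eq with map-split h as u (∷-injectiveʳ eq)
... | bs , cs , refl , refl , refl = a ∷ bs , cs , refl , cong (_∷ _) (∷-injectiveˡ eq) , refl

true-⇔ : ∀ {a b} → (a ≡ true ⇔ b ≡ true) → a ≡ b
true-⇔ {true}  {b}     h = sym (to h refl)
true-⇔ {false} {false} h = refl
true-⇔ {false} {true}  h = from h refl

-- T2, for the value h of the minor and the value g m of the graph when its
-- maximum edge has mark m.
Forcing : Bool → (Mark → Bool) → Set
Forcing h g = (h ≡ true → g (or +) ≡ true × g (or -) ≡ true)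
            × (h ≡ false → g blocked ≡ true → ∃[ s ] g (or s) ≡ false × g (or (opposite s)) ≡ true)
            × h ≡ g free

T2⇒forcing : ∀ {h g₊ g₋ gᵇ gᶠ g} → g₊ ≡ g (or +) → g₋ ≡ g (or -) → gᵇ ≡ g blocked → gᶠ ≡ g free →
  (h ≡ true → g₊ ≡ true × g₋ ≡ true) × (h ≡ false → gᵇ ≡ true → ExactlyOne (g₊ ≡ true) (g₋ ≡ true)) × (h ≡ true ⇔ gᶠ ≡ true) →
  Forcing h g
T2⇒forcing {g = g} refl refl refl refl (good , bad , fr) = good , (λ h bl → choose (bad h bl)) , true-⇔ fr
  where
  choose : ExactlyOne (g (or +) ≡ true) (g (or -) ≡ true) → ∃[ s ] g (or s) ≡ false × g (or (opposite s)) ≡ true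
  choose (inj₁ (p , ¬q)) = - , Bool.¬-not ¬q , p
  choose (inj₂ (¬p , q)) = + , Bool.¬-not ¬p , q

forcing-cong : ∀ {h h′ g g′} → h ≡ h′ → g ≗ g′ → Forcing h g → Forcing h′ g′
forcing-cong refl eq (good , bad , fr) =
    (λ h → trans (sym (eq _)) (proj₁ (good h)) , trans (sym (eq _)) (proj₂ (good h)))
  , (λ h bl → let s , b , g = bad h (trans (eq _) bl) in s , trans (sym (eq _)) b , trans (sym (eq _)) g)
  , trans fr (eq _)

-- The common theory of bonds and simple cycles.

module CircuitTheory (P : FourientationProperty) (pol : Polarity) (shape : Shape) where
  open FourientationProperty P
  open Words pol shape public
  open Value P public

  -- What the passage to words must know about bonds or simple cycles. `good⇔` is the defining
  -- condition of a cut or cycle property, and `natural-bad` is T1 in a graph that is a single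
  -- circuit, where a potential circuit follows the word or its mirror image.
  record Theory : Set₁ where
    field
      Circ        : (G : OOGraph) → List (OOGraph.𝔼 G) → Set
      circ-unique : ∀ {G as} → Circ G as → Unique (map proj₁ as)
      circ-rotate : ∀ {G} u {v} → Circ G (u ++ v) → Circ G (v ++ u)
      circ-mirror : ∀ {G as} → Circ G as → Circ G (reverse (map opp as))
      natural     : ∀ n φ (inj : Injective _≡_ _≡_ (key ∘ φ)) → Circ (wordGraph n φ inj) (tabulate (nat n φ))
      -- Two keys and two lists in one statement: rekeying, rotation and mirroring of words are all
      -- instances.
      same-edges  : ∀ {G as bs} O {κ κ′} → EdgeKey G κ → EdgeKey G κ′ → Circ G as → Circ G bs →
                    (∀ e → e ∈ˡ map proj₁ as ⇔ e ∈ˡ map proj₁ bs) →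
                    f (word {G} κ O as) ≡ f (word {G} κ′ O bs)
      good⇔       : ∀ G O {κ} → EdgeKey G κ →
                    Good G O ⇔ (∀ as → Circ G as → f (word {G} κ O as) ≡ true)
      natural-bad : ∀ n φ (inj : Injective _≡_ _≡_ (key ∘ φ)) O → Bad (wordGraph n φ inj) O →
                    ∃[ D ] (∀ i → Compat D (letter {wordGraph n φ inj} (key ∘ φ) O (nat n φ i)))
      Minor       : (G : OOGraph) → OOGraph.E G → OOGraph → Set
      minor-edges : ∀ {G e H} → Minor G e H → EdgeEmbedding G (∁ ｛ e ｝) H
      T2          : ∀ {G e H} → OOGraph.IsMax G e → ¬ IsIsthmus G e → ¬ OOGraph.IsLoop G e →
                    (m : Minor G e H) → ∀ O →
                    Forcing (isGood H (EdgeEmbedding.restrict (minor-edges m) O))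
                            (λ t → isGood G (_[_≔_] {G} O e ⟦ t ⟧))
      tail-minor  : ∀ n (φ : Fin (suc (suc n)) → Letter) (inj : Injective _≡_ _≡_ (key ∘ φ)) (inj′ : Injective _≡_ _≡_ (key ∘ φ ∘ suc)) →
                    ¬ IsIsthmus (wordGraph (suc n) φ inj) zero × ¬ OOGraph.IsLoop (wordGraph (suc n) φ inj) zero ×
                    (Σ[ m ∈ Minor (wordGraph (suc n) φ inj) zero (wordGraph n (φ ∘ suc) inj′) ]
                      (∀ i → EdgeEmbedding.ι (minor-edges m) i ≡ suc i))

    -- The graph behind the chord rule. Besides the two circuits through the maximum edge `e`, every
    -- circuit has the edge set of `circ₃`.
    record Theta (k : ℕ) (d : Sign) (P A : List Letter) (b : Letter) (Q : List Letter) : Set₁ where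
      field
        G        : OOGraph
      open OOGraph G using (E; 𝔼)
      field
        κ        : E → ℕ
        edgeKey  : EdgeKey G κ
        O        : OOGraph.Fourientation G
        e        : E
        max      : OOGraph.IsMax G e
        ¬isthmus : ¬ IsIsthmus G e
        ¬loop    : ¬ OOGraph.IsLoop G e
        {H}      : OOGraph
        minor    : Minor G e H
        {π α ω}  : List 𝔼
        {β}      : 𝔼
        key-e    : κ e ≡ k
        word-π   : word {G} κ O π ≡ P
        word-α   : word {G} κ O α ≡ A
        word-ω   : word {G} κ O ω ≡ Q
        letter-β : letter {G} κ O β ≡ b
        circ₁    : Circ G ((e , d) ∷ π ++ α ++ ω)
        circ₂    : Circ G ((e , d) ∷ π ++ β ∷ ω)
        circ₃    : Circ G (α ++ [ opp β ])
        circ₃-only : ∀ bs → Circ G bs → e ∉ˡ map proj₁ bs →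
                     ∀ x → x ∈ˡ map proj₁ bs ⇔ x ∈ˡ map proj₁ (α ++ [ opp β ])

  module WordRules (theory : Theory)
    (theta : ∀ k d P A b Q → A ≢ [] → (P ++ A ++ b ∷ Q) ≺ k → UniqueKeys (P ++ A ++ b ∷ Q) →
             Theory.Theta theory k d P A b Q) where
    open Theory theory

    word-off : ∀ {G} κ O e t as → e ∉ˡ map proj₁ as → word {G} κ (_[_≔_] {G} O e t) as ≡ word {G} κ O as
    word-off κ O e t [] e∉ = refl
    word-off {G} κ O e t (a ∷ as) e∉ = cong₂ _∷_
      (cong (λ τ → ⟨ _ , _ , mk τ ⟩) (status-off {G} O e t (λ eq → e∉ (here (sym eq)))))
      (word-off {G} κ O e t as (e∉ ∘ there))

    record Rep (l : List Letter) : Set₁ where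
      field
        G    : OOGraph
        κ    : OOGraph.E G → ℕ
        keyed-by : ∀ g → StrictMono g → EdgeKey G (g ∘ κ)
        O    : OOGraph.Fourientation G
        as   : List (OOGraph.𝔼 G)
        circ : Circ G as
        is   : word {G} κ O as ≡ l

    mono⇔ : ∀ {g} → StrictMono g → ∀ {i j} → (i ℕ.< j) ⇔ (g i ℕ.< g j)
    mono⇔ {g} m {i} {j} = mk⇔ m back
      where
      back : g i ℕ.< g j → i ℕ.< j
      back h with ℕ.<-cmp i j
      ... | tri< lt _ _ = lt
      ... | tri≈ _ refl _ = contradiction h (ℕ.<-irrefl refl)
      ... | tri> _ _ gt = contradiction h (ℕ.<-asym (m gt))

    natural-letter : ∀ n φ (inj : Injective _≡_ _≡_ (key ∘ φ)) i → letter {wordGraph n φ inj} (key ∘ φ) (marks n φ) (nat n φ i) ≡ φ i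
    natural-letter n φ inj i = cong (λ m → ⟨ key (φ i) , dir (φ i) , m ⟩)
      (trans (cong mk (status-has ⟦ mark (φ i) ⟧)) (mk-st (mark (φ i))))

    rep : ∀ x l → UniqueKeys (x ∷ l) → Rep (x ∷ l)
    rep x l u = record
      { G = wordGraph n φ inj
      ; κ = key ∘ φ
      ; keyed-by = λ g m e e′ → mono⇔ m
      ; O = marks n φ
      ; as = tabulate (nat n φ)
      ; circ = natural n φ inj
      ; is = trans (map-tabulate (nat n φ) _) (trans (tabulate-cong (natural-letter n φ inj)) (tabulate-lookup (x ∷ l)))
      }
      where
      n = length l
      φ = lookup (x ∷ l)
      inj = lookup-injective key (x ∷ l) u

    edgeKey-id : ∀ {l} (r : Rep l) → EdgeKey (Rep.G r) (Rep.κ r)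
    edgeKey-id r = Rep.keyed-by r id id

    rekey-inv : ∀ g → StrictMono g → ∀ l → f (map (rekey g) l) ≡ f l
    rekey-inv g m [] = refl
    rekey-inv g m (x ∷ l) with uniqueKeys? (x ∷ l)
    ... | no ¬u = trans (f-nonunique (map (rekey g) (x ∷ l)) (λ u → ¬u (Uniqueₚ.map⁻ {f = g}
            (subst Unique (trans (sym (map-∘ (x ∷ l))) (map-∘ (x ∷ l))) u)))) (sym (f-nonunique (x ∷ l) ¬u))
    ... | yes u = trans (cong f words) (trans (same-edges {G} O (keyed-by g m) (edgeKey-id r) circ circ (λ _ → ⇔-refl))
                    (cong f is))
      where
      r = rep x l u
      open Rep r
      words : map (rekey g) (x ∷ l) ≡ word {G} (g ∘ κ) O as
      words = trans (cong (map (rekey g)) (sym is)) (sym (map-∘ as))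

    f-↭-nonunique : ∀ {l l′} → l ↭ l′ → ¬ UniqueKeys l → f l′ ≡ true
    f-↭-nonunique {l} {l′} p ¬u = f-nonunique l′ (¬u ∘ ↭-UniqueKeys (↭-sym p))

    rotate-word : ∀ u v → f (u ++ v) ≡ f (v ++ u)
    rotate-word u v with u ++ v in eq
    ... | [] = sym (cong f (empty u v eq))
      where
      empty : ∀ u v → u ++ v ≡ [] → v ++ u ≡ []
      empty [] [] _ = refl
    ... | x ∷ l with uniqueKeys? (x ∷ l)
    ...   | no ¬u = trans (f-nonunique (x ∷ l) ¬u) (sym (f-↭-nonunique (↭-trans (↭-reflexive (sym eq)) (Perm.++-comm u v)) ¬u))
    ...   | yes un with map-split (letter {Rep.G (rep x l un)} (Rep.κ (rep x l un)) (Rep.O (rep x l un))) (Rep.as (rep x l un)) u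
                        (trans (Rep.is (rep x l un)) (sym eq))
    ...     | bs , cs , split , w-u , w-v = trans (cong f (sym is)) (trans
              (same-edges {G} {as} {cs ++ bs} O (edgeKey-id r) (edgeKey-id r) circ (circ-rotate bs (subst (Circ G) split circ))
                (λ e → subst (λ t → e ∈ˡ map proj₁ t ⇔ e ∈ˡ map proj₁ (cs ++ bs)) (sym split) (swap⇔ e)))
              (cong f (trans (map-++ _ cs bs) (cong₂ _++_ w-v w-u))))
      where
      r = rep x l un
      open Rep r
      ∈-swap : ∀ {e : OOGraph.E G} (xs ys : List (OOGraph.𝔼 G)) → e ∈ˡ map proj₁ (xs ++ ys) → e ∈ˡ map proj₁ (ys ++ xs)
      ∈-swap {e} xs ys h = subst (e ∈ˡ_) (sym (map-++ proj₁ ys xs)) (Any-swap (map proj₁ xs) (subst (e ∈ˡ_) (map-++ proj₁ xs ys) h))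
      swap⇔ : ∀ e → e ∈ˡ map proj₁ (bs ++ cs) ⇔ e ∈ˡ map proj₁ (cs ++ bs)
      swap⇔ e = mk⇔ (∈-swap bs cs) (∈-swap cs bs)

    mirror-word : ∀ l → f (reverse (map flip l)) ≡ f l
    mirror-word [] = refl
    mirror-word (x ∷ l) with uniqueKeys? (x ∷ l)
    ... | no ¬u = trans (f-nonunique (reverse (map flip (x ∷ l))) λ u → ¬u
           (subst Unique (trans (sym (map-∘ (x ∷ l))) refl) (↭-UniqueKeys (Perm.↭-reverse (map flip (x ∷ l))) u))) (sym (f-nonunique (x ∷ l) ¬u))
    ... | yes u = trans (cong f words) (trans (same-edges {G} {reverse (map opp as)} {as} O (edgeKey-id r) (edgeKey-id r) (circ-mirror circ) circ edges)
                    (cong f is))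
      where
      r = rep x l u
      open Rep r
      words : reverse (map flip (x ∷ l)) ≡ word {G} κ O (reverse (map opp as))
      words = trans (cong (reverse ∘ map flip) (sym is)) (trans (cong reverse (trans (sym (map-∘ as)) (map-∘ as)))
        (sym (reverse-map (letter {G} κ O) (map opp as))))
      edges : ∀ e → e ∈ˡ map proj₁ (reverse (map opp as)) ⇔ e ∈ˡ map proj₁ as
      edges e = mk⇔ (λ h → subst (e ∈ˡ_) eq (Perm.∈-resp-↭ p h)) (λ h → Perm.∈-resp-↭ (↭-sym p) (subst (e ∈ˡ_) (sym eq) h))
        where
        p : map proj₁ (reverse (map opp as)) ↭ map proj₁ (map opp as)
        p = Perm.map⁺ proj₁ (Perm.↭-reverse (map opp as))
        eq : map proj₁ (map opp as) ≡ map proj₁ as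
        eq = sym (map-∘ as)

    compat-word : ∀ l → f l ≡ false → ∃[ D ] All (Compat D) l
    compat-word [] bad = contradiction (trans (sym f-empty) bad) λ ()
    compat-word (x ∷ l) bad with f-unique (x ∷ l) bad
    ... | u with natural-bad n φ inj (marks n φ) (trans (sym (f-word x l inj)) bad)
      where
      n = length l
      φ = lookup (x ∷ l)
      inj = lookup-injective key (x ∷ l) u
    ... | D , c = D , All.tabulate λ {y} y∈ → subst (Compat D) (trans (natural-letter _ (lookup (x ∷ l)) (lookup-injective key (x ∷ l) u) (Any.index y∈)) (sym (Anyₚ.lookup-index y∈))) (c (Any.index y∈))

    -- T2 in the graph of a single circuit: the maximum letter is edge 0, and the minor is the graph
    -- of the remaining word.
    max-step : ∀ k d y l → y ∷ l ≺ k → UniqueKeys (y ∷ l) → Forcing (f (y ∷ l)) (λ m → f (⟨ k , d , m ⟩ ∷ y ∷ l))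
    max-step k d y l lt u = forcing-cong h≡ g≡ (T2 maxL (proj₁ tm) (proj₁ (proj₂ tm)) m O)
      where
      n = length l
      -- The mark `free` is a default; `g≡` overwrites it with every mark `t`.
      L = ⟨ k , d , free ⟩ ∷ y ∷ l
      φ = lookup L
      uL : UniqueKeys L
      uL = Allₚ.map⁺ (All.map (λ z<k k≡z → ℕ.<⇒≢ z<k (sym k≡z)) lt) ∷ u
      inj : Injective _≡_ _≡_ (key ∘ φ)
      inj = lookup-injective key L uL
      inj′ : Injective _≡_ _≡_ (key ∘ φ ∘ suc)
      inj′ = lookup-injective key (y ∷ l) u
      G = wordGraph (suc n) φ inj
      O = marks (suc n) φ
      tm = tail-minor n φ inj inj′
      m = proj₁ (proj₂ (proj₂ tm))
      ι≡suc = proj₂ (proj₂ (proj₂ tm))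
      maxL : OOGraph.IsMax G zero
      maxL zero ne = contradiction refl ne
      maxL (suc i) _ = All.lookup lt (∈-lookup i)
      h≡ : isGood _ (EdgeEmbedding.restrict (minor-edges m) O) ≡ f (y ∷ l)
      h≡ = trans (isGood-cong P _ (λ (i , s) → cong (λ j → O (j , s)) (ι≡suc i))) (sym (f-word y l inj′))
      F : Mark → Bool
      F t = f (⟨ k , d , t ⟩ ∷ y ∷ l)
      g≡ : ∀ t → isGood G (_[_≔_] {G} O zero ⟦ t ⟧) ≡ F t
      g≡ t = trans (sym (f-natural (suc n) φ inj (_[_≔_] {G} O zero ⟦ t ⟧)))
        (cong f (cong₂ _∷_ (cong (λ m → ⟨ k , d , m ⟩) (trans (cong mk (status-at {G} O zero ⟦ t ⟧)) (mk-st t)))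
          (trans (tabulate-cong off) (tabulate-lookup (y ∷ l)))))
        where
        off : ∀ i → letter {G} (key ∘ φ) (_[_≔_] {G} O zero ⟦ t ⟧) (nat (suc n) φ (suc i)) ≡ φ (suc i)
        off i = trans (cong (λ τ → ⟨ key (φ (suc i)) , dir (φ (suc i)) , mk τ ⟩) (status-off {G} O zero ⟦ t ⟧ {suc i} (λ ())))
                  (natural-letter (suc n) φ inj (suc i))

    blocked-good : ∀ l → Any (λ y → mark y ≡ blocked) l → f l ≡ true
    blocked-good l bl with f l in eq
    ... | true = refl
    ... | false with compat-word l eq
    ...   | D , c with All.lookupAny c bl
    ...     | inert m , b = contradiction (trans (sym m) b) λ ()
    ...     | aligned m , b = contradiction (trans (sym m) b) λ ()

    max-nonunique : ∀ k d y l → ¬ UniqueKeys (y ∷ l) → ∀ m → f (⟨ k , d , m ⟩ ∷ y ∷ l) ≡ true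
    max-nonunique k d y l ¬u m = f-nonunique _ λ { (_ ∷ u) → ¬u u }

    rules : Rules f
    rules = record
      { empty-good = f-empty
      ; rekey-inv  = rekey-inv
      ; rotate     = rotate-word
      ; mirror     = mirror-word
      ; bad-unique = f-unique
      ; bad-compat = compat-word
      ; max-free   = max-free′
      ; max-good   = max-good′
      ; max-bad    = λ k d y l lt bad → proj₁ (proj₂ (max-step k d y l lt (f-unique _ bad))) bad (blocked-good _ (here refl))
      ; chord      = chord′
      }
      where
      max-free′ : ∀ k d y l → y ∷ l ≺ k → f (⟨ k , d , free ⟩ ∷ y ∷ l) ≡ f (y ∷ l)
      max-free′ k d y l lt with uniqueKeys? (y ∷ l)
      ... | yes u = sym (proj₂ (proj₂ (max-step k d y l lt u)))
      ... | no ¬u = trans (max-nonunique k d y l ¬u free) (sym (f-nonunique (y ∷ l) ¬u))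
      max-good′ : ∀ k d s y l → y ∷ l ≺ k → f (y ∷ l) ≡ true → f (⟨ k , d , or s ⟩ ∷ y ∷ l) ≡ true
      max-good′ k d s y l lt g = by-cases (uniqueKeys? (y ∷ l)) s
        where
        by-cases : Dec (UniqueKeys (y ∷ l)) → ∀ s → f (⟨ k , d , or s ⟩ ∷ y ∷ l) ≡ true
        by-cases (no ¬u) s = max-nonunique k d y l ¬u (or s)
        by-cases (yes u) + = proj₁ (proj₁ (max-step k d y l lt u) g)
        by-cases (yes u) - = proj₂ (proj₁ (max-step k d y l lt u) g)
      -- The first two circuits make both orientations of `e` bad. This contradicts T2 (a) if the
      -- minor is good. If it is bad, T2 (b) applies, because blocking `e` makes every circuit
      -- through it good and leaves only the good third circuit.
      chord′ : ∀ k d s P A b Q → A ≢ [] → (P ++ A ++ b ∷ Q) ≺ k → key b ∉ˡ map key A →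
        f (⟨ k , d , or s ⟩ ∷ P ++ A ++ Q) ≡ false → f (A ++ [ flip b ]) ≡ true →
        f (⟨ k , d , or (opposite s) ⟩ ∷ P ++ b ∷ Q) ≡ false → ⊥
      chord′ k d s P A b Q A≢[] lt b∉A bad₁ good bad₂ = conclude (isGood H (EdgeEmbedding.restrict (minor-edges minor) O)) refl
        where
        u₁ : UniqueKeys (P ++ A ++ Q)
        u₁ with f-unique _ bad₁
        ... | _ ∷ u = u
        u₂ : UniqueKeys (b ∷ P ++ Q)
        u₂ with f-unique _ bad₂
        ... | _ ∷ u = ↭-UniqueKeys (Perm.shift b P Q) u
        -- The two bad words have distinct keys, which separates `b` from `P` and `Q`; the side
        -- condition of the rule separates it from `A`.
        b-fresh : All (λ x → key b ≢ key x) (P ++ A ++ Q)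
        b-fresh with u₂
        ... | ne ∷ _ = Allₚ.++⁺ (Allₚ.++⁻ˡ P (Allₚ.map⁻ ne)) (Allₚ.++⁺
                (All.tabulate (λ {x} x∈A eq → b∉A (subst (_∈ˡ map key A) (sym eq) (∈-map⁺ key x∈A))))
                (Allₚ.++⁻ʳ P (Allₚ.map⁻ ne)))
        u₃ : UniqueKeys (P ++ A ++ b ∷ Q)
        u₃ = ↭-UniqueKeys (↭-sym (↭-trans (↭-reflexive (sym (++-assoc P A (b ∷ Q))))
               (↭-trans (Perm.shift b (P ++ A) Q) (prep b (↭-reflexive (++-assoc P A Q))))))
               (Allₚ.map⁺ b-fresh ∷ u₁)
        open Theta (theta k d P A b Q A≢[] lt u₃)
        g : Mark → Bool
        g t = isGood G (_[_≔_] {G} O e ⟦ t ⟧)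
        off : ∀ {as} → Circ G ((e , d) ∷ as) → e ∉ˡ map proj₁ as
        off c e∈ with circ-unique c
        ... | ne ∷ _ = All.lookup ne e∈ refl
        word-e : ∀ t as {l} → Circ G ((e , d) ∷ as) → word {G} κ O as ≡ l →
                 word {G} κ (_[_≔_] {G} O e ⟦ t ⟧) ((e , d) ∷ as) ≡ ⟨ k , d , t ⟩ ∷ l
        word-e t as c eq = cong₂ _∷_
          (cong₂ (λ j m → ⟨ j , d , m ⟩) key-e (trans (cong mk (status-at {G} O e ⟦ t ⟧)) (mk-st t)))
          (trans (word-off {G} κ O e ⟦ t ⟧ as (off c)) eq)
        bad-g : ∀ t as {l} → Circ G ((e , d) ∷ as) → word {G} κ O as ≡ l → f (⟨ k , d , t ⟩ ∷ l) ≡ false → g t ≡ false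
        bad-g t as c eq bad with g t in gt
        ... | false = refl
        ... | true = contradiction (trans (sym (trans (cong f (sym (word-e t as c eq)))
                       (to (good⇔ G (_[_≔_] {G} O e ⟦ t ⟧) edgeKey) gt _ c))) bad) λ ()
        w₁ : word {G} κ O (π ++ α ++ ω) ≡ P ++ A ++ Q
        w₁ = trans (map-++ _ π (α ++ ω)) (cong₂ _++_ word-π (trans (map-++ _ α ω) (cong₂ _++_ word-α word-ω)))
        w₂ : word {G} κ O (π ++ β ∷ ω) ≡ P ++ b ∷ Q
        w₂ = trans (map-++ _ π (β ∷ ω)) (cong₂ _++_ word-π (cong₂ _∷_ letter-β word-ω))
        w₃ : word {G} κ O (α ++ [ opp β ]) ≡ A ++ [ flip b ]
        w₃ = trans (map-++ _ α [ opp β ]) (cong₂ _++_ word-α (cong (λ y → [ flip y ]) letter-β))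
        bad-s : g (or s) ≡ false
        bad-s = bad-g (or s) _ circ₁ w₁ bad₁
        bad-s′ : g (or (opposite s)) ≡ false
        bad-s′ = bad-g (or (opposite s)) _ circ₂ w₂ bad₂
        blocked-g : g blocked ≡ true
        blocked-g = from (good⇔ G (_[_≔_] {G} O e ⟦ blocked ⟧) edgeKey) all-good
          where
          O′ = _[_≔_] {G} O e ⟦ blocked ⟧
          all-good : ∀ bs → Circ G bs → f (word {G} κ O′ bs) ≡ true
          all-good bs c with DecMem._∈?_ _≟_ e (map proj₁ bs)
          ... | yes e∈ = blocked-good _ (marked bs e∈)
            where
            marked : ∀ bs → e ∈ˡ map proj₁ bs → Any (λ y → mark y ≡ blocked) (word {G} κ O′ bs)
            marked (a ∷ bs) (here refl) = here (trans (cong mk (status-at {G} O e ⟦ blocked ⟧)) (mk-st blocked))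
            marked (a ∷ bs) (there h) = there (marked bs h)
          ... | no e∉ = trans (same-edges {G} {bs} {α ++ [ opp β ]} O′ edgeKey edgeKey c circ₃ (circ₃-only bs c e∉))
                  (trans (cong f (trans (word-off {G} κ O e ⟦ blocked ⟧ (α ++ [ opp β ]) (e∉ ∘ e∈bs)) w₃)) good)
            where
            e∈bs : e ∈ˡ map proj₁ (α ++ [ opp β ]) → e ∈ˡ map proj₁ bs
            e∈bs = from (circ₃-only bs c e∉ e)
        opposite-both : ∀ r → g (or r) ≡ true → ⊥
        opposite-both r gr = contradiction (trans (sym gr) (bad r s bad-s bad-s′)) λ ()
          where
          bad : ∀ r s → g (or s) ≡ false → g (or (opposite s)) ≡ false → g (or r) ≡ false
          bad + + h _ = h
          bad - - h _ = h
          bad + - _ h = h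
          bad - + _ h = h
        conclude : ∀ h → isGood H (EdgeEmbedding.restrict (minor-edges minor) O) ≡ h → ⊥
        conclude true  eq = opposite-both + (proj₁ (proj₁ (T2 max ¬isthmus ¬loop minor O) eq))
        conclude false eq with proj₁ (proj₂ (T2 max ¬isthmus ¬loop minor O)) eq blocked-g
        ... | r , _ , gr = opposite-both (opposite r) gr

-- Builds the graph `H` of the word of a list of arcs. For a bond it turns out to be the contraction
-- onto the bond, for a simple cycle the subgraph of the cycle.
module Listed (P : FourientationProperty) (pol : Polarity) (shape : Shape)
  (G : OOGraph) (O : OOGraph.Fourientation G) {κ : OOGraph.E G → ℕ} (K : EdgeKey G κ)
  (a : OOGraph.𝔼 G) (as : List (OOGraph.𝔼 G)) (u : Unique (map proj₁ (a ∷ as))) where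
  open OOGraph G
  open CircuitTheory P pol shape
  open FourientationProperty P

  n = length as

  φ : Fin (suc n) → Letter
  φ i = letter {G} κ O (lookup (a ∷ as) i)

  φ-injective : Injective _≡_ _≡_ (key ∘ φ)
  φ-injective eq = lookup-injective proj₁ (a ∷ as) u (key-injective {G} K eq)

  H : OOGraph
  H = wordGraph n φ φ-injective

  embedding : (S : Pred E 0ℓ) → (∀ e → e ∈ S ⇔ e ∈ˡ map proj₁ (a ∷ as)) → EdgeEmbedding G S H
  embedding S S⇔ = record
    { ι = λ i → proj₁ (lookup (a ∷ as) i)
    ; ι-injective = lookup-injective proj₁ (a ∷ as) u
    ; ι-image = λ e → ⇔-trans (mk⇔ (fwd e) (bwd e)) (⇔-sym (S⇔ e))
    ; ι-order = λ x y → ⇔-sym (K _ _)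
    }
    where
    fwd : ∀ e → ∃[ x ] proj₁ (lookup (a ∷ as) x) ≡ e → e ∈ˡ map proj₁ (a ∷ as)
    fwd e (x , refl) = ∈-map⁺ proj₁ (∈-lookup x)
    bwd : ∀ e → e ∈ˡ map proj₁ (a ∷ as) → ∃[ x ] proj₁ (lookup (a ∷ as) x) ≡ e
    bwd e h with ∈-map⁻ proj₁ h
    ... | b , b∈ , refl = Any.index b∈ , cong proj₁ (sym (Anyₚ.lookup-index b∈))

  f-word-listed : f (word {G} κ O (a ∷ as)) ≡ isGood H (marks n φ)
  f-word-listed = trans (cong f (trans (cong (map (letter {G} κ O)) (sym (tabulate-lookup (a ∷ as)))) (map-tabulate (lookup (a ∷ as)) _)))
                        (f-tabulate n φ φ-injective)

  marks-restrict : ∀ x s → marks n φ (x , s) ≡ O (proj₁ (lookup (a ∷ as) x) , s)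
  marks-restrict x s = trans (cong (λ t → has t s) (st-mk _)) (has-status-at {G} O _ s)

-- Ranks of edges as keys.

module _ (G : OOGraph) where
  open OOGraph G
  private module < = IsStrictTotalOrder isStrictTotalOrder

  below : E → Subset #E
  below e = Vec.tabulate (λ f → does (f <.<? e))

  rank : E → ℕ
  rank e = Sub.∣ below e ∣

  below⁺ : ∀ {e f} → f < e → f Sub.∈ below e
  below⁺ {e} {f} lt = lookup⇒[]= f (below e) (trans (lookup∘tabulate _ f) (dec-true (f <.<? e) lt))

  below⁻ : ∀ {e f} → f Sub.∈ below e → f < e
  below⁻ {e} {f} m with f <.<? e in eq
  ... | yes lt = lt
  ... | no ¬lt = contradiction (trans (sym ([]=⇒lookup m)) (trans (lookup∘tabulate _ f) (dec-false (f <.<? e) ¬lt))) λ ()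

  rank-mono : ∀ {e f} → e < f → rank e ℕ.< rank f
  rank-mono {e} {f} lt = p⊂q⇒∣p∣<∣q∣
    ((λ m → below⁺ (<.trans (below⁻ m) lt)) , e , below⁺ lt , λ m → <.irrefl refl (below⁻ m))

  rank-key : EdgeKey G rank
  rank-key e f = mk⇔ rank-mono back
    where
    back : rank e ℕ.< rank f → e < f
    back h with <.compare e f
    ... | tri< lt _ _ = lt
    ... | tri≈ _ refl _ = contradiction h (ℕ.<-irrefl refl)
    ... | tri> _ _ gt = contradiction h (ℕ.<-asym (rank-mono gt))

  least : ∀ {Q : Pred E 0ℓ} → Decidable Q → ∀ n e → Q e → rank e ℕ.≤ n →
          ∃[ m ] Q m × (∀ f → Q f → rank m ℕ.≤ rank f)
  least Q? n e q le with any? (λ f → Q? f ×-dec (rank f ℕ.<? rank e))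
  ... | no ¬f = e , q , λ f qf → ℕ.≮⇒≥ (λ lt → ¬f (f , qf , lt))
  least Q? zero e q le | yes (f , qf , lt) = contradiction (ℕ.<-≤-trans lt le) λ ()
  least Q? (suc n) e q le | yes (f , qf , lt) = least Q? n f qf (ℕ.≤-pred (ℕ.<-≤-trans lt le))

  isMin : ∀ {S : Pred E 0ℓ} {e} → e ∈ S → (∀ f → f ∈ S → rank e ℕ.≤ rank f) → IsMin S e
  isMin {S} {e} e∈ le = e∈ , λ f f∈ f≢e → from (rank-key e f)
    (ℕ.≤∧≢⇒< (le f f∈) (λ eq → f≢e (sym (key-injective {G} rank-key eq))))

  isMin-≤ : ∀ {S : Pred E 0ℓ} {e} → IsMin S e → ∀ f → f ∈ S → rank e ℕ.≤ rank f
  isMin-≤ {S} {e} (_ , h) f f∈ with f ≟ e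
  ... | yes refl = ℕ.≤-refl
  ... | no ne = ℕ.<⇒≤ (rank-mono (h f f∈ ne))

  oriented? : ∀ O e → Dec (IsOriented O e)
  oriented? O e with status O e
  ... | unoriented = no λ ()
  ... | bioriented = no λ ()
  ... | oriented s = yes (s , refl)

-- From words to arbitrary potential cuts and cycles.

module Transfer (P : FourientationProperty) (pol : Polarity) (shape : Shape)
  (theory : CircuitTheory.Theory P pol shape) where
  open FourientationProperty P
  open CircuitTheory P pol shape
  open Theory theory

  -- The min-edge and weird properties quantify over all directed cuts or cycles, whereas `Circ`
  -- comprises simple ones. The field `sub` bridges the gap with a simple circuit through any
  -- prescribed arc.
  record Objects : Set₁ where
    field
      Ob      : OOGraph → Set
      𝔼Ob    : ∀ {G} → Ob G → Pred (OOGraph.𝔼 G) 0ℓ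
      𝔼Ob?   : ∀ {G} (ob : Ob G) → Decidable (𝔼Ob ob)
      anArc   : ∀ {G} (ob : Ob G) → ∃[ a ] a ∈ 𝔼Ob ob
      of-circ : ∀ {G as} → Circ G as → Σ[ ob ∈ Ob G ] (∀ a → a ∈ 𝔼Ob ob ⇔ a ∈ˡ as)
      one-way : ∀ {G} (ob : Ob G) {e s t} → (e , s) ∈ 𝔼Ob ob → (e , t) ∈ 𝔼Ob ob → s ≡ t
      sub     : ∀ {G} (ob : Ob G) a → a ∈ 𝔼Ob ob →
                ∃[ as ] Circ G as × a ∈ˡ as × (∀ b → b ∈ˡ as → b ∈ 𝔼Ob ob)
      Pot     : ∀ {G} → OOGraph.Fourientation G → Ob G → Set
      pot⇔    : ∀ {G} O (ob : Ob G) → Pot {G} O ob ⇔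
                (∀ e s → (e , s) ∈ 𝔼Ob ob → OOGraph.status G O e ≡ ⟦ free ⟧ ⊎ OOGraph.status G O e ≡ ⟦ or s ⟧)

  module Goodness (objects : Objects) (rules : Rules f) where
    open Objects objects
    open Consequences f rules using (classification; X; X-blocked)

    ⟦or⟧ : ∀ s → oriented s ≡ ⟦ or s ⟧
    ⟦or⟧ s = trans (sym (st-mk (oriented s))) (cong ⟦_⟧ (mk-or s))

    mk⇒ : ∀ {t m} → mk t ≡ m → t ≡ ⟦ m ⟧
    mk⇒ {t} eq = trans (sym (st-mk t)) (cong ⟦_⟧ eq)

    ⇒mk : ∀ {t m} → t ≡ ⟦ m ⟧ → mk t ≡ m
    ⇒mk {m = m} eq = trans (cong mk eq) (mk-st m)

    module _ (G : OOGraph) (O : OOGraph.Fourientation G) where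
      open OOGraph G

      κ : E → ℕ
      κ = rank G

      lett : 𝔼 → Letter
      lett = letter {G} κ O

      opp-mirror : ∀ {as : List 𝔼} e s → (e , s) ∈ˡ reverse (map opp as) ⇔ (e , opposite s) ∈ˡ as
      opp-mirror {as} e s = mk⇔ (λ m → fwd (Anyₚ.reverse⁻ m))
        (λ m → Anyₚ.reverse⁺ (subst (λ t → (e , t) ∈ˡ map opp as) (opposite-involutive s) (∈-map⁺ opp m)))
        where
        fwd : (e , s) ∈ˡ map opp as → (e , opposite s) ∈ˡ as
        fwd m with ∈-map⁻ opp m
        ... | (_ , t) , b∈ , refl = subst (λ r → (e , r) ∈ˡ as) (sym (opposite-involutive t)) b∈

      -- If the word is compatible with the direction -, the potential circuit is the mirror image
      -- of the listed one.
      turn : ∀ D {as} → Circ G as → ∃[ bs ] Circ G bs × (∀ e s → (e , s) ∈ˡ bs ⇔ (e , D * s) ∈ˡ as)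
      turn + {as} c = as , c , λ _ _ → ⇔-refl
      turn - {as} c = reverse (map opp as) , circ-mirror c , opp-mirror

      unique-keys : ∀ {as} → Circ G as → UniqueKeys (word {G} κ O as)
      unique-keys {as} c = subst Unique (trans (sym (map-∘ as)) (map-∘ as)) (Uniqueₚ.map⁺ (key-injective {G} (rank-key G)) (circ-unique c))

      pot-compat : ∀ ob → Pot {G} O ob → ∀ {as} → (∀ b → b ∈ˡ as → b ∈ 𝔼Ob ob) → All (Compat +) (word {G} κ O as)
      pot-compat ob pot as⊆ = Allₚ.map⁺ (All.tabulate λ {(e , s)} m → compat e s (to (pot⇔ O ob) pot e s (as⊆ _ m)))
        where
        compat : ∀ e s → status O e ≡ ⟦ free ⟧ ⊎ status O e ≡ ⟦ or s ⟧ → Compat + (lett (e , s))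
        compat e s (inj₁ eq) = inert (⇒mk eq)
        compat e s (inj₂ eq) = aligned (⇒mk eq)

      compat-pot : ∀ D {as bs} → (∀ e s → (e , s) ∈ˡ bs ⇔ (e , D * s) ∈ˡ as) → All (Compat D) (word {G} κ O as) →
                   ∀ ob → (∀ a → a ∈ 𝔼Ob ob ⇔ a ∈ˡ bs) → Pot {G} O ob
      compat-pot D {as} turned c ob arcs⇔ = from (pot⇔ O ob) λ e s m →
        status-of e s (All.lookup c (∈-map⁺ lett (to (turned e s) (to (arcs⇔ _) m))))
        where
        status-of : ∀ e s → Compat D (lett (e , D * s)) → status O e ≡ ⟦ free ⟧ ⊎ status O e ≡ ⟦ or s ⟧
        status-of e s (inert eq) = inj₁ (mk⇒ eq)
        status-of e s (aligned eq) = inj₂ (mk⇒ (trans eq (cong or (sense D s))))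

      word-good : Good G O ⇔ (∀ as → Circ G as → f (word {G} κ O as) ≡ true)
      word-good = good⇔ G O (rank-key G)

      good-unless : (∀ as → Circ G as → f (word {G} κ O as) ≡ false → ⊥) → Good G O
      good-unless h = from word-good λ as c → true-of as c
        where
        true-of : ∀ as → Circ G as → f (word {G} κ O as) ≡ true
        true-of as c with f (word {G} κ O as) in eq
        ... | true = refl
        ... | false = ⊥-elim (h as c eq)

      MinEdgeGood : (Status → Bool) → Sign → Set
      MinEdgeGood Y δ = ∀ ob → Pot {G} O ob → ¬ BadMinEdge G O ⟦ free ⟧ Y δ (𝔼Ob ob)

      WeirdGood : Sign → Set
      WeirdGood s = ∀ ob → Pot {G} O ob → MinOriented G O s (𝔼Ob ob)

      edges-of-word : ∀ {as y} → y ∈ˡ word {G} κ O as → ∃[ a ] a ∈ˡ as × y ≡ lett a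
      edges-of-word m = ∈-map⁻ lett m

      -- Inside a bad potential object, the simple circuit through the minimum edge is again
      -- potential and has the same minimum edge in the same direction, so its word is bad.
      min-edge-good : ∀ Y δ → (∀ m → Y m ≡ X (mk m)) → (∀ l → UniqueKeys l → f l ≡ false ⇔ MinEdgeBad X δ l) → Good G O ⇔ MinEdgeGood Y δ
      min-edge-good Y δ Y≡ std = mk⇔ fwd bwd
        where
        fwd : Good G O → MinEdgeGood Y δ
        fwd g ob pot (e , min@((s , e∈) , _) , Ye , at-free) with sub ob (e , s) e∈
        ... | as , c , m , as⊆ = contradiction (trans (sym (to word-good g as c)) (from (std _ (unique-keys c))
                (+ , pot-compat ob pot as⊆ , lett (e , s) ,
                  (∈-map⁺ lett m , Allₚ.map⁺ (All.tabulate λ {(f , t)} f∈ → isMin-≤ G min f (t , as⊆ _ f∈))) ,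
                  trans (sym (Y≡ _)) Ye , sign))) λ ()
          where
          sign : mk (status O e) ≡ free → + ≡ δ * s
          sign fr with one-way ob e∈ (at-free (mk⇒ fr))
          ... | refl = sym (s*s≡+ s)
        bwd : MinEdgeGood Y δ → Good G O
        bwd h = good-unless λ as c bad → case as c (to (std _ (unique-keys c)) bad)
          where
          dir-eq : ∀ D δ s → D ≡ δ * s → s ≡ D * δ
          dir-eq _ + + refl = refl
          dir-eq _ + - refl = refl
          dir-eq _ - + refl = refl
          dir-eq _ - - refl = refl
          case : ∀ as → Circ G as → MinEdgeBad X δ (word {G} κ O as) → ⊥
          case as c (D , compat , y , (y∈ , y≤) , Xy , sgn) with edges-of-word {as} y∈ | turn D c
          ... | (e , s) , e∈ , refl | bs , c′ , turned with of-circ c′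
          ...   | ob , arcs⇔ = h ob (compat-pot D turned compat ob arcs⇔)
                  (e , isMin G (D * s , from (arcs⇔ _) (from (turned e (D * s)) (subst (λ t → (e , t) ∈ˡ as) (sym (sense D s)) e∈)))
                         (λ { f (t , f∈) → All.lookup y≤ (∈-map⁺ lett (to (turned f t) (to (arcs⇔ _) f∈))) })
                  , trans (Y≡ _) Xy
                  , λ fr → from (arcs⇔ _) (from (turned e δ) (subst (λ t → (e , t) ∈ˡ as) (dir-eq D δ s (sgn (⇒mk fr))) e∈)))

      -- The word classification names the bad sign of the first oriented edge and the property its
      -- good sign, hence `opposite s`. If a potential object violates the property, so does a
      -- simple circuit in it: one through its minimum oriented edge, or through any edge when none
      -- is oriented.
      weird-good : ∀ s → (∀ l → UniqueKeys l → f l ≡ false ⇔ WeirdBad s l) → Good G O ⇔ WeirdGood (opposite s)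
      weird-good s std = mk⇔ fwd bwd
        where
        module _ (ob : Ob G) where
          InOb : Pred E 0ℓ
          InOb e = e ∈ edgesOf (𝔼Ob ob) × IsOriented O e
          inOb? : Decidable InOb
          inOb? e = edge? ×-dec oriented? G O e
            where
            edge? : Dec (e ∈ edgesOf (𝔼Ob ob))
            edge? with 𝔼Ob? ob (e , +) | 𝔼Ob? ob (e , -)
            ... | yes p | _ = yes (+ , p)
            ... | no _ | yes p = yes (- , p)
            ... | no ¬p | no ¬q = no λ { (+ , p) → ¬p p ; (- , q) → ¬q q }

        bad-sub : Good G O → ∀ ob → Pot {G} O ob → ∀ a → a ∈ 𝔼Ob ob →
          (∀ as → a ∈ˡ as → (∀ b → b ∈ˡ as → b ∈ 𝔼Ob ob) → ∀ y → y ∈ˡ word {G} κ O as → Oriented y →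
            (∀ z → z ∈ˡ word {G} κ O as → Oriented z → key y ℕ.≤ key z) → mark y ≡ or s) → ⊥
        bad-sub g ob pot a a∈ sgn with sub ob a a∈
        ... | as , c , m , as⊆ = contradiction (trans (sym (to word-good g as c)) (from (std _ (unique-keys c))
                (nonempty as m , + , pot-compat ob pot as⊆ , sgn as m as⊆))) λ ()
          where
          nonempty : ∀ as → a ∈ˡ as → word {G} κ O as ≢ []
          nonempty (_ ∷ _) _ ()

        oriented-mark : ∀ {e t} → status O e ≡ oriented t → mk (status O e) ≡ or t
        oriented-mark {t = t} eq = ⇒mk (trans eq (⟦or⟧ t))

        mark-oriented : ∀ {e t} → mk (status O e) ≡ or t → status O e ≡ oriented t
        mark-oriented {t = t} eq = trans (mk⇒ eq) (sym (⟦or⟧ t))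

        fwd : Good G O → WeirdGood (opposite s)
        fwd g ob pot with any? (inOb? ob)
        ... | no none = ⊥-elim (bad-sub g ob pot _ (proj₂ (anArc ob)) λ as m as⊆ y y∈ (t , o) _ → ⊥-elim (absurd as as⊆ y y∈ t o))
          where
          absurd : ∀ as → (∀ b → b ∈ˡ as → b ∈ 𝔼Ob ob) → ∀ y → y ∈ˡ word {G} κ O as → ∀ t → mark y ≡ or t → ⊥
          absurd as as⊆ y y∈ t o with edges-of-word {as} y∈
          ... | (e , r) , e∈ , refl = none (e , (r , as⊆ _ e∈) , t , mark-oriented o)
        ... | yes (e₀ , q₀) with least G (inOb? ob) (κ e₀) e₀ q₀ ℕ.≤-refl
        ...   | e , q@((r , e∈) , t , st) , e≤ with t ≟ˢ opposite s
        ...     | yes refl = e , isMin G q e≤ , st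
        ...     | no ne = ⊥-elim (bad-sub g ob pot (e , r) e∈ λ as m as⊆ y y∈ o min → same as m as⊆ y y∈ o min)
          where
          t≡s : t ≡ s
          t≡s = trans (≢⇒opposite ne) (opposite-involutive s)
          same : ∀ as → (e , r) ∈ˡ as → (∀ b → b ∈ˡ as → b ∈ 𝔼Ob ob) → ∀ y → y ∈ˡ word {G} κ O as → Oriented y →
            (∀ z → z ∈ˡ word {G} κ O as → Oriented z → key y ℕ.≤ key z) → mark y ≡ or s
          same as m as⊆ y y∈ (t′ , o) min with edges-of-word {as} y∈
          ... | (e′ , r′) , e′∈ , refl with key-injective {G} (rank-key G) (ℕ.≤-antisym
                  (min _ (∈-map⁺ lett m) (t , oriented-mark st))
                  (e≤ e′ ((r′ , as⊆ _ e′∈) , t′ , mark-oriented o)))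
          ...   | refl = trans (oriented-mark st) (cong or t≡s)

        bwd : WeirdGood (opposite s) → Good G O
        bwd h = good-unless λ as c bad → case as c (to (std _ (unique-keys c)) bad)
          where
          case : ∀ as → Circ G as → WeirdBad s (word {G} κ O as) → ⊥
          case as c (_ , D , compat , sgn) with turn D c
          ... | bs , c′ , turned with of-circ c′
          ...   | ob , arcs⇔ with h ob (compat-pot D turned compat ob arcs⇔)
          ...     | e , min@(((r , e∈) , _) , _) , st = s≢opp (or-injective (trans (sym
                      (sgn _ (∈-map⁺ lett (to (turned e r) (to (arcs⇔ _) e∈))) (_ , oriented-mark st) least-e)) (oriented-mark st)))
            where
            least-e : ∀ z → z ∈ˡ word {G} κ O as → Oriented z → κ e ℕ.≤ key z
            least-e z z∈ (t , o) with edges-of-word {as} z∈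
            ... | (e′ , r′) , e′∈ , refl = isMin-≤ G min e′
                  ((D * r′ , from (arcs⇔ _) (from (turned e′ (D * r′)) (subst (λ t → (e′ , t) ∈ˡ as) (sym (sense D r′)) e′∈)))
                  , t , mark-oriented o)

-- Cuts

↭-Unique : ∀ {A : Set} {l l′ : List A} → l ↭ l′ → Unique l → Unique l′
↭-Unique p = PermS.Unique-resp-↭ (setoid _) (↭⇒↭ₛ p)

∈⇒true : ∀ {n} {U : Subset n} {x} → x Sub.∈ U → Vec.lookup U x ≡ true
∈⇒true = []=⇒lookup

true⇒∈ : ∀ {n} {U : Subset n} {x} → Vec.lookup U x ≡ true → x Sub.∈ U
true⇒∈ {U = U} {x} = lookup⇒[]= x U

lookup-∁ : ∀ {n} (U : Subset n) x → Vec.lookup (Sub.∁ U) x ≡ not (Vec.lookup U x)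
lookup-∁ U x = lookup-map x not U

∈∁⇒false : ∀ {n} {U : Subset n} {x} → x Sub.∈ Sub.∁ U → Vec.lookup U x ≡ false
∈∁⇒false {U = U} {x} h = trans (sym (not-involutive _)) (cong not (trans (sym (lookup-∁ U x)) (∈⇒true h)))

false⇒∈∁ : ∀ {n} {U : Subset n} {x} → Vec.lookup U x ≡ false → x Sub.∈ Sub.∁ U
false⇒∈∁ {U = U} {x} h = true⇒∈ (trans (lookup-∁ U x) (cong not h))

∁-involutive : ∀ {n} (U : Subset n) → Sub.∁ (Sub.∁ U) ≡ U
∁-involutive U = trans (sym (Vecₚ.map-∘ not not U)) (trans (Vecₚ.map-cong not-involutive U) (Vecₚ.map-id U))

true≢false : ∀ {b} → b ≡ true → b ≡ false → ⊥
true≢false refl ()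

cutPolarity : Polarity
cutPolarity = record
  { ⟦_⟧ = λ { free → unoriented ; blocked → bioriented ; (or s) → oriented s }
  ; mk = λ { unoriented → free ; bioriented → blocked ; (oriented s) → or s }
  ; mk-st = λ { free → refl ; blocked → refl ; (or s) → refl }
  ; st-mk = λ { unoriented → refl ; bioriented → refl ; (oriented s) → refl }
  ; mk-or = λ _ → refl }

bondShape : Shape
bondShape = record
  { vert = λ _ → 1
  ; fro = λ _ _ → zero
  ; into = λ _ _ → suc zero
  ; reach = λ { n R h h′ zero zero → ε ; n R h h′ zero (suc zero) → h zero ◅ ε
              ; n R h h′ (suc zero) zero → h′ zero ◅ ε ; n R h h′ (suc zero) (suc zero) → ε } }

module _ {G : OOGraph} where
  open OOGraph G

  walk-path : ∀ {u v} (w : Walk u v) → Path graph u (arcs w) v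
  walk-path ε = []
  walk-path ((a , p , refl) ◅ w) = step p (walk-path w)

  joined-same : ∀ {S : Pred E _} {A : Set} (π : V → A) → (∀ a → proj₁ a ∈ S → π (src a) ≡ π (tgt a)) →
                ∀ {u v} → Joined S u v → π u ≡ π v
  joined-same π h ε = refl
  joined-same π h (((a , refl , refl) , a∈S) ◅ w) = trans (h a a∈S) (joined-same π h w)

  joined-map : ∀ {S T : Pred E _} → (∀ e → e ∈ S → e ∈ T) → ∀ {u v} → Joined S u v → Joined T u v
  joined-map h ε = ε
  joined-map h ((a , a∈S) ◅ w) = (a , h _ a∈S) ◅ joined-map h w

module _ {G : OOGraph} (Cu : Cut G) where
  open OOGraph G
  open Cut Cu

  side : V → Bool
  side = Vec.lookup U

  crossing : ∀ a → a ∈ 𝔼Cu ⇔ (side (src a) ≡ true × side (tgt a) ≡ false)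
  crossing a = mk⇔ (λ (p , q) → ∈⇒true p , ∈∁⇒false q) (λ (p , q) → true⇒∈ p , false⇒∈∁ q)

  -- Decides equality of the two sides, so `no` is the answer for an edge of the cut.
  crossing? : ∀ e → Dec (side (tail e) ≡ side (head e))
  crossing? e = side (tail e) Bool.≟ side (head e)

  arcOf : E → 𝔼
  arcOf e = e , (if side (tail e) then + else -)

  arcOf-crossing : ∀ e → side (tail e) ≢ side (head e) → arcOf e ∈ 𝔼Cu
  arcOf-crossing e ne with side (tail e) in p | side (head e) in q
  ... | true  | true  = contradiction refl ne
  ... | true  | false = true⇒∈ p , false⇒∈∁ q
  ... | false | true  = true⇒∈ q , false⇒∈∁ p
  ... | false | false = contradiction refl ne

  crossing-arcOf : ∀ a → a ∈ 𝔼Cu → side (tail (proj₁ a)) ≢ side (head (proj₁ a)) × a ≡ arcOf (proj₁ a)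
  crossing-arcOf (e , +) h with to (crossing (e , +)) h
  ... | p , q rewrite p | q = (λ ()) , refl
  crossing-arcOf (e , -) h with to (crossing (e , -)) h
  ... | p , q rewrite p | q = (λ ()) , refl

  cutArcs : List 𝔼
  cutArcs = map arcOf (filter (λ e → ¬? (crossing? e)) (allFin #E))

  cutArcs-edges : map proj₁ cutArcs ≡ filter (λ e → ¬? (crossing? e)) (allFin #E)
  cutArcs-edges = trans (sym (map-∘ _)) (map-id _)

  cutArcs-unique : Unique (map proj₁ cutArcs)
  cutArcs-unique = subst Unique (sym cutArcs-edges) (Uniqueₚ.filter⁺ _ (Uniqueₚ.allFin⁺ #E))

  cutArcs-∈ : ∀ a → a ∈ 𝔼Cu ⇔ a ∈ˡ cutArcs
  cutArcs-∈ a = mk⇔ fwd bwd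
    where
    fwd : a ∈ 𝔼Cu → a ∈ˡ cutArcs
    fwd h with crossing-arcOf a h
    ... | ne , eq = subst (_∈ˡ cutArcs) (sym eq) (∈-map⁺ arcOf (∈-filter⁺ _ (∈-allFin _) ne))
    bwd : a ∈ˡ cutArcs → a ∈ 𝔼Cu
    bwd h with ∈-map⁻ arcOf h
    ... | e , e∈ , refl = arcOf-crossing e (proj₂ (∈-filter⁻ _ {xs = allFin #E} e∈))

  edge-crossing : ∀ e → e ∈ ECu ⇔ (side (tail e) ≢ side (head e))
  edge-crossing e = mk⇔ (λ (s , h) → proj₁ (crossing-arcOf (e , s) h)) (λ ne → proj₂ (arcOf e) , arcOf-crossing e ne)

  non-crossing : ∀ e → e ∈ ∁ ECu → side (tail e) ≡ side (head e)
  non-crossing e h with crossing? e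
  ... | yes eq = eq
  ... | no ne = contradiction (from (edge-crossing e) ne) h

  complement : Cut G
  complement = record
    { U = Sub.∁ U ; nonempty = nonemptyᶜ
    ; nonemptyᶜ = subst Nonempty (sym (∁-involutive U)) nonempty }

  complement-crossing : ∀ a → a ∈ Cut.𝔼Cu complement ⇔ opp a ∈ 𝔼Cu
  complement-crossing a = mk⇔
    (λ (p , q) → subst (Sub._∈ U) (sym (src-opp {graph} a)) (subst (tgt a Sub.∈_) (∁-involutive U) q) ,
                 subst (Sub._∈ Sub.∁ U) (sym (tgt-opp {graph} a)) p)
    (λ (p , q) → subst (Sub._∈ Sub.∁ U) (tgt-opp {graph} a) q ,
                 subst (tgt a Sub.∈_) (sym (∁-involutive U)) (subst (Sub._∈ U) (src-opp {graph} a) p))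

  complement-simple : SimpleCut G Cu → SimpleCut G complement
  complement-simple (c , c′) = c′ , subst (InducedConnected G) (sym (∁-involutive U)) c

  crosses-back : ∀ {u as v} → Path graph u as v → side u ≡ false → side v ≡ true →
                 ∃[ a ] a ∈ˡ as × proj₁ a ∈ ECu
  crosses-back p hu hv with path-crosses {graph} (not ∘ side) p (cong not hu) (cong not hv)
  ... | a , a∈ , p′ , q′ = a , a∈ , from (edge-crossing (proj₁ a)) (ne a p′ q′)
    where
    ne : ∀ a → not (side (src a)) ≡ true → not (side (tgt a)) ≡ false → side (tail (proj₁ a)) ≢ side (head (proj₁ a))
    ne (e , +) h h′ eq = true≢false h (trans (cong not eq) h′)
    ne (e , -) h h′ eq = true≢false h (trans (cong not (sym eq)) h′)

-- A cut containing `a` must also be crossed by the return path `as`. If the edge of `a` were its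
-- only edge, it would occur in `as`.
not-isthmus : ∀ {G} a as → let open OOGraph G in Path graph (tgt a) as (src a) → proj₁ a ∉ˡ map proj₁ as → ¬ IsIsthmus G (proj₁ a)
not-isthmus {G} a as p a∉ (Cu , only) = case a p (from (only (proj₁ a)) refl)
  where
  open OOGraph G
  hit : ∀ {u v} → Path graph u as v → side Cu u ≡ false → side Cu v ≡ true → ⊥
  hit q hu hv with crosses-back Cu q hu hv
  ... | b , b∈ , b∈Cu = a∉ (subst (_∈ˡ map proj₁ as) (to (only (proj₁ b)) b∈Cu) (∈-map⁺ proj₁ b∈))
  hit′ : ∀ {u v} → Path graph u as v → side Cu u ≡ true → side Cu v ≡ false → ⊥
  hit′ q hu hv with crosses-back (complement Cu) q (trans (lookup-∁ (Cut.U Cu) _) (cong not hu)) (trans (lookup-∁ (Cut.U Cu) _) (cong not hv))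
  ... | b , b∈ , t , b∈Cu = a∉ (subst (_∈ˡ map proj₁ as) (to (only (proj₁ b)) (opposite t , to (complement-crossing Cu (proj₁ b , t)) b∈Cu)) (∈-map⁺ proj₁ b∈))
  case : ∀ c → Path graph (tgt c) as (src c) → proj₁ c ∈ Cut.ECu Cu → ⊥
  case (e , +) q (+ , h) = let p , q′ = to (crossing Cu (e , +)) h in hit q q′ p
  case (e , +) q (- , h) = let p , q′ = to (crossing Cu (e , -)) h in hit′ q p q′
  case (e , -) q (+ , h) = let p , q′ = to (crossing Cu (e , +)) h in hit′ q p q′
  case (e , -) q (- , h) = let p , q′ = to (crossing Cu (e , -)) h in hit q q′ p

module _ {G S H S′ H′} (c : Contraction G S H) (c′ : Contraction G S′ H′) (S⇔S′ : ∀ e → e ∈ S ⇔ e ∈ S′) where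
  private
    module c = Contraction c
    module c′ = Contraction c′
    module G = OOGraph G
    lift : ∀ y → ∃[ v ] c.π v ≡ y
    lift y = let v , h = c.π-surjective y in v , h refl
    lift′ : ∀ y → ∃[ v ] c′.π v ≡ y
    lift′ y = let v , h = c′.π-surjective y in v , h refl
    fibres : ∀ u v → c.π u ≡ c.π v ⇔ c′.π u ≡ c′.π v
    fibres u v = mk⇔
      (λ h → from (c′.π-fibres u v) (joined-map {G} (λ e → to (S⇔S′ e)) (to (c.π-fibres u v) h)))
      (λ h → from (c.π-fibres u v) (joined-map {G} (λ e → from (S⇔S′ e)) (to (c′.π-fibres u v) h)))
    S̄⇔ : ∀ e → e ∈ ∁ S ⇔ e ∈ ∁ S′
    S̄⇔ e = mk⇔ (λ h s → h (from (S⇔S′ e) s)) (λ h s → h (to (S⇔S′ e) s))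
    onV : OOGraph.V H → OOGraph.V H′
    onV y = c′.π (proj₁ (lift y))
    onV-π : ∀ v → onV (c.π v) ≡ c′.π v
    onV-π v = to (fibres _ _) (proj₂ (lift (c.π v)))

  -- Both vertex sets are quotients of the vertices of `G` by being joined inside the same set of
  -- edges; representatives supplied by surjectivity match the classes.
  contraction-iso : ∀ O → Isomorphism H (c.restrict O) H′ (c′.restrict O)
  contraction-iso O = record
    { verts = mk↔ₛ′ onV (λ y → c.π (proj₁ (lift′ y)))
        (λ y → trans (onV-π _) (proj₂ (lift′ y)))
        (λ y → trans (from (fibres _ _) (proj₂ (lift′ (onV y)))) (proj₂ (lift y)))
    ; edges = embedding-↔ c.edges c′.edges S̄⇔
    ; tail-comm = λ x → trans (cong onV (c.tail-comm x)) (trans (onV-π _)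
        (trans (cong (c′.π ∘ G.tail) (sym (embedding-ι c.edges c′.edges S̄⇔ x))) (sym (c′.tail-comm _))))
    ; head-comm = λ x → trans (cong onV (c.head-comm x)) (trans (onV-π _)
        (trans (cong (c′.π ∘ G.head) (sym (embedding-ι c.edges c′.edges S̄⇔ x))) (sym (c′.head-comm _))))
    ; order = embedding-order c.edges c′.edges S̄⇔
    ; fourient = λ x s → cong (λ e → O (e , s)) (sym (embedding-ι c.edges c′.edges S̄⇔ x))
    }

-- Bonds and the contractions onto them.

module CutTheory (P : FourientationProperty) (tutte : IsTutteCutProperty P) where
  open FourientationProperty P
  open IsTutteCutProperty tutte
  open CircuitTheory P cutPolarity bondShape

  IsBond : (G : OOGraph) → List (OOGraph.𝔼 G) → Set
  IsBond G as = Σ[ Cu ∈ Cut G ] SimpleCut G Cu × Unique (map proj₁ as) × (∀ a → a ∈ Cut.𝔼Cu Cu ⇔ a ∈ˡ as)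

  module Bond {G : OOGraph} (Cu : Cut G) (simple : SimpleCut G Cu) where
    open OOGraph G
    open Cut Cu

    edges⇔ : ∀ {as} → (∀ a → a ∈ 𝔼Cu ⇔ a ∈ˡ as) → ∀ e → e ∈ ECu ⇔ e ∈ˡ map proj₁ as
    edges⇔ {as} h e = mk⇔ (λ (s , p) → ∈-map⁺ proj₁ (to (h (e , s)) p)) bwd
      where
      bwd : e ∈ˡ map proj₁ as → e ∈ ECu
      bwd m with ∈-map⁻ proj₁ m
      ... | (_ , s) , b∈ , refl = s , from (h _) b∈

    module Standard (O : Fourientation) {κ} (K : EdgeKey G κ) (a : 𝔼) (as : List 𝔼) (u : Unique (map proj₁ (a ∷ as)))
                    (arcs⇔ : ∀ b → b ∈ 𝔼Cu ⇔ b ∈ˡ a ∷ as) where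
      open Listed P cutPolarity bondShape G O K a as u

      toSide : Bool → Fin 2
      toSide true  = zero
      toSide false = suc zero

      toSide-injective : ∀ {b c} → toSide b ≡ toSide c → b ≡ c
      toSide-injective {true} {true} _ = refl
      toSide-injective {false} {false} _ = refl

      same-side : ∀ u v → side Cu u ≡ side Cu v → Joined (∁ ECu) u v
      same-side u v eq with side Cu u in eu
      ... | true = joined-map {G} (λ e (p , q) e∈ → to (edge-crossing Cu e) e∈ (trans (∈⇒true p) (sym (∈⇒true q))))
                     (proj₁ simple (true⇒∈ eu) (true⇒∈ (sym eq)))
      ... | false = joined-map {G} (λ e (p , q) e∈ → to (edge-crossing Cu e) e∈ (trans (∈∁⇒false p) (sym (∈∁⇒false q))))
                     (proj₂ simple (false⇒∈∁ eu) (false⇒∈∁ (sym eq)))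

      ends : ∀ x → let b = lookup (a ∷ as) x in side Cu (src b) ≡ true × side Cu (tgt b) ≡ false
      ends x = to (crossing Cu (lookup (a ∷ as) x)) (from (arcs⇔ (lookup (a ∷ as) x)) (∈-lookup x))

      tail-comm′ : ∀ b x → side Cu (src b) ≡ true × side Cu (tgt b) ≡ false →
                   tl n (proj₂ b) x ≡ toSide (side Cu (tail (proj₁ b))) × hd n (proj₂ b) x ≡ toSide (side Cu (head (proj₁ b)))
      tail-comm′ (e , +) x (p , q) rewrite p | q = refl , refl
      tail-comm′ (e , -) x (p , q) rewrite p | q = refl , refl

      -- Simplicity makes each side connected by edges outside the cut, so contracting these edges
      -- leaves precisely two vertices.
      contraction : Contraction G (∁ ECu) H
      contraction = record
        { edges = embedding (∁ (∁ ECu)) (λ e → ⇔-trans (mk⇔ (λ nn → decide nn) (λ p n → n p)) (edges⇔ arcs⇔ e))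
        ; π = toSide ∘ side Cu
        ; π-surjective = surj
        ; π-fibres = λ u v → mk⇔ (λ h → same-side u v (toSide-injective h))
            (λ j → cong toSide (joined-same {G} (side Cu) (λ b n → arc-same b (non-crossing Cu _ n)) j))
        ; tail-comm = λ x → proj₁ (tail-comm′ (lookup (a ∷ as) x) x (ends x))
        ; head-comm = λ x → proj₂ (tail-comm′ (lookup (a ∷ as) x) x (ends x))
        }
        where
        decide : ∀ {e} → ¬ ¬ (e ∈ ECu) → e ∈ ECu
        decide {e} nn with crossing? Cu e
        ... | yes eq = contradiction (λ e∈ → to (edge-crossing Cu e) e∈ eq) nn
        ... | no ne = from (edge-crossing Cu e) ne
        surj : ∀ y → ∃[ v ] (∀ {z} → z ≡ v → toSide (side Cu z) ≡ y)
        surj zero = proj₁ nonempty , λ { refl → cong toSide (∈⇒true (proj₂ nonempty)) }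
        surj (suc zero) = proj₁ nonemptyᶜ , λ { refl → cong toSide (∈∁⇒false (proj₂ nonemptyᶜ)) }
        arc-same : ∀ b → side Cu (tail (proj₁ b)) ≡ side Cu (head (proj₁ b)) → side Cu (src b) ≡ side Cu (tgt b)
        arc-same (e , +) h = h
        arc-same (e , -) h = sym h

    value-minor : ∀ O {κ} → EdgeKey G κ → ∀ {as} → Unique (map proj₁ as) → (∀ b → b ∈ 𝔼Cu ⇔ b ∈ˡ as) →
                  ∀ {S H} → (∀ e → e ∈ ∁ ECu ⇔ e ∈ S) → (c : Contraction G S H) →
                  isGood H (Contraction.restrict c O) ≡ f (word {G} κ O as)
    -- A cut of a connected graph has an edge, so the list of its arcs is nonempty.
    value-minor O K {[]} u arcs⇔ S⇔ c = ⊥-elim (no-arcs (path-crosses {graph} (side Cu)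
        (walk-path {G} (connected (proj₁ nonempty) (proj₁ nonemptyᶜ))) (∈⇒true (proj₂ nonempty)) (∈∁⇒false (proj₂ nonemptyᶜ))))
      where
      no-arcs : ∃[ a ] _ × side Cu (src a) ≡ true × side Cu (tgt a) ≡ false → ⊥
      no-arcs (a , _ , p , q) with to (arcs⇔ a) (from (crossing Cu a) (p , q))
      ... | ()
    value-minor O K {a ∷ as} u arcs⇔ {S} {H′} S⇔ c =
      trans (invariant (contraction-iso c contraction (λ e → ⇔-sym (S⇔ e)) O))
        (trans (isGood-cong P H (λ (x , s) → sym (marks-restrict x s))) (sym f-word-listed))
      where
      open Standard O K a as u arcs⇔
      open Listed P cutPolarity bondShape G O K a as u

  -- Equal edge sets mean equal contracted sets, so both words give the value of one and the same
  -- contraction.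
  same-bond : ∀ {G as bs} O {κ κ′} → EdgeKey G κ → EdgeKey G κ′ → IsBond G as → IsBond G bs →
              (∀ e → e ∈ˡ map proj₁ as ⇔ e ∈ˡ map proj₁ bs) → f (word {G} κ O as) ≡ f (word {G} κ′ O bs)
  same-bond {G} {[]} {[]} O K K′ _ _ eq = refl
  same-bond {G} {a ∷ as} {[]} O K K′ _ _ eq with to (eq (proj₁ a)) (here refl)
  ... | ()
  same-bond {G} {as} {b ∷ bs} O K K′ (Cu , simple , u , h) (Cu′ , simple′ , u′ , h′) eq =
    trans (sym (Bond.value-minor Cu simple O K u h S⇔ c)) (Bond.value-minor Cu′ simple′ O K′ u′ h′ (λ _ → ⇔-refl) c)
    where
    c = Bond.Standard.contraction Cu′ simple′ O K′ b bs u′ h′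
    E⇔ : ∀ e → e ∈ Cut.ECu Cu ⇔ e ∈ Cut.ECu Cu′
    E⇔ e = ⇔-trans (Bond.edges⇔ Cu simple h e) (⇔-trans (eq e) (⇔-sym (Bond.edges⇔ Cu′ simple′ h′ e)))
    S⇔ : ∀ e → e ∈ ∁ (Cut.ECu Cu) ⇔ e ∈ ∁ (Cut.ECu Cu′)
    S⇔ e = mk⇔ (λ n m → n (from (E⇔ e) m)) (λ n m → n (to (E⇔ e) m))

  bond-good⇔ : ∀ G O {κ} → EdgeKey G κ → Good G O ⇔ (∀ as → IsBond G as → f (word {G} κ O as) ≡ true)
  bond-good⇔ G O K = mk⇔ fwd bwd
    where
    fwd : Good G O → ∀ as → IsBond G as → f (word {G} _ O as) ≡ true
    fwd g [] _ = f-empty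
    fwd g (a ∷ as) (Cu , simple , u , h) =
      trans (sym (Bond.value-minor Cu simple O K u h (λ _ → ⇔-refl) c)) (to (isCutProperty G O) g Cu simple _ c)
      where c = Bond.Standard.contraction Cu simple O K a as u h
    bwd : (∀ as → IsBond G as → f (word {G} _ O as) ≡ true) → Good G O
    bwd h = from (isCutProperty G O) λ Cu simple H c →
      trans (Bond.value-minor Cu simple O K (cutArcs-unique Cu) (cutArcs-∈ Cu) (λ _ → ⇔-refl) c)
        (h (cutArcs Cu) (Cu , simple , cutArcs-unique Cu , cutArcs-∈ Cu))

  cut-T2 : ∀ {G e H} → OOGraph.IsMax G e → ¬ IsIsthmus G e → ¬ OOGraph.IsLoop G e →
           (m : Deletion G ｛ e ｝ H) → ∀ O →
           Forcing (isGood H (EdgeEmbedding.restrict (Deletion.edges m) O)) (λ t → isGood G (_[_≔_] {G} O e ⟦ t ⟧))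
  cut-T2 {G} {e} {H} mx ni nl m O = T2⇒forcing {g = λ t → isGood G (_[_≔_] {G} O e ⟦ t ⟧)}
    (isGood-cong P G (extend-oriented d O +)) (isGood-cong P G (extend-oriented d O -))
    (isGood-cong P G (extend-bioriented d O)) (isGood-cong P G (extend-unoriented d O))
    (T2 G e mx ni nl H m (EdgeEmbedding.restrict d O))
    where d = Deletion.edges m

  bond-rotate : ∀ {G} u {v} → IsBond G (u ++ v) → IsBond G (v ++ u)
  bond-rotate u {v} (Cu , simple , un , h) = Cu , simple , ↭-Unique (Perm.map⁺ proj₁ p) un ,
    λ a → ⇔-trans (h a) (mk⇔ (Perm.∈-resp-↭ p) (Perm.∈-resp-↭ (↭-sym p)))
    where p = Perm.++-comm u v

  bond-mirror : ∀ {G as} → IsBond G as → IsBond G (reverse (map opp as))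
  bond-mirror {G} {as} (Cu , simple , un , h) = complement Cu , complement-simple Cu simple ,
    ↭-Unique (Perm.map⁺ proj₁ (↭-sym p)) (subst Unique (map-∘ as) un) ,
    λ a → ⇔-trans (complement-crossing Cu a) (⇔-trans (h (opp a)) (⇔-trans (mk⇔ (fwd a) (bwd a))
            (mk⇔ (Perm.∈-resp-↭ (↭-sym p)) (Perm.∈-resp-↭ p))))
    where
    p : reverse (map opp as) ↭ map opp as
    p = Perm.↭-reverse (map opp as)
    fwd : ∀ a → opp a ∈ˡ as → a ∈ˡ map opp as
    fwd a m = subst (_∈ˡ map opp as) (opp-opp a) (∈-map⁺ opp m)
    bwd : ∀ a → a ∈ˡ map opp as → opp a ∈ˡ as
    bwd a m with ∈-map⁻ opp m
    ... | b , b∈ , refl = subst (_∈ˡ as) (sym (opp-opp b)) b∈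

  module _ (n : ℕ) (φ : Fin (suc n) → Letter) (inj : Injective _≡_ _≡_ (key ∘ φ)) where
    private
      G = wordGraph n φ inj
    open OOGraph G

    src-opp-nat : ∀ i → src (i , opposite (dir (φ i))) ≡ suc zero
    src-opp-nat i = trans (src-opp {graph} (nat n φ i)) (tgt-nat n φ i)

    tgt-opp-nat : ∀ i → tgt (i , opposite (dir (φ i))) ≡ zero
    tgt-opp-nat i = trans (tgt-opp {graph} (nat n φ i)) (src-nat n φ i)

    bond-natural : IsBond G (tabulate (nat n φ))
    bond-natural = Cu , (conn-in , conn-out) ,
      subst Unique (sym (map-tabulate (nat n φ) proj₁)) (Uniqueₚ.tabulate⁺ id) , λ a → mk⇔ (fwd a) (bwd a)
      where
      Cu : Cut G
      Cu = record { U = inside ∷ outside ∷ [] ; nonempty = zero , true⇒∈ refl ; nonemptyᶜ = suc zero , true⇒∈ refl }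
      open Cut Cu
      conn-in : InducedConnected G U
      conn-in {zero} {zero} _ _ = ε
      conn-in {suc zero} p _ = contradiction (∈⇒true p) λ ()
      conn-in {zero} {suc zero} _ p = contradiction (∈⇒true p) λ ()
      conn-out : InducedConnected G (Sub.∁ U)
      conn-out {suc zero} {suc zero} _ _ = ε
      conn-out {zero} p _ = contradiction (∈⇒true p) λ ()
      conn-out {suc zero} {zero} _ p = contradiction (∈⇒true p) λ ()
      fwd : ∀ a → a ∈ 𝔼Cu → a ∈ˡ tabulate (nat n φ)
      fwd (i , s) h with sign-cases (dir (φ i)) s
      ... | inj₁ refl = ∈-tabulate⁺ {f = nat n φ} i
      ... | inj₂ refl with to (crossing Cu (i , s)) h
      ...   | p , _ = contradiction (subst (λ v → Vec.lookup U v ≡ true) (src-opp-nat i) p) λ ()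
      bwd : ∀ a → a ∈ˡ tabulate (nat n φ) → a ∈ 𝔼Cu
      bwd a m with ∈-tabulate⁻ {f = nat n φ} m
      ... | i , refl = from (crossing Cu (nat n φ i)) (cong (Vec.lookup U) (src-nat n φ i) , cong (Vec.lookup U) (tgt-nat n φ i))

    compat-of : ∀ D m (O : Fourientation) i → D * dir (φ i) ≡ m → ¬ (i , opposite m) ∈ᶠ O →
                Compat D (letter {G} (key ∘ φ) O (nat n φ i))
    compat-of D m O i eq ¬opp with status O i in st
    ... | unoriented = inert refl
    ... | bioriented = contradiction (trans (sym (has-status-at {G} O i (opposite m))) (cong (λ t → has t (opposite m)) st)) ¬opp
    ... | oriented t with sign-cases m t
    ...   | inj₁ refl = aligned (cong or (sym eq))
    ...   | inj₂ refl = contradiction (trans (sym (has-status-at {G} O i (opposite m))) (trans (cong (λ t → has t (opposite m)) st) (same (opposite m)))) ¬opp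
      where
      same : ∀ s → has (oriented s) s ≡ true
      same + = refl
      same - = refl

    -- A graph on two vertices has only two directed cuts, from 0 to 1 and from 1 to 0; they are the
    -- directions + and -.
    bond-natural-bad : ∀ O → Bad G O → ∃[ D ] (∀ i → Compat D (letter {G} (key ∘ φ) O (nat n φ i)))
    bond-natural-bad O bad with T1 G O bad
    ... | record { U = inside ∷ inside ∷ [] ; nonemptyᶜ = zero , p } , pot = contradiction (∈⇒true p) λ ()
    ... | record { U = inside ∷ inside ∷ [] ; nonemptyᶜ = suc zero , p } , pot = contradiction (∈⇒true p) λ ()
    ... | record { U = outside ∷ outside ∷ [] ; nonempty = zero , p } , pot = contradiction (∈⇒true p) λ ()
    ... | record { U = outside ∷ outside ∷ [] ; nonempty = suc zero , p } , pot = contradiction (∈⇒true p) λ ()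
    ... | Cu@(record { U = inside ∷ outside ∷ [] }) , pot = + , λ i → compat-of + (dir (φ i)) O i refl
            (pot i (dir (φ i)) (from (crossing Cu (nat n φ i)) (cong (Vec.lookup (Cut.U Cu)) (src-nat n φ i) , cong (Vec.lookup (Cut.U Cu)) (tgt-nat n φ i))))
    ... | Cu@(record { U = outside ∷ inside ∷ [] }) , pot = - , λ i → compat-of - (opposite (dir (φ i))) O i refl
            (pot i (opposite (dir (φ i))) (from (crossing Cu (i , opposite (dir (φ i))))
              (cong (Vec.lookup (Cut.U Cu)) (src-opp-nat i) , cong (Vec.lookup (Cut.U Cu)) (tgt-opp-nat i))))

  module _ (n : ℕ) (φ : Fin (suc (suc n)) → Letter) (inj : Injective _≡_ _≡_ (key ∘ φ)) (inj′ : Injective _≡_ _≡_ (key ∘ φ ∘ suc)) where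
    private
      G = wordGraph (suc n) φ inj
      H = wordGraph n (φ ∘ suc) inj′
    open OOGraph G

    -- At least two parallel edges are present, so one of the others leads back and edge 0 is no
    -- isthmus.
    bond-tail-minor : ¬ IsIsthmus G zero × ¬ IsLoop zero ×
      (Σ[ m ∈ Deletion G ｛ zero ｝ H ] (∀ i → EdgeEmbedding.ι (Deletion.edges m) i ≡ suc i))
    bond-tail-minor = not-isthmus {G} (nat (suc n) φ zero) [ b ] back (λ { (here ()) }) , not-loop , deletion , λ _ → refl
      where
      b : 𝔼
      b = opp (nat (suc n) φ (suc zero))
      back : Path graph (tgt (nat (suc n) φ zero)) [ b ] (src (nat (suc n) φ zero))
      back = step (trans (src-opp {graph} (nat (suc n) φ (suc zero))) (trans (tgt-nat (suc n) φ (suc zero)) (sym (tgt-nat (suc n) φ zero))))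
        (subst (λ v → Path graph (tgt b) [] v)
          (trans (tgt-opp {graph} (nat (suc n) φ (suc zero))) (trans (src-nat (suc n) φ (suc zero)) (sym (src-nat (suc n) φ zero)))) [])
      not-loop : ¬ IsLoop zero
      not-loop eq with dir (φ zero)
      not-loop () | +
      not-loop () | -
      deletion : Deletion G ｛ zero ｝ H
      deletion = record
        { edges = record
          { ι = suc
          ; ι-injective = λ { refl → refl }
          ; ι-image = suc-image
          ; ι-order = λ _ _ → ⇔-refl }
        ; verts = ↔-refl
        ; tail-comm = λ x → tl-suc (dir (φ (suc x))) x
        ; head-comm = λ x → hd-suc (dir (φ (suc x))) x }
        where
        tl-suc : ∀ s x → tl n s x ≡ tl (suc n) s (suc x)
        tl-suc + x = refl
        tl-suc - x = refl
        hd-suc : ∀ s x → hd n s x ≡ hd (suc n) s (suc x)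
        hd-suc + x = refl
        hd-suc - x = refl

  theory : Theory
  theory = record
    { Circ = IsBond
    ; circ-unique = λ (_ , _ , u , _) → u
    ; circ-rotate = bond-rotate
    ; circ-mirror = bond-mirror
    ; natural = bond-natural
    ; same-edges = same-bond
    ; good⇔ = bond-good⇔
    ; natural-bad = bond-natural-bad
    ; Minor = λ G e H → Deletion G ｛ e ｝ H
    ; minor-edges = Deletion.edges
    ; T2 = cut-T2
    ; tail-minor = bond-tail-minor
    }

-- A triangle with multiple edges, where Place records the ends of an edge

data Place : Set where
  xy xz zy : Place

-- The vertices x, z, y are 0, 1, 2. Separating x, y or z from the other two cuts the places xy and
-- xz, xy and zy, or xz and zy. With e, P, Q at xy, A at xz and b at zy these are the three circuits
-- of the chord rule.
beg fin : Place → Fin 3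
beg xy = zero
beg xz = zero
beg zy = suc zero
fin xy = suc (suc zero)
fin xz = suc zero
fin zy = suc (suc zero)

-- The number of edges is arbitrary, so that deleting the maximum edge gives another graph of this
-- form; the edges `i₁` and `i₂` keep it connected.
module TriangleGraph (n : ℕ) (ψ : Fin n → Place × Letter) (inj : Injective _≡_ _≡_ (key ∘ proj₂ ∘ ψ))
  (i₁ i₂ : Fin n) (at-xz : proj₁ (ψ i₁) ≡ xz) (at-zy : proj₁ (ψ i₂) ≡ zy) where

  place : Fin n → Place
  place = proj₁ ∘ ψ

  dirOf : Fin n → Sign
  dirOf = dir ∘ proj₂ ∘ ψ

  ends : Sign → Place → Fin 3 × Fin 3
  ends + p = beg p , fin p
  ends - p = fin p , beg p

  tri : OrientedGraph
  tri = record { #V = 3 ; #E = n ; nonEmpty = _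
               ; tail = λ i → proj₁ (ends (dirOf i) (place i)) ; head = λ i → proj₂ (ends (dirOf i) (place i)) }

  open OrientedGraph tri

  nat′ : Fin n → 𝔼
  nat′ i = i , dirOf i

  src-nat′ : ∀ i → src (nat′ i) ≡ beg (place i)
  src-nat′ i with dirOf i in eq
  ... | + rewrite eq = refl
  ... | - rewrite eq = refl

  tgt-nat′ : ∀ i → tgt (nat′ i) ≡ fin (place i)
  tgt-nat′ i with dirOf i in eq
  ... | + rewrite eq = refl
  ... | - rewrite eq = refl

  step-xz : Arc zero (suc zero)
  step-xz = nat′ i₁ , trans (src-nat′ i₁) (cong beg at-xz) , trans (tgt-nat′ i₁) (cong fin at-xz)

  step-zy : Arc (suc zero) (suc (suc zero))
  step-zy = nat′ i₂ , trans (src-nat′ i₂) (cong beg at-zy) , trans (tgt-nat′ i₂) (cong fin at-zy)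

  conn : ∀ u v → Walk u v
  conn u v = walk-sym {tri} (from-x u) ◅◅ from-x v
    where
    from-x : ∀ v → Walk zero v
    from-x zero = ε
    from-x (suc zero) = step-xz ◅ ε
    from-x (suc (suc zero)) = step-xz ◅ step-zy ◅ ε

  graph3 : OOGraph
  graph3 = keyed tri (key ∘ proj₂ ∘ ψ) inj conn

  O₃ : Fin n × Sign → Bool
  O₃ (i , s) = has (Polarity.⟦_⟧ cutPolarity (mark (proj₂ (ψ i)))) s

unique-++ʳ : ∀ {A : Set} (xs : List A) {ys} → Unique (xs ++ ys) → Unique ys
unique-++ʳ [] u = u
unique-++ʳ (x ∷ xs) (_ ∷ u) = unique-++ʳ xs u

map-tagged : ∀ {A B C : Set} (t : A → B × C) p l L → map t l ≡ map (p ,_) L → ∀ {a} → a ∈ˡ l → proj₁ (t a) ≡ p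
map-tagged t p l L eq {a} a∈ with ∈-map⁻ (p ,_) (subst (t a ∈ˡ_) eq (∈-map⁺ t a∈))
... | _ , _ , e = cong proj₁ e

single-connected : ∀ {G W} → let open OOGraph G in ∀ p → (∀ w → w Sub.∈ W → w ≡ p) → InducedConnected G W
single-connected p h {u} {v} u∈ v∈ with h u u∈ | h v v∈
... | refl | refl = ε

pair-connected : ∀ {G W} → let open OOGraph G in ∀ a → src a Sub.∈ W → tgt a Sub.∈ W →
  (∀ w → w Sub.∈ W → w ≡ src a ⊎ w ≡ tgt a) → InducedConnected G W
pair-connected {G} {W} a p∈ q∈ h {u} {v} u∈ v∈ = go (h u u∈) (h v v∈)
  where
  open OOGraph G
  inside-W : ∀ a → src a Sub.∈ W → tgt a Sub.∈ W → tail (proj₁ a) Sub.∈ W × head (proj₁ a) Sub.∈ W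
  inside-W (e , +) p q = p , q
  inside-W (e , -) p q = q , p
  go : u ≡ src a ⊎ u ≡ tgt a → v ≡ src a ⊎ v ≡ tgt a → Joined (λ e → tail e Sub.∈ W × head e Sub.∈ W) u v
  go (inj₁ refl) (inj₁ refl) = ε
  go (inj₂ refl) (inj₂ refl) = ε
  go (inj₁ refl) (inj₂ refl) = ((a , refl , refl) , inside-W a p∈ q∈) ◅ ε
  go (inj₂ refl) (inj₁ refl) = ((opp a , src-opp {graph} a , tgt-opp {graph} a) , inside-W a p∈ q∈) ◅ ε

module CutTheta (P : FourientationProperty) (tutte : IsTutteCutProperty P) where
  open FourientationProperty P
  open CircuitTheory P cutPolarity bondShape
  open CutTheory P tutte
  open Theory theory using (Theta)

  module TriangleBonds (n : ℕ) (ψ : Fin (suc n) → Place × Letter) (inj : Injective _≡_ _≡_ (key ∘ proj₂ ∘ ψ))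
    (i₁ i₂ : Fin (suc n)) (at-xz : proj₁ (ψ i₁) ≡ xz) (at-zy : proj₁ (ψ i₂) ≡ zy)
    (place-e₀ : proj₁ (ψ zero) ≡ xy)
    (π α : List (Fin (suc n) × Sign)) (β : Fin (suc n) × Sign) (ω : List (Fin (suc n) × Sign))
    (N≡ : tabulate (λ i → i , dir (proj₂ (ψ i))) ≡ (zero , dir (proj₂ (ψ zero))) ∷ π ++ α ++ β ∷ ω)
    (tag-at-π : ∀ {a} → a ∈ˡ π → proj₁ (ψ (proj₁ a)) ≡ xy)
    (tag-at-α : ∀ {a} → a ∈ˡ α → proj₁ (ψ (proj₁ a)) ≡ xz)
    (place-β : proj₁ (ψ (proj₁ β)) ≡ zy)
    (tag-at-ω : ∀ {a} → a ∈ˡ ω → proj₁ (ψ (proj₁ a)) ≡ xy)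
    where
    open TriangleGraph (suc n) ψ inj i₁ i₂ at-xz at-zy
    open OOGraph graph3

    e₀ : 𝔼
    e₀ = nat′ zero

    tag : 𝔼 → Place × Letter
    tag (i , _) = ψ i

    N : List 𝔼
    N = e₀ ∷ π ++ α ++ β ∷ ω

    N-edges-unique : Unique (map proj₁ N)
    N-edges-unique = subst (λ l → Unique (map proj₁ l)) N≡ (subst Unique (sym (map-tabulate nat′ proj₁)) (Uniqueₚ.tabulate⁺ id))

    data Location (i : E) : Set where
      on-xy : place i ≡ xy → nat′ i ∈ˡ e₀ ∷ π ⊎ nat′ i ∈ˡ ω → Location i
      on-xz : place i ≡ xz → nat′ i ∈ˡ α → Location i
      on-zy : place i ≡ zy → nat′ i ≡ β → Location i

    locate : ∀ i → Location i
    locate i with subst (nat′ i ∈ˡ_) N≡ (∈-tabulate⁺ {f = nat′} i)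
    ... | here eq = on-xy (trans (cong (proj₁ ∘ ψ ∘ proj₁) eq) place-e₀) (inj₁ (here eq))
    ... | there h with ∈-++⁻ π h
    ...   | inj₁ m = on-xy (tag-at-π m) (inj₁ (there m))
    ...   | inj₂ h′ with ∈-++⁻ α h′
    ...     | inj₁ m = on-xz (tag-at-α m) m
    ...     | inj₂ (here eq) = on-zy (trans (cong (proj₁ ∘ tag) eq) place-β) eq
    ...     | inj₂ (there m) = on-xy (tag-at-ω m) (inj₂ m)

    natural-arc : ∀ {a} → a ∈ˡ N → a ≡ nat′ (proj₁ a)
    natural-arc {a} m with ∈-tabulate⁻ {f = nat′} (subst (a ∈ˡ_) (sym N≡) m)
    ... | i , eq = trans eq (cong (nat′ ∘ proj₁) (sym eq))

    ∈α⇒∈N : ∀ {a} → a ∈ˡ α → a ∈ˡ N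
    ∈α⇒∈N m = there (∈-++⁺ʳ π (∈-++⁺ˡ m))
    ∈π⇒∈N : ∀ {a} → a ∈ˡ π → a ∈ˡ N
    ∈π⇒∈N m = there (∈-++⁺ˡ m)
    ∈ω⇒∈N : ∀ {a} → a ∈ˡ ω → a ∈ˡ N
    ∈ω⇒∈N m = there (∈-++⁺ʳ π (∈-++⁺ʳ α (there m)))
    β∈N : β ∈ˡ N
    β∈N = there (∈-++⁺ʳ π (∈-++⁺ʳ α (here refl)))

    mkCut : (U : Subset 3) → Nonempty U → Nonempty (Sub.∁ U) → Cut graph3
    mkCut U p q = record { U = U ; nonempty = p ; nonemptyᶜ = q }

    -- Whether arcs at a place cross from U to its complement, and whether
    -- their opposites do.
    crosses : (U : Subset 3) → Place → Bool × Bool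
    crosses U p = (Vec.lookup U (beg p) ∧ not (Vec.lookup U (fin p)))
                , (Vec.lookup U (fin p) ∧ not (Vec.lookup U (beg p)))

    ∧-true : ∀ {x y} → x ≡ true → y ≡ false → x ∧ not y ≡ true
    ∧-true refl refl = refl

    true-∧ : ∀ {x y} → x ∧ not y ≡ true → x ≡ true × y ≡ false
    true-∧ {true} {false} _ = refl , refl

    forward : ∀ (Cu : Cut graph3) i → nat′ i ∈ Cut.𝔼Cu Cu ⇔ proj₁ (crosses (Cut.U Cu) (place i)) ≡ true
    forward Cu i = ⇔-trans (crossing Cu (nat′ i)) (mk⇔
      (λ (p , q) → ∧-true (subst (λ v → side Cu v ≡ true) (src-nat′ i) p) (subst (λ v → side Cu v ≡ false) (tgt-nat′ i) q))
      (λ h → let p , q = true-∧ h in subst (λ v → side Cu v ≡ true) (sym (src-nat′ i)) p , subst (λ v → side Cu v ≡ false) (sym (tgt-nat′ i)) q))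

    backward : ∀ (Cu : Cut graph3) i → opp (nat′ i) ∈ Cut.𝔼Cu Cu ⇔ proj₂ (crosses (Cut.U Cu) (place i)) ≡ true
    backward Cu i = ⇔-trans (crossing Cu (opp (nat′ i))) (mk⇔
      (λ (p , q) → ∧-true (subst (λ v → side Cu v ≡ true) s p) (subst (λ v → side Cu v ≡ false) t q))
      (λ h → let p , q = true-∧ h in subst (λ v → side Cu v ≡ true) (sym s) p , subst (λ v → side Cu v ≡ false) (sym t) q))
      where
      s = trans (src-opp {graph} (nat′ i)) (tgt-nat′ i)
      t = trans (tgt-opp {graph} (nat′ i)) (src-nat′ i)

    src-e₀ : src e₀ ≡ zero
    src-e₀ = trans (src-nat′ zero) (cong beg place-e₀)
    tgt-e₀ : tgt e₀ ≡ suc (suc zero)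
    tgt-e₀ = trans (tgt-nat′ zero) (cong fin place-e₀)
    a₁ : 𝔼
    a₁ = nat′ i₁
    b₁ : 𝔼
    b₁ = nat′ i₂
    src-a₁ : src a₁ ≡ zero
    src-a₁ = trans (src-nat′ i₁) (cong beg at-xz)
    tgt-a₁ : tgt a₁ ≡ suc zero
    tgt-a₁ = trans (tgt-nat′ i₁) (cong fin at-xz)
    src-b₁ : src b₁ ≡ suc zero
    src-b₁ = trans (src-nat′ i₂) (cong beg at-zy)
    tgt-b₁ : tgt b₁ ≡ suc (suc zero)
    tgt-b₁ = trans (tgt-nat′ i₂) (cong fin at-zy)

    pair : ∀ {W : Subset 3} a {p q} → src a ≡ p → tgt a ≡ q → Vec.lookup W p ≡ true → Vec.lookup W q ≡ true →
           (∀ w → Vec.lookup W w ≡ true → w ≡ p ⊎ w ≡ q) → InducedConnected graph3 W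
    pair {W} a refl refl p∈ q∈ h = pair-connected {graph3} {W} a (true⇒∈ p∈) (true⇒∈ q∈) (λ w w∈ → h w (∈⇒true w∈))

    single : ∀ {W : Subset 3} p → (∀ w → Vec.lookup W w ≡ true → w ≡ p) → InducedConnected graph3 W
    single p h = single-connected {graph3} p (λ w w∈ → h w (∈⇒true w∈))

    -- The sets {x}, {x, z} and {x, y}. Edges at zy enter the last one instead of leaving it, whence
    -- `opp β` in the third circuit.
    U₁ U₂ U₃ : Subset 3
    U₁ = inside ∷ outside ∷ outside ∷ []
    U₂ = inside ∷ inside ∷ outside ∷ []
    U₃ = inside ∷ outside ∷ inside ∷ []
    C₁ C₂ C₃ : Cut graph3
    C₁ = mkCut U₁ (zero , true⇒∈ refl) (suc zero , true⇒∈ refl)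
    C₂ = mkCut U₂ (zero , true⇒∈ refl) (suc (suc zero) , true⇒∈ refl)
    C₃ = mkCut U₃ (zero , true⇒∈ refl) (suc zero , true⇒∈ refl)

    simple₁ : SimpleCut graph3 C₁
    simple₁ = single zero (λ { zero _ → refl ; (suc zero) () ; (suc (suc zero)) () })
            , pair b₁ src-b₁ tgt-b₁ refl refl (λ { zero () ; (suc zero) _ → inj₁ refl ; (suc (suc zero)) _ → inj₂ refl })
    simple₂ : SimpleCut graph3 C₂
    simple₂ = pair a₁ src-a₁ tgt-a₁ refl refl (λ { zero _ → inj₁ refl ; (suc zero) _ → inj₂ refl ; (suc (suc zero)) () })
            , single (suc (suc zero)) (λ { zero () ; (suc zero) () ; (suc (suc zero)) _ → refl })
    simple₃ : SimpleCut graph3 C₃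
    simple₃ = pair e₀ src-e₀ tgt-e₀ refl refl (λ { zero _ → inj₁ refl ; (suc zero) () ; (suc (suc zero)) _ → inj₂ refl })
            , single (suc zero) (λ { zero () ; (suc zero) _ → refl ; (suc (suc zero)) () })

    arcs⇔ : ∀ (Cu : Cut graph3) L →
      (∀ i → proj₁ (crosses (Cut.U Cu) (place i)) ≡ true → Location i → nat′ i ∈ˡ L) →
      (∀ i → proj₂ (crosses (Cut.U Cu) (place i)) ≡ true → Location i → opp (nat′ i) ∈ˡ L) →
      (∀ a → a ∈ˡ L → a ∈ Cut.𝔼Cu Cu) →
      ∀ a → a ∈ Cut.𝔼Cu Cu ⇔ a ∈ˡ L
    arcs⇔ Cu L fw bw back (i , s) = mk⇔ fwd (back (i , s))
      where
      fwd : (i , s) ∈ Cut.𝔼Cu Cu → (i , s) ∈ˡ L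
      fwd h with sign-cases (dirOf i) s
      ... | inj₁ refl = fw i (to (forward Cu i) h) (locate i)
      ... | inj₂ refl = bw i (to (backward Cu i) h) (locate i)

    forward∈ : ∀ (Cu : Cut graph3) {a} p → a ∈ˡ N → proj₁ (tag a) ≡ p → proj₁ (crosses (Cut.U Cu) p) ≡ true → a ∈ Cut.𝔼Cu Cu
    forward∈ Cu p m refl h with natural-arc m
    ... | eq = subst (_∈ Cut.𝔼Cu Cu) (sym eq) (from (forward Cu _) h)

    circ₁ : IsBond graph3 (e₀ ∷ π ++ α ++ ω)
    circ₁ = C₁ , simple₁ , unique , arcs⇔ C₁ (e₀ ∷ π ++ α ++ ω) fw bw back
      where
      unique : Unique (map proj₁ (e₀ ∷ π ++ α ++ ω))
      unique with ↭-Unique (Perm.map⁺ proj₁ (↭-trans (↭-reflexive (cong (e₀ ∷_) (sym (++-assoc π α (β ∷ ω)))))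
                   (↭-trans (Perm.shift β (e₀ ∷ π ++ α) ω) (prep β (↭-reflexive (cong (e₀ ∷_) (++-assoc π α ω))))))) N-edges-unique
      ... | _ ∷ u = u
      fw : ∀ i → proj₁ (crosses U₁ (place i)) ≡ true → Location i → nat′ i ∈ˡ e₀ ∷ π ++ α ++ ω
      fw i h (on-xy _ (inj₁ m)) = ∈-++⁺ˡ m
      fw i h (on-xy _ (inj₂ m)) = ∈-++⁺ʳ (e₀ ∷ π) (∈-++⁺ʳ α m)
      fw i h (on-xz _ m) = ∈-++⁺ʳ (e₀ ∷ π) (∈-++⁺ˡ m)
      fw i h (on-zy p _) = contradiction (trans (sym h) (cong (proj₁ ∘ crosses U₁) p)) λ ()
      bw : ∀ i → proj₂ (crosses U₁ (place i)) ≡ true → Location i → opp (nat′ i) ∈ˡ e₀ ∷ π ++ α ++ ω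
      bw i h (on-xy p _) = contradiction (trans (sym h) (cong (proj₂ ∘ crosses U₁) p)) λ ()
      bw i h (on-xz p _) = contradiction (trans (sym h) (cong (proj₂ ∘ crosses U₁) p)) λ ()
      bw i h (on-zy p _) = contradiction (trans (sym h) (cong (proj₂ ∘ crosses U₁) p)) λ ()
      back : ∀ a → a ∈ˡ e₀ ∷ π ++ α ++ ω → a ∈ Cut.𝔼Cu C₁
      back a (here refl) = forward∈ C₁ xy (here refl) place-e₀ refl
      back a (there m) with ∈-++⁻ π m
      ... | inj₁ h = forward∈ C₁ xy (∈π⇒∈N h) (tag-at-π h) refl
      ... | inj₂ m′ with ∈-++⁻ α m′
      ...   | inj₁ h = forward∈ C₁ xz (∈α⇒∈N h) (tag-at-α h) refl
      ...   | inj₂ h = forward∈ C₁ xy (∈ω⇒∈N h) (tag-at-ω h) refl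

    circ₂ : IsBond graph3 (e₀ ∷ π ++ β ∷ ω)
    circ₂ = C₂ , simple₂ , unique , arcs⇔ C₂ (e₀ ∷ π ++ β ∷ ω) fw bw back
      where
      p : N ↭ α ++ (e₀ ∷ π ++ β ∷ ω)
      p = ↭-trans (Perm.++-comm (e₀ ∷ π) (α ++ β ∷ ω)) (↭-trans (↭-reflexive (++-assoc α (β ∷ ω) (e₀ ∷ π)))
            (Perm.++⁺ˡ α (Perm.++-comm (β ∷ ω) (e₀ ∷ π))))
      unique : Unique (map proj₁ (e₀ ∷ π ++ β ∷ ω))
      unique = unique-++ʳ (map proj₁ α) (subst Unique (map-++ proj₁ α _) (↭-Unique (Perm.map⁺ proj₁ p) N-edges-unique))
      fw : ∀ i → proj₁ (crosses U₂ (place i)) ≡ true → Location i → nat′ i ∈ˡ e₀ ∷ π ++ β ∷ ω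
      fw i h (on-xy _ (inj₁ m)) = ∈-++⁺ˡ m
      fw i h (on-xy _ (inj₂ m)) = ∈-++⁺ʳ (e₀ ∷ π) (there m)
      fw i h (on-xz p _) = contradiction (trans (sym h) (cong (proj₁ ∘ crosses U₂) p)) λ ()
      fw i h (on-zy p eq) = ∈-++⁺ʳ (e₀ ∷ π) (here eq)
      bw : ∀ i → proj₂ (crosses U₂ (place i)) ≡ true → Location i → opp (nat′ i) ∈ˡ e₀ ∷ π ++ β ∷ ω
      bw i h (on-xy p _) = contradiction (trans (sym h) (cong (proj₂ ∘ crosses U₂) p)) λ ()
      bw i h (on-xz p _) = contradiction (trans (sym h) (cong (proj₂ ∘ crosses U₂) p)) λ ()
      bw i h (on-zy p _) = contradiction (trans (sym h) (cong (proj₂ ∘ crosses U₂) p)) λ ()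
      back : ∀ a → a ∈ˡ e₀ ∷ π ++ β ∷ ω → a ∈ Cut.𝔼Cu C₂
      back a (here refl) = forward∈ C₂ xy (here refl) place-e₀ refl
      back a (there m) with ∈-++⁻ π m
      ... | inj₁ h = forward∈ C₂ xy (∈π⇒∈N h) (tag-at-π h) refl
      ... | inj₂ (here refl) = forward∈ C₂ zy β∈N place-β refl
      ... | inj₂ (there h) = forward∈ C₂ xy (∈ω⇒∈N h) (tag-at-ω h) refl

    circ₃ : IsBond graph3 (α ++ [ opp β ])
    circ₃ = C₃ , simple₃ , unique , arcs⇔ C₃ (α ++ [ opp β ]) fw bw back
      where
      p : N ↭ (e₀ ∷ π ++ ω) ++ (α ++ [ β ])
      p = ↭-trans (Perm.++⁺ˡ (e₀ ∷ π) (↭-trans (↭-reflexive (sym (++-assoc α [ β ] ω))) (Perm.++-comm (α ++ [ β ]) ω)))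
            (↭-reflexive (sym (++-assoc (e₀ ∷ π) ω (α ++ [ β ]))))
      unique : Unique (map proj₁ (α ++ [ opp β ]))
      unique = subst Unique (trans (map-++ proj₁ α [ β ]) (sym (map-++ proj₁ α [ opp β ])))
        (unique-++ʳ (map proj₁ (e₀ ∷ π ++ ω)) (subst Unique (map-++ proj₁ (e₀ ∷ π ++ ω) _) (↭-Unique (Perm.map⁺ proj₁ p) N-edges-unique)))
      fw : ∀ i → proj₁ (crosses U₃ (place i)) ≡ true → Location i → nat′ i ∈ˡ α ++ [ opp β ]
      fw i h (on-xy p _) = contradiction (trans (sym h) (cong (proj₁ ∘ crosses U₃) p)) λ ()
      fw i h (on-xz _ m) = ∈-++⁺ˡ m
      fw i h (on-zy p _) = contradiction (trans (sym h) (cong (proj₁ ∘ crosses U₃) p)) λ ()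
      bw : ∀ i → proj₂ (crosses U₃ (place i)) ≡ true → Location i → opp (nat′ i) ∈ˡ α ++ [ opp β ]
      bw i h (on-xy p _) = contradiction (trans (sym h) (cong (proj₂ ∘ crosses U₃) p)) λ ()
      bw i h (on-xz p _) = contradiction (trans (sym h) (cong (proj₂ ∘ crosses U₃) p)) λ ()
      bw i h (on-zy p eq) = ∈-++⁺ʳ α (here (cong opp eq))
      back : ∀ a → a ∈ˡ α ++ [ opp β ] → a ∈ Cut.𝔼Cu C₃
      back a m with ∈-++⁻ α m
      ... | inj₁ h = forward∈ C₃ xz (∈α⇒∈N h) (tag-at-α h) refl
      ... | inj₂ (here refl) = subst (λ c → opp c ∈ Cut.𝔼Cu C₃) (sym (natural-arc β∈N))
              (from (backward C₃ (proj₁ β)) (cong (proj₂ ∘ crosses U₃) place-β))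

    edge-sides : ∀ (Cu : Cut graph3) i → side Cu (tail i) ≢ side Cu (head i) ⇔ side Cu (beg (place i)) ≢ side Cu (fin (place i))
    edge-sides Cu i with dirOf i
    ... | + = ⇔-refl
    ... | - = mk⇔ (_∘ sym) (_∘ sym)

    -- Edge `zero` joins x and y, so a cut without it has both on one side. Both sides are nonempty,
    -- which leaves z alone on the other.
    only₃ : ∀ bs → IsBond graph3 bs → zero ∉ˡ map proj₁ bs →
            ∀ x → x ∈ˡ map proj₁ bs ⇔ x ∈ˡ map proj₁ (α ++ [ opp β ])
    only₃ bs (Cu , simple , u , h) e∉ x =
      ⇔-trans (⇔-sym (Bond.edges⇔ Cu simple h x)) (⇔-trans (edge-crossing Cu x) (⇔-trans (edge-sides Cu x)
        (⇔-trans (compare (place x)) (⇔-sym (⇔-trans (⇔-sym (Bond.edges⇔ C₃ simple₃ (proj₂ (proj₂ (proj₂ circ₃))) x))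
          (⇔-trans (edge-crossing C₃ x) (edge-sides C₃ x)))))))
      where
      x~y : side Cu zero ≡ side Cu (suc (suc zero))
      x~y with crossing? Cu zero
      ... | no ne = contradiction (to (Bond.edges⇔ Cu simple h zero) (from (edge-crossing Cu zero) ne)) e∉
      ... | yes eq with side Cu zero Bool.≟ side Cu (suc (suc zero))
      ...   | yes eq′ = eq′
      ...   | no ne = contradiction eq (from (edge-sides Cu zero) (ne ∘ subst (λ p → side Cu (beg p) ≡ side Cu (fin p)) place-e₀))
      x≁z : side Cu zero ≢ side Cu (suc zero)
      x≁z eq = true≢false (trans (all-same v) (∈⇒true p)) (trans (all-same w) (∈∁⇒false q))
        where
        v = proj₁ (Cut.nonempty Cu)
        p = proj₂ (Cut.nonempty Cu)
        w = proj₁ (Cut.nonemptyᶜ Cu)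
        q = proj₂ (Cut.nonemptyᶜ Cu)
        all-same : ∀ v → side Cu zero ≡ side Cu v
        all-same zero = refl
        all-same (suc zero) = eq
        all-same (suc (suc zero)) = x~y
      compare : ∀ p → side Cu (beg p) ≢ side Cu (fin p) ⇔ side C₃ (beg p) ≢ side C₃ (fin p)
      compare xy = mk⇔ (λ ne → contradiction x~y ne) (λ ne → contradiction refl ne)
      compare xz = mk⇔ (λ _ ()) (λ _ → x≁z)
      compare zy = mk⇔ (λ _ ()) (λ _ eq → x≁z (trans x~y (sym eq)))

    κ : E → ℕ
    κ = key ∘ proj₂ ∘ ψ

    letter≡ : ∀ {a} → a ∈ˡ N → letter {graph3} κ O₃ a ≡ proj₂ (tag a)
    letter≡ {a} m = trans (cong (letter {graph3} κ O₃) (natural-arc m))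
      (cong (λ m → ⟨ κ (proj₁ a) , dirOf (proj₁ a) , m ⟩)
        (trans (cong mk (status-has ⟦ mark (proj₂ (ψ (proj₁ a))) ⟧)) (mk-st _)))

    word≡ : ∀ l {p L} → (∀ {a} → a ∈ˡ l → a ∈ˡ N) → map tag l ≡ map (p ,_) L → word {graph3} κ O₃ l ≡ L
    word≡ l {p} {L} l⊆N eq = trans (map-cong-local (All.tabulate (λ {a} m → letter≡ (l⊆N m))))
      (trans (map-∘ l) (trans (cong (map proj₂) eq) (trans (sym (map-∘ L)) (map-id L))))

    ¬isthmus : ¬ IsIsthmus graph3 zero
    ¬isthmus = not-isthmus {graph3} e₀ (opp b₁ ∷ opp a₁ ∷ []) back (λ { (here eq) → xy≢zy eq ; (there (here eq)) → xy≢xz eq })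
      where
      xy≢zy : zero ≢ i₂
      xy≢zy eq = contradiction (trans (sym place-e₀) (trans (cong place eq) at-zy)) λ ()
      xy≢xz : zero ≢ i₁
      xy≢xz eq = contradiction (trans (sym place-e₀) (trans (cong place eq) at-xz)) λ ()
      back : Path graph (tgt e₀) (opp b₁ ∷ opp a₁ ∷ []) (src e₀)
      back = step (trans (src-opp {graph} b₁) (trans tgt-b₁ (sym tgt-e₀)))
        (step (trans (src-opp {graph} a₁) (trans tgt-a₁ (sym (trans (tgt-opp {graph} b₁) src-b₁))))
          (subst (λ v → Path graph (tgt (opp a₁)) [] v) (trans (tgt-opp {graph} a₁) (trans src-a₁ (sym src-e₀))) []))

    ¬loop : ¬ IsLoop zero
    ¬loop = subst (λ p → proj₁ (ends (dirOf zero) p) ≢ proj₂ (ends (dirOf zero) p)) (sym place-e₀) (ends≢ (dirOf zero))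
      where
      ends≢ : ∀ s → proj₁ (ends s xy) ≢ proj₂ (ends s xy)
      ends≢ + ()
      ends≢ - ()

  module _ (k : ℕ) (d : Sign) (L₁ : List Letter) (a₀ : Letter) (L₂ : List Letter) (b : Letter) (L₃ : List Letter)
           (lt : (L₁ ++ (a₀ ∷ L₂) ++ b ∷ L₃) ≺ k) (uk : UniqueKeys (L₁ ++ (a₀ ∷ L₂) ++ b ∷ L₃)) where
    private
      T′ T : List (Place × Letter)
      T′ = map (xy ,_) L₁ ++ map (xz ,_) (a₀ ∷ L₂) ++ (zy , b) ∷ map (xy ,_) L₃
      -- The maximum edge needs some status to begin with; the chord argument overwrites it.
      T = (xy , ⟨ k , d , free ⟩) ∷ T′

      untag : map proj₂ T′ ≡ L₁ ++ (a₀ ∷ L₂) ++ b ∷ L₃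
      untag = trans (map-++ proj₂ (map (xy ,_) L₁) _) (cong₂ _++_ (un xy L₁)
        (trans (map-++ proj₂ (map (xz ,_) (a₀ ∷ L₂)) _) (cong₂ _++_ (un xz (a₀ ∷ L₂)) (cong (b ∷_) (un xy L₃)))))
        where
        un : ∀ (p : Place) (L : List Letter) → map proj₂ (map (p ,_) L) ≡ L
        un p L = trans (sym (map-∘ {f = p ,_} L)) (map-id L)

      keysT : map (key ∘ proj₂) T′ ≡ map key (L₁ ++ (a₀ ∷ L₂) ++ b ∷ L₃)
      keysT = trans (map-∘ T′) (cong (map key) untag)

      uT′ : Unique (map (key ∘ proj₂) T′)
      uT′ = subst Unique (sym keysT) uk

      uT : Unique (map (key ∘ proj₂) T)
      uT = subst (All (k ≢_)) (sym keysT) (Allₚ.map⁺ (All.map (λ z<k k≡z → ℕ.<⇒≢ z<k (sym k≡z)) lt)) ∷ uT′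

      n = length T′

      ψ : Fin (suc n) → Place × Letter
      ψ = lookup T

      injψ : Injective _≡_ _≡_ (key ∘ proj₂ ∘ ψ)
      injψ = lookup-injective (key ∘ proj₂) T uT

      xz∈ : (xz , a₀) ∈ˡ T′
      xz∈ = ∈-++⁺ʳ (map (xy ,_) L₁) (here refl)

      zy∈ : (zy , b) ∈ˡ T′
      zy∈ = ∈-++⁺ʳ (map (xy ,_) L₁) (∈-++⁺ʳ (map (xz ,_) (a₀ ∷ L₂)) (here refl))

      j₁ j₂ : Fin n
      j₁ = Any.index xz∈
      j₂ = Any.index zy∈

      at-xz : proj₁ (lookup T′ j₁) ≡ xz
      at-xz = cong proj₁ (sym (Anyₚ.lookup-index xz∈))

      at-zy : proj₁ (lookup T′ j₂) ≡ zy
      at-zy = cong proj₁ (sym (Anyₚ.lookup-index zy∈))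

      open TriangleGraph (suc n) ψ injψ (suc j₁) (suc j₂) at-xz at-zy
      module Del = TriangleGraph n (ψ ∘ suc) (lookup-injective (key ∘ proj₂) T′ uT′) j₁ j₂ at-xz at-zy

      open OOGraph graph3

      deletion : Deletion graph3 ｛ zero ｝ Del.graph3
      deletion = record
        { edges = record
          { ι = suc
          ; ι-injective = λ { refl → refl }
          ; ι-image = suc-image
          ; ι-order = λ _ _ → ⇔-refl }
        ; verts = ↔-refl
        ; tail-comm = λ x → ends-tail (dirOf (suc x)) (place (suc x))
        ; head-comm = λ x → ends-head (dirOf (suc x)) (place (suc x)) }
        where
        ends-tail : ∀ s p → proj₁ (Del.ends s p) ≡ proj₁ (ends s p)
        ends-tail + p = refl
        ends-tail - p = refl
        ends-head : ∀ s p → proj₂ (Del.ends s p) ≡ proj₂ (ends s p)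
        ends-head + p = refl
        ends-head - p = refl

      tag : 𝔼 → Place × Letter
      tag (i , _) = ψ i

      N′ : List 𝔼
      N′ = tabulate (nat′ ∘ suc)

      tag-N′ : map tag N′ ≡ T′
      tag-N′ = trans (map-tabulate (nat′ ∘ suc) tag) (tabulate-lookup T′)

    abstract
      arc-lists : ∃[ π ] ∃[ α ] ∃[ β ] ∃[ ω ] N′ ≡ π ++ α ++ β ∷ ω ×
        map tag π ≡ map (xy ,_) L₁ × map tag α ≡ map (xz ,_) (a₀ ∷ L₂) × tag β ≡ (zy , b) × map tag ω ≡ map (xy ,_) L₃
      arc-lists with map-split tag N′ (map (xy ,_) L₁) tag-N′
      ... | π , r , e₁ , t₁ , eq with map-split tag r (map (xz ,_) (a₀ ∷ L₂)) eq
      ...   | α , β ∷ ω , e₂ , t₂ , eq₂ = π , α , β , ω , trans e₁ (cong (π ++_) e₂) , t₁ , t₂ , ∷-injectiveˡ eq₂ , ∷-injectiveʳ eq₂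

    private
      π α ω : List 𝔼
      β : 𝔼
      π = proj₁ arc-lists
      α = proj₁ (proj₂ arc-lists)
      β = proj₁ (proj₂ (proj₂ arc-lists))
      ω = proj₁ (proj₂ (proj₂ (proj₂ arc-lists)))
      N′≡ : N′ ≡ π ++ α ++ β ∷ ω
      N′≡ = proj₁ (proj₂ (proj₂ (proj₂ (proj₂ arc-lists))))
      tag-π = proj₁ (proj₂ (proj₂ (proj₂ (proj₂ (proj₂ arc-lists)))))
      tag-α = proj₁ (proj₂ (proj₂ (proj₂ (proj₂ (proj₂ (proj₂ arc-lists))))))
      tag-β = proj₁ (proj₂ (proj₂ (proj₂ (proj₂ (proj₂ (proj₂ (proj₂ arc-lists)))))))
      tag-ω = proj₂ (proj₂ (proj₂ (proj₂ (proj₂ (proj₂ (proj₂ (proj₂ arc-lists)))))))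

      open TriangleBonds n ψ injψ (suc j₁) (suc j₂) at-xz at-zy refl π α β ω (cong (nat′ zero ∷_) N′≡)
        (map-tagged tag xy π L₁ tag-π) (map-tagged tag xz α (a₀ ∷ L₂) tag-α) (cong proj₁ tag-β) (map-tagged tag xy ω L₃ tag-ω)
        hiding (tag)

    theta′ : Theta k d L₁ (a₀ ∷ L₂) b L₃
    theta′ = record
      { G = graph3 ; κ = κ ; edgeKey = λ _ _ → ⇔-refl ; O = O₃ ; e = zero
      ; max = is-max
      ; ¬isthmus = ¬isthmus
      ; ¬loop = ¬loop
      ; minor = deletion
      ; π = π ; α = α ; ω = ω ; β = β
      ; key-e = refl
      ; word-π = word≡ π ∈π⇒∈N tag-π
      ; word-α = word≡ α ∈α⇒∈N tag-α
      ; word-ω = word≡ ω ∈ω⇒∈N tag-ω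
      ; letter-β = ∷-injectiveˡ (word≡ [ β ] {L = [ b ]} (λ { (here refl) → β∈N }) (cong [_] tag-β))
      ; circ₁ = circ₁ ; circ₂ = circ₂ ; circ₃ = circ₃ ; circ₃-only = only₃ }
      where
      is-max : IsMax zero
      is-max zero ne = contradiction refl ne
      is-max (suc i) _ = All.lookup (subst (All (ℕ._< k)) (sym keysT) (Allₚ.map⁺ lt)) (∈-map⁺ (key ∘ proj₂) (∈-lookup i))

  theta : ∀ k d P A b Q → A ≢ [] → (P ++ A ++ b ∷ Q) ≺ k → UniqueKeys (P ++ A ++ b ∷ Q) → Theta k d P A b Q
  theta k d P [] b Q ne lt u = contradiction refl ne
  theta k d P (a ∷ A) b Q ne lt u = theta′ k d P a A b Q lt u

-- Simple cuts inside arbitrary cuts.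

module Component {G : OOGraph} (W : OOGraph.V G → Bool) (v : OOGraph.V G) (v∈W : W v ≡ true) where
  open OOGraph G

  Inside : Subset #V → E → Set
  Inside C e = tail e Sub.∈ C × head e Sub.∈ C

  ends-in : ∀ {C} a → src a Sub.∈ C → tgt a Sub.∈ C → Inside C (proj₁ a)
  ends-in (e , +) p q = p , q
  ends-in (e , -) p q = q , p

  Reached : Subset #V → Set
  Reached C = v Sub.∈ C × (∀ u → u Sub.∈ C → W u ≡ true × Joined (Inside C) v u)

  Closed : Subset #V → Set
  Closed C = ∀ a → src a Sub.∈ C → W (tgt a) ≡ true → tgt a Sub.∈ C

  Leaves : Subset #V → 𝔼 → Set
  Leaves C a = Vec.lookup C (src a) ≡ true × W (tgt a) ≡ true × Vec.lookup C (tgt a) ≡ false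

  leaves? : ∀ C a → Dec (Leaves C a)
  leaves? C a = (Vec.lookup C (src a) Bool.≟ true) ×-dec (W (tgt a) Bool.≟ true) ×-dec (Vec.lookup C (tgt a) Bool.≟ false)

  grow : ∀ C a → Reached C → Leaves C a → Reached (C Sub.∪ Sub.⁅ tgt a ⁆)
  grow C a (v∈ , reach) (s∈ , w∈ , t∉) = p⊆p∪q Sub.⁅ tgt a ⁆ v∈ , joined
    where
    C′ = C Sub.∪ Sub.⁅ tgt a ⁆
    ⊆C′ : ∀ {u} → u Sub.∈ C → u Sub.∈ C′
    ⊆C′ = p⊆p∪q Sub.⁅ tgt a ⁆
    widen : ∀ {u} → Joined (Inside C) v u → Joined (Inside C′) v u
    widen = joined-map {G} (λ e (p , q) → ⊆C′ p , ⊆C′ q)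
    joined : ∀ u → u Sub.∈ C′ → W u ≡ true × Joined (Inside C′) v u
    joined u u∈ with x∈p∪q⁻ C Sub.⁅ tgt a ⁆ u∈
    ... | inj₁ h = proj₁ (reach u h) , widen (proj₂ (reach u h))
    ... | inj₂ h with x∈⁅y⁆⇒x≡y (tgt a) h
    ...   | refl = w∈ , widen (proj₂ (reach (src a) (true⇒∈ s∈))) ◅◅
              (((a , refl , refl) , ends-in {C′} a (⊆C′ (true⇒∈ s∈)) u∈) ◅ ε)

  leaving : ∀ C → ∃ (Leaves C) ⊎ Closed C
  leaving C with any? (λ e → leaves? C (e , +)) | any? (λ e → leaves? C (e , -))
  ... | yes (e , lv) | _ = inj₁ ((e , +) , lv)
  ... | no _ | yes (e , lv) = inj₁ ((e , -) , lv)
  ... | no ¬p | no ¬m = inj₂ closed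
    where
    closed : Closed C
    closed a s∈ w∈ with Vec.lookup C (tgt a) in eq
    ... | true = true⇒∈ eq
    closed (e , +) s∈ w∈ | false = contradiction (e , ∈⇒true s∈ , w∈ , eq) ¬p
    closed (e , -) s∈ w∈ | false = contradiction (e , ∈⇒true s∈ , w∈ , eq) ¬m

  grows : ∀ C a → Leaves C a → Sub.∣ C ∣ ℕ.< Sub.∣ C Sub.∪ Sub.⁅ tgt a ⁆ ∣
  grows C a (_ , _ , t∉) = p⊂q⇒∣p∣<∣q∣ (p⊆p∪q Sub.⁅ tgt a ⁆ , tgt a ,
    q⊆p∪q C Sub.⁅ tgt a ⁆ (x∈⁅x⁆ (tgt a)) , λ t∈ → true≢false (∈⇒true t∈) t∉)

  -- Every step adds a new vertex, so fuel plus size stays at least `#V`, and running out of fuel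
  -- would mean more than `#V` vertices.
  saturate : ∀ fuel C → #V ℕ.≤ fuel ℕ.+ Sub.∣ C ∣ → Reached C → ∃[ C′ ] Reached C′ × Closed C′
  saturate fuel C le r with leaving C
  ... | inj₂ closed = C , r , closed
  saturate zero C le r | inj₁ (a , lv) =
    contradiction (ℕ.≤-trans (ℕ.<-≤-trans (ℕ.≤-<-trans le (grows C a lv)) (∣p∣≤n (C Sub.∪ Sub.⁅ tgt a ⁆))) ℕ.≤-refl) (ℕ.<-irrefl refl)
  saturate (suc fuel) C le r | inj₁ (a , lv) =
    saturate fuel (C Sub.∪ Sub.⁅ tgt a ⁆)
      (ℕ.≤-trans le (ℕ.≤-trans (ℕ.≤-reflexive (sym (ℕ.+-suc fuel _))) (ℕ.+-monoʳ-≤ fuel (grows C a lv))))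
      (grow C a r lv)

  component : ∃[ C ] Reached C × Closed C
  component = saturate #V Sub.⁅ v ⁆ (ℕ.m≤m+n #V _)
    (x∈⁅x⁆ v , λ u u∈ → start u (x∈⁅y⁆⇒x≡y v u∈))
    where
    start : ∀ u → u ≡ v → W u ≡ true × Joined (Inside Sub.⁅ v ⁆) v u
    start _ refl = v∈W , ε

module _ {G : OOGraph} where
  open OOGraph G

  joined-sym : ∀ {S u v} → Joined S u v → Joined S v u
  joined-sym = Star.reverse (λ ((a , p , q) , h) → (opp a , trans (src-opp {graph} a) q , trans (tgt-opp {graph} a) p) , h)

  -- Take the component C₁ of U containing the tail of a, and then the
  -- component C₂ of its complement containing the head of a: the edges
  -- between C₁ and C₂ form a simple cut.
  simple-subcut : ∀ (Cu : Cut G) a → a ∈ Cut.𝔼Cu Cu →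
    Σ[ Cu′ ∈ Cut G ] SimpleCut G Cu′ × a ∈ Cut.𝔼Cu Cu′ × (∀ b → b ∈ Cut.𝔼Cu Cu′ → b ∈ Cut.𝔼Cu Cu)
  simple-subcut Cu a a∈ = Cu′ , (connected-U′ , connected-C₂′) , a∈′ , sub
    where
    open Cut Cu using (U; 𝔼Cu)
    s t : V
    s = src a
    t = tgt a
    s∈ : side Cu s ≡ true
    s∈ = proj₁ (to (crossing Cu a) a∈)
    t∉ : side Cu t ≡ false
    t∉ = proj₂ (to (crossing Cu a) a∈)
    module K₁ = Component {G} (side Cu) s s∈
    C₁ : Subset #V
    C₁ = proj₁ K₁.component
    s∈C₁ : s Sub.∈ C₁
    s∈C₁ = proj₁ (proj₁ (proj₂ K₁.component))
    reach₁ : ∀ u → u Sub.∈ C₁ → side Cu u ≡ true × Joined (K₁.Inside C₁) s u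
    reach₁ = proj₂ (proj₁ (proj₂ K₁.component))
    closed₁ : K₁.Closed C₁
    closed₁ = proj₂ (proj₂ K₁.component)
    W₂ : V → Bool
    W₂ u = not (Vec.lookup C₁ u)
    t∈W₂ : W₂ t ≡ true
    t∈W₂ with Vec.lookup C₁ t in eq
    ... | true = ⊥-elim (true≢false (proj₁ (reach₁ t (true⇒∈ eq))) t∉)
    ... | false = refl
    module K₂ = Component {G} W₂ t t∈W₂
    C₂ : Subset #V
    C₂ = proj₁ K₂.component
    t∈C₂ : t Sub.∈ C₂
    t∈C₂ = proj₁ (proj₁ (proj₂ K₂.component))
    reach₂ : ∀ u → u Sub.∈ C₂ → W₂ u ≡ true × Joined (K₂.Inside C₂) t u
    reach₂ = proj₂ (proj₁ (proj₂ K₂.component))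
    closed₂ : K₂.Closed C₂
    closed₂ = proj₂ (proj₂ K₂.component)
    disjoint : ∀ u → u Sub.∈ C₁ → u Sub.∈ Sub.∁ C₂
    disjoint u u∈ with Vec.lookup C₂ u in eq
    ... | false = false⇒∈∁ eq
    ... | true = ⊥-elim (true≢false (proj₁ (reach₂ u (true⇒∈ eq))) (cong not (∈⇒true u∈)))
    -- The first side is all of the complement of `C₂`, not just `C₁`: the other components of the
    -- complement of `C₁` join it, being attached to `C₁`.
    U′ : Subset #V
    U′ = Sub.∁ C₂
    Cu′ : Cut G
    Cu′ = record { U = U′ ; nonempty = s , disjoint s s∈C₁ ; nonemptyᶜ = t , subst (t Sub.∈_) (sym (∁-involutive C₂)) t∈C₂ }
    connected-C₂ : InducedConnected G C₂
    connected-C₂ u∈ v∈ = joined-sym (proj₂ (reach₂ _ u∈)) ◅◅ proj₂ (reach₂ _ v∈)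
    connected-C₂′ : InducedConnected G (Sub.∁ U′)
    connected-C₂′ = subst (InducedConnected G) (sym (∁-involutive C₂)) connected-C₂
    within : ∀ {u} → u Sub.∈ C₁ → Joined (K₁.Inside U′) u s
    within u∈ = joined-map {G} (λ e (p , q) → disjoint _ p , disjoint _ q) (joined-sym (proj₂ (reach₁ _ u∈)))
    -- A walk to `s` cannot enter `C₂` before it meets `C₁`: the vertex from which it entered would
    -- lie outside `C₁`, hence in the closed set `C₂`.
    to-s : ∀ {u} → Walk u s → u Sub.∈ U′ → Joined (K₁.Inside U′) u s
    to-s ε u∈ = ε
    to-s {u} ((b , refl , refl) ◅ w) u∈ with Vec.lookup C₁ u in eq
    ... | true = within (true⇒∈ eq)
    ... | false with Vec.lookup C₂ (tgt b) in eq₂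
    ...   | false = ((b , refl , refl) , K₁.ends-in {U′} b u∈ (false⇒∈∁ eq₂)) ◅ to-s w (false⇒∈∁ eq₂)
    ...   | true = ⊥-elim (true≢false
            (∈⇒true (subst (Sub._∈ C₂) (tgt-opp {graph} b) (closed₂ (opp b) (subst (Sub._∈ C₂) (sym (src-opp {graph} b)) (true⇒∈ eq₂))
              (trans (cong W₂ (tgt-opp {graph} b)) (cong not eq))))) (∈∁⇒false u∈))
    connected-U′ : InducedConnected G U′
    connected-U′ {u} {v} u∈ v∈ = to-s (connected u s) u∈ ◅◅ joined-sym (to-s (connected v s) v∈)
    a∈′ : a ∈ Cut.𝔼Cu Cu′
    a∈′ = disjoint s s∈C₁ , subst (t Sub.∈_) (sym (∁-involutive C₂)) t∈C₂
    sub : ∀ b → b ∈ Cut.𝔼Cu Cu′ → b ∈ 𝔼Cu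
    sub b (p , q) = true⇒∈ (proj₁ (reach₁ _ sb∈)) , tb∉
      where
      tb∈ : tgt b Sub.∈ C₂
      tb∈ = subst (tgt b Sub.∈_) (∁-involutive C₂) q
      sb∈ : src b Sub.∈ C₁
      sb∈ with Vec.lookup C₁ (src b) in eq
      ... | true = true⇒∈ eq
      ... | false = ⊥-elim (true≢false
            (∈⇒true (subst (Sub._∈ C₂) (tgt-opp {graph} b) (closed₂ (opp b) (subst (Sub._∈ C₂) (sym (src-opp {graph} b)) tb∈)
              (trans (cong W₂ (tgt-opp {graph} b)) (cong not eq))))) (∈∁⇒false p))
      -- If the head were in `U`, then `C₁`, which is closed in `U` and contains the source, would
      -- contain it.
      tb∉ : tgt b Sub.∈ Sub.∁ U
      tb∉ with side Cu (tgt b) in eq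
      ... | false = false⇒∈∁ eq
      ... | true = ⊥-elim (true≢false (proj₁ (reach₂ _ tb∈)) (cong not (∈⇒true (closed₁ b sb∈ eq))))

-- The classification of Tutte cut properties.

module CutFinal (P : FourientationProperty) (tutte : IsTutteCutProperty P) where
  open FourientationProperty P
  open CircuitTheory P cutPolarity bondShape
  open CutTheory P tutte
  open CutTheta P tutte using (theta)
  open WordRules theory theta using (rules)
  open Transfer P cutPolarity bondShape theory

  cutObjects : Objects
  cutObjects = record
    { Ob = Cut
    ; 𝔼Ob = λ Cu → Cut.𝔼Cu Cu
    ; 𝔼Ob? = λ {G} Cu a → in-cut? {G} Cu a
    ; anArc = λ {G} Cu → an-arc {G} Cu
    ; of-circ = λ { (Cu , _ , _ , h) → Cu , h }
    ; one-way = λ {G} Cu {e} {s} {t} p q → cong proj₂ (trans (proj₂ (crossing-arcOf Cu (e , s) p)) (sym (proj₂ (crossing-arcOf Cu (e , t) q))))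
    ; sub = λ {G} Cu a a∈ → let Cu′ , simple , a∈′ , ⊆ = simple-subcut {G} Cu a a∈ in
        cutArcs Cu′ , (Cu′ , simple , cutArcs-unique Cu′ , cutArcs-∈ Cu′) , to (cutArcs-∈ Cu′ a) a∈′ ,
        λ b b∈ → ⊆ b (from (cutArcs-∈ Cu′ b) b∈)
    ; Pot = λ {G} O Cu → PotentialCut G O Cu
    ; pot⇔ = λ {G} O Cu → mk⇔ (λ pot e s m → fwd {G} O e s (pot e s m)) (λ h e s m → bwd {G} O e s (h e s m))
    }
    where
    in-cut? : ∀ {G} (Cu : Cut G) a → Dec (a ∈ Cut.𝔼Cu Cu)
    in-cut? {G} Cu a with side Cu (OOGraph.src G a) Bool.≟ true | side Cu (OOGraph.tgt G a) Bool.≟ false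
    ... | yes p | yes q = yes (from (crossing Cu a) (p , q))
    ... | no ¬p | _ = no (¬p ∘ proj₁ ∘ to (crossing Cu a))
    ... | yes _ | no ¬q = no (¬q ∘ proj₂ ∘ to (crossing Cu a))
    an-arc : ∀ {G} (Cu : Cut G) → ∃[ a ] a ∈ Cut.𝔼Cu Cu
    an-arc {G} Cu with path-crosses {OOGraph.graph G} (side Cu)
      (walk-path {G} (OOGraph.connected G (proj₁ (Cut.nonempty Cu)) (proj₁ (Cut.nonemptyᶜ Cu))))
      (∈⇒true (proj₂ (Cut.nonempty Cu))) (∈∁⇒false (proj₂ (Cut.nonemptyᶜ Cu)))
    ... | a , _ , p , q = a , from (crossing Cu a) (p , q)
    fwd : ∀ {G} O e s → let open OOGraph G in ¬ (e , opposite s) ∈ᶠ O → status O e ≡ unoriented ⊎ status O e ≡ oriented s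
    fwd {G} O e s h with OOGraph.status G O e | has-status-at {G} O e (opposite s)
    ... | unoriented | eq = inj₁ refl
    ... | bioriented | eq = contradiction (sym eq) h
    fwd {G} O e + h | oriented + | eq = inj₂ refl
    fwd {G} O e - h | oriented - | eq = inj₂ refl
    fwd {G} O e + h | oriented - | eq = contradiction (sym eq) h
    fwd {G} O e - h | oriented + | eq = contradiction (sym eq) h
    bwd : ∀ {G} O e s → let open OOGraph G in status O e ≡ unoriented ⊎ status O e ≡ oriented s → ¬ (e , opposite s) ∈ᶠ O
    bwd {G} O e s h m with OOGraph.status G O e | has-status-at {G} O e (opposite s)
    bwd O e s (inj₁ refl) m | _ | eq = contradiction (trans (sym m) (sym eq)) λ ()
    bwd O e + (inj₂ refl) m | _ | eq = contradiction (trans (sym m) (sym eq)) λ ()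
    bwd O e - (inj₂ refl) m | _ | eq = contradiction (trans (sym m) (sym eq)) λ ()

  open Goodness cutObjects rules
  open Consequences f rules using (classification; X; X-blocked)

  cut-classification : IsMinEdgeCutProperty P ⊎ IsCutWeird P ⊎ IsCutCoWeird P
  cut-classification with classification
  ... | inj₁ (δ , std) = inj₁ (X ∘ Polarity.mk cutPolarity , δ , X-blocked , λ G O → min-edge-good G O (X ∘ Polarity.mk cutPolarity) δ (λ _ → refl) std)
  ... | inj₂ (- , std) = inj₂ (inj₁ λ G O → weird-good G O - std)
  ... | inj₂ (+ , std) = inj₂ (inj₂ λ G O → weird-good G O + std)

-- Cycles

next : ∀ {n} → Fin (suc n) → Fin (suc n)
next i with view i
... | ‵fromℕ     = zero
... | ‵inject₁ j = suc j

next-inject₁ : ∀ {n} (j : Fin n) → next (inject₁ j) ≡ suc j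
next-inject₁ j rewrite view-inject₁ j = refl

next-fromℕ : ∀ n → next (fromℕ n) ≡ zero
next-fromℕ n rewrite view-fromℕ n = refl

next-injective : ∀ {n} {i j : Fin (suc n)} → next i ≡ next j → i ≡ j
next-injective {i = i} {j} eq with view i | view j
... | ‵fromℕ     | ‵fromℕ     = refl
... | ‵inject₁ _ | ‵inject₁ _ with eq
...   | refl = refl

next≢ : ∀ {n} (i : Fin (suc (suc n))) → next i ≢ i
next≢ i eq with view i
next≢ _ () | ‵fromℕ
... | ‵inject₁ j = suc≢inject₁ j eq
  where
  suc≢inject₁ : ∀ {n} (j : Fin n) → suc j ≢ inject₁ j
  suc≢inject₁ zero ()
  suc≢inject₁ (suc j) eq = suc≢inject₁ j (suc-injective eq)

-- Climb from `i₀` to the last index, wrap around to `zero`, and climb again.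
next-closed : ∀ {n} (Q : Fin (suc n) → Set) → (∀ i → Q i → Q (next i)) → ∀ i₀ → Q i₀ → ∀ i → Q i
next-closed {n} Q closed i₀ q₀ = <-weakInduction Q q-zero step′
  where
  step′ : ∀ i → Q (inject₁ i) → Q (suc i)
  step′ i q = subst Q (next-inject₁ i) (closed _ q)
  q-zero : Q zero
  q-zero = subst Q (next-fromℕ n) (closed _ (<-weakInduction-startingFrom Q q₀ step′ (≤fromℕ i₀)))

cyclePolarity : Polarity
cyclePolarity = record
  { ⟦_⟧ = λ { free → bioriented ; blocked → unoriented ; (or s) → oriented s }
  ; mk = λ { unoriented → blocked ; bioriented → free ; (oriented s) → or s }
  ; mk-st = λ { free → refl ; blocked → refl ; (or s) → refl }
  ; st-mk = λ { unoriented → refl ; bioriented → refl ; (oriented s) → refl }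
  ; mk-or = λ _ → refl }

cycleShape : Shape
cycleShape = record
  { vert = λ n → n
  ; fro = λ _ i → i
  ; into = λ _ → next
  ; reach = λ n R h h′ u v → back n R h′ u ◅◅ forth n R h v }
  where
  forth : ∀ n (R : Fin (suc n) → Fin (suc n) → Set) → (∀ i → R i (next i)) → ∀ v → Star R zero v
  forth n R h = <-weakInduction (Star R zero) ε (λ i w → w ◅◅ (subst (R (inject₁ i)) (next-inject₁ i) (h (inject₁ i)) ◅ ε))
  back : ∀ n (R : Fin (suc n) → Fin (suc n) → Set) → (∀ i → R (next i) i) → ∀ v → Star R v zero
  back n R h = <-weakInduction (λ v → Star R v zero) ε (λ i w → subst (λ j → R j (inject₁ i)) (next-inject₁ i) (h (inject₁ i)) ◅ w)

module _ {G : OrientedGraph} where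
  open OrientedGraph G

  path-inject₁ : ∀ {u a as w} → Path G u (a ∷ as) w → ∀ j → tgt (lookup (a ∷ as) (inject₁ j)) ≡ src (lookup as j)
  path-inject₁ (step _ (step eq p)) zero    = sym eq
  path-inject₁ (step _ p@(step _ _)) (suc j) = path-inject₁ p j

  path-fromℕ : ∀ {u a as w} → Path G u (a ∷ as) w → tgt (lookup (a ∷ as) (fromℕ (length as))) ≡ w
  path-fromℕ (step _ []) = refl
  path-fromℕ (step _ p@(step _ _)) = path-fromℕ p

  path-next : ∀ {u a as} → Path G u (a ∷ as) u → ∀ i → tgt (lookup (a ∷ as) i) ≡ src (lookup (a ∷ as) (next i))
  path-next p i with view i
  ... | ‵fromℕ     = trans (path-fromℕ p) (sym (path-start p))
  ... | ‵inject₁ j = path-inject₁ p j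

  path-ends : ∀ {u as v} → Path G u as v → map src as ++ [ v ] ≡ u ∷ map tgt as
  path-ends [] = refl
  path-ends (step refl p) = cong (_ ∷_) (path-ends p)

  -- Sources followed by the endpoint are the start followed by the targets; on a closed path the
  -- two extra vertices agree and cancel.
  closed-ends : ∀ {u as} → Path G u as u → map src as ↭ map tgt as
  closed-ends {u} {as} p = Perm.drop-∷ (↭-trans (Perm.∷↭∷ʳ u (map src as)) (↭-reflexive (path-ends p)))

  path-rotate : ∀ {u} as {bs} → Path G u (as ++ bs) u → ∃[ v ] Path G v (bs ++ as) v
  path-rotate as p with path-split as p
  ... | v , q , r = v , path-++ r q

  -- After rotating `b` to the front, the next arc starts where `b` ends. If there is no other arc,
  -- `b` is a loop and its own successor.
  next-arc : ∀ {u as} → Path G u as u → Unique (map proj₁ as) → ∀ {b} → b ∈ˡ as →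
             ∃[ c ] c ∈ˡ as × src c ≡ tgt b × (c ≡ b ⊎ proj₁ c ≢ proj₁ b)
  next-arc {u} {as} p un {b} b∈ with ∈-∃++ b∈
  ... | xs , ys , refl with path-rotate xs p | ↭-Unique (Perm.map⁺ proj₁ (Perm.++-comm xs (b ∷ ys))) un
  ...   | _ , step refl q | ne ∷ _ = follow (ys ++ xs) refl q
    where
    follow : ∀ zs → zs ≡ ys ++ xs → Path G (tgt b) zs (src b) → ∃[ c ] c ∈ˡ xs ++ b ∷ ys × src c ≡ tgt b × (c ≡ b ⊎ proj₁ c ≢ proj₁ b)
    follow [] _ q = b , b∈ , sym (path-[] q) , inj₁ refl
    follow (c ∷ zs) eq (step e _) = c , Perm.∈-resp-↭ (Perm.++-comm (b ∷ ys) xs) (there c∈) , e ,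
      inj₂ (λ eq′ → All.lookup ne (∈-map⁺ proj₁ c∈) (sym eq′))
      where
      c∈ : c ∈ˡ ys ++ xs
      c∈ = subst (c ∈ˡ_) eq (here refl)

module _ {G : OOGraph} where
  open OOGraph G

  path-walk : ∀ {u as v} → Path graph u as v → Σ[ w ∈ Walk u v ] arcs w ≡ as
  path-walk [] = ε , refl
  path-walk (step {a = a} e p) with path-walk p
  ... | w , eq = (a , e , refl) ◅ w , cong (a ∷_) eq

IsCycle : (G : OOGraph) → List (OOGraph.𝔼 G) → Set
IsCycle G as = (∃[ u ] Path (OOGraph.graph G) u as u) × as ≢ [] × Unique (map proj₁ as) × Unique (map (OOGraph.src G) as)

module _ {G : OOGraph} where
  open OOGraph G

  map-proj₁-mirror : ∀ (as : List 𝔼) → map proj₁ (reverse (map opp as)) ↭ map proj₁ as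
  map-proj₁-mirror as = ↭-trans (Perm.map⁺ proj₁ (Perm.↭-reverse (map opp as))) (↭-reflexive (sym (map-∘ as)))

  cycle-rotate : ∀ as {bs} → IsCycle G (as ++ bs) → IsCycle G (bs ++ as)
  cycle-rotate as {bs} ((_ , p) , ne , u , u′) = path-rotate as p , nonempty as bs ne ,
    ↭-Unique (Perm.map⁺ proj₁ (Perm.++-comm as bs)) u , ↭-Unique (Perm.map⁺ src (Perm.++-comm as bs)) u′
    where
    nonempty : ∀ (as bs : List 𝔼) → as ++ bs ≢ [] → bs ++ as ≢ []
    nonempty [] [] ne _ = ne refl
    nonempty (x ∷ as) [] ne ()

  cycle-mirror : ∀ {as} → IsCycle G as → IsCycle G (reverse (map opp as))
  cycle-mirror {as} ((u , p) , ne , un , un′) = (u , path-reverse p) , nonempty as ne ,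
    ↭-Unique (↭-sym (map-proj₁-mirror as)) un ,
    ↭-Unique (↭-sym (↭-trans (Perm.map⁺ src (Perm.↭-reverse (map opp as)))
      (↭-reflexive (trans (sym (map-∘ as)) (map-cong (src-opp {graph}) as))))) (↭-Unique (closed-ends p) un′)
    where
    nonempty : ∀ as → as ≢ [] → reverse (map opp as) ≢ []
    nonempty [] ne _ = ne refl
    nonempty (a ∷ as) ne eq with trans (sym (Perm.↭-length (Perm.↭-reverse (map opp (a ∷ as))))) (cong length eq)
    ... | ()

  mirror-∈ : ∀ {a : 𝔼} {as} → a ∈ˡ as → opp a ∈ˡ reverse (map opp as)
  mirror-∈ a∈ = Anyₚ.reverse⁺ (∈-map⁺ opp a∈)

module _ {G S H S′ H′} (d : EdgeSubgraph G S H) (d′ : EdgeSubgraph G S′ H′) (S⇔S′ : ∀ e → e ∈ S ⇔ e ∈ S′) where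
  private
    module d = EdgeSubgraph d
    module d′ = EdgeSubgraph d′
    fwd : ∀ y → ∃[ z ] d′.ν z ≡ d.ν y
    fwd y with to (d.ν-image (d.ν y)) (y , refl)
    ... | e , e∈ , inc = from (d′.ν-image _) (e , to (S⇔S′ e) e∈ , inc)
    bwd : ∀ y → ∃[ z ] d.ν z ≡ d′.ν y
    bwd y with to (d′.ν-image (d′.ν y)) (y , refl)
    ... | e , e∈ , inc = from (d.ν-image _) (e , from (S⇔S′ e) e∈ , inc)

  subgraph-iso : ∀ O → Isomorphism H (d.restrict O) H′ (d′.restrict O)
  subgraph-iso O = record
    { verts = mk↔ₛ′ (proj₁ ∘ fwd) (proj₁ ∘ bwd)
        (λ y → d′.ν-injective (trans (proj₂ (fwd _)) (proj₂ (bwd y))))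
        (λ y → d.ν-injective (trans (proj₂ (bwd _)) (proj₂ (fwd y))))
    ; edges = embedding-↔ d.edges d′.edges S⇔S′
    ; tail-comm = λ x → d′.ν-injective (trans (proj₂ (fwd _)) (trans (d.tail-comm x)
        (trans (cong (OOGraph.tail G) (sym (embedding-ι d.edges d′.edges S⇔S′ x))) (sym (d′.tail-comm _)))))
    ; head-comm = λ x → d′.ν-injective (trans (proj₂ (fwd _)) (trans (d.head-comm x)
        (trans (cong (OOGraph.head G) (sym (embedding-ι d.edges d′.edges S⇔S′ x))) (sym (d′.head-comm _)))))
    ; order = embedding-order d.edges d′.edges S⇔S′
    ; fourient = λ x s → cong (λ e → O (e , s)) (sym (embedding-ι d.edges d′.edges S⇔S′ x))
    }

-- Simple cycles and their subgraphs.

module CycleTheory (P : FourientationProperty) (tutte : IsTutteCycleProperty P) where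
  open FourientationProperty P
  open IsTutteCycleProperty tutte
  open CircuitTheory P cyclePolarity cycleShape

  module Standard {G : OOGraph} (O : OOGraph.Fourientation G) {κ : OOGraph.E G → ℕ} (K : EdgeKey G κ)
                  (a : OOGraph.𝔼 G) (as : List (OOGraph.𝔼 G)) (circ : IsCycle G (a ∷ as)) where
    open OOGraph G
    unique : Unique (map proj₁ (a ∷ as))
    unique = proj₁ (proj₂ (proj₂ circ))
    path : Path graph _ (a ∷ as) _
    path = proj₂ (proj₁ circ)
    open Listed P cyclePolarity cycleShape G O K a as unique

    at : Fin (suc n) → 𝔼
    at = lookup (a ∷ as)

    ends : ∀ b x v w → src b ≡ v → tgt b ≡ w → (ν : Fin (suc n) → V) → ν x ≡ v → ν (next x) ≡ w →
           ν (tl n (proj₂ b) x) ≡ tail (proj₁ b) × ν (hd n (proj₂ b) x) ≡ head (proj₁ b)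
    ends (e , +) x _ _ refl refl ν p q = p , q
    ends (e , -) x _ _ refl refl ν p q = q , p

    -- Vertices are identified with the arcs leaving them; the target of each arc is the source of
    -- the cyclically next one.
    subgraph : (S : Pred E _) → (∀ e → e ∈ S ⇔ e ∈ˡ map proj₁ (a ∷ as)) → EdgeSubgraph G S H
    subgraph S S⇔ = record
      { edges = embedding S S⇔
      ; ν = src ∘ at
      ; ν-injective = lookup-injective src (a ∷ as) (proj₂ (proj₂ (proj₂ circ)))
      ; ν-image = λ v → mk⇔ (image v) (preimage v)
      ; tail-comm = λ x → proj₁ (comm x)
      ; head-comm = λ x → proj₂ (comm x)
      }
      where
      comm : ∀ x → src (at (tl n (proj₂ (at x)) x)) ≡ tail (proj₁ (at x)) × src (at (hd n (proj₂ (at x)) x)) ≡ head (proj₁ (at x))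
      comm x = ends (at x) x _ _ refl refl (src ∘ at) refl (sym (path-next {graph} path x))
      incident : ∀ b → tail (proj₁ b) ≡ src b ⊎ head (proj₁ b) ≡ src b
      incident (e , +) = inj₁ refl
      incident (e , -) = inj₂ refl
      image : ∀ v → ∃[ y ] src (at y) ≡ v → ∃[ e ] e ∈ S × (tail e ≡ v ⊎ head e ≡ v)
      image v (y , refl) = proj₁ (at y) , from (S⇔ _) (∈-map⁺ proj₁ (∈-lookup y)) , incident (at y)
      ends-of : ∀ b {v} → tail (proj₁ b) ≡ v ⊎ head (proj₁ b) ≡ v → src b ≡ v ⊎ tgt b ≡ v
      ends-of (e , +) (inj₁ p) = inj₁ p
      ends-of (e , +) (inj₂ p) = inj₂ p
      ends-of (e , -) (inj₁ p) = inj₂ p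
      ends-of (e , -) (inj₂ p) = inj₁ p
      preimage : ∀ v → ∃[ e ] e ∈ S × (tail e ≡ v ⊎ head e ≡ v) → ∃[ y ] src (at y) ≡ v
      preimage v (e , e∈ , inc) with ∈-map⁻ proj₁ (to (S⇔ e) e∈)
      ... | b , b∈ , refl with ends-of b inc
      ...   | inj₁ p = Any.index b∈ , trans (cong src (sym (Anyₚ.lookup-index b∈))) p
      ...   | inj₂ p = next (Any.index b∈) , trans (sym (path-next {graph} path (Any.index b∈))) (trans (cong tgt (sym (Anyₚ.lookup-index b∈))) p)

    standard-value : ∀ {S H′} → (∀ e → e ∈ S ⇔ e ∈ˡ map proj₁ (a ∷ as)) → (d : EdgeSubgraph G S H′) →
                     isGood H′ (EdgeSubgraph.restrict d O) ≡ f (word {G} κ O (a ∷ as))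
    standard-value {S} S⇔ d = trans (invariant (subgraph-iso d (subgraph S S⇔) (λ _ → ⇔-refl) O))
      (trans (isGood-cong P H (λ (x , s) → sym (marks-restrict x s))) (sym f-word-listed))

  value-minor : ∀ {G} O {κ} → EdgeKey G κ → ∀ {as} → IsCycle G as → ∀ {S H} → (∀ e → e ∈ S ⇔ e ∈ˡ map proj₁ as) →
                (d : EdgeSubgraph G S H) → isGood H (EdgeSubgraph.restrict d O) ≡ f (word {G} κ O as)
  value-minor O K {[]} (_ , ne , _) S⇔ d = contradiction refl ne
  value-minor {G} O K {a ∷ as} c S⇔ d = Standard.standard-value {G} O K a as c S⇔ d

  same-cycle : ∀ {G as bs} O {κ κ′} → EdgeKey G κ → EdgeKey G κ′ → IsCycle G as → IsCycle G bs →
               (∀ e → e ∈ˡ map proj₁ as ⇔ e ∈ˡ map proj₁ bs) → f (word {G} κ O as) ≡ f (word {G} κ′ O bs)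
  same-cycle {bs = []} O K K′ c c′ eq = contradiction refl (proj₁ (proj₂ c′))
  same-cycle {G} {as} {b ∷ bs} O K K′ c c′ eq = trans (sym (value-minor {G} O K c (⇔-sym ∘ eq) d)) (value-minor {G} O K′ c′ (λ _ → ⇔-refl) d)
    where d = Standard.subgraph {G} O K′ b bs c′ (_∈ˡ map proj₁ (b ∷ bs)) (λ _ → ⇔-refl)

  edges⇔ : ∀ {G} (Cy : Cycle G) e → e ∈ Cycle.ECy Cy ⇔ e ∈ˡ map proj₁ (OOGraph.arcs G (Cycle.walk Cy))
  edges⇔ {G} Cy e = mk⇔ (λ (s , m) → ∈-map⁺ proj₁ m) bwd
    where
    bwd : e ∈ˡ map proj₁ (OOGraph.arcs G (Cycle.walk Cy)) → e ∈ Cycle.ECy Cy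
    bwd m with ∈-map⁻ proj₁ m
    ... | (_ , s) , b∈ , refl = s , b∈

  toCycle : ∀ {G as} → IsCycle G as → Σ[ Cy ∈ Cycle G ] OOGraph.arcs G (Cycle.walk Cy) ≡ as
  toCycle {G} ((u , p) , ne , un , _) with path-walk {G} p
  ... | w , refl = record { base = u ; walk = w ; nonempty = ne ; distinctEdges = un } , refl

  fromCycle : ∀ {G} (Cy : Cycle G) → SimpleCycle G Cy → IsCycle G (OOGraph.arcs G (Cycle.walk Cy))
  fromCycle {G} Cy simple = (_ , walk-path {G} (Cycle.walk Cy)) , Cycle.nonempty Cy , Cycle.distinctEdges Cy , simple

  cycle-good⇔ : ∀ G O {κ} → EdgeKey G κ → Good G O ⇔ (∀ as → IsCycle G as → f (word {G} κ O as) ≡ true)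
  cycle-good⇔ G O K = mk⇔ fwd bwd
    where
    fwd : Good G O → ∀ as → IsCycle G as → f (word {G} _ O as) ≡ true
    fwd g [] (_ , ne , _) = contradiction refl ne
    fwd g (a ∷ as) c with toCycle {G} c
    ... | Cy , eq = trans (sym (value-minor {G} O K c S⇔ d)) (to (isCycleProperty G O) g Cy simple _ d)
      where
      simple : SimpleCycle G Cy
      simple = subst (λ l → Unique (map (OOGraph.src G) l)) (sym eq) (proj₂ (proj₂ (proj₂ c)))
      S⇔ : ∀ e → e ∈ Cycle.ECy Cy ⇔ e ∈ˡ map proj₁ (a ∷ as)
      S⇔ e = subst (λ l → e ∈ Cycle.ECy Cy ⇔ e ∈ˡ map proj₁ l) eq (edges⇔ Cy e)
      d = Standard.subgraph {G} O K a as c (Cycle.ECy Cy) S⇔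
    bwd : (∀ as → IsCycle G as → f (word {G} _ O as) ≡ true) → Good G O
    bwd h = from (isCycleProperty G O) λ Cy simple H d →
      trans (value-minor {G} O K (fromCycle Cy simple) (edges⇔ Cy) d) (h _ (fromCycle Cy simple))

  cycle-T2 : ∀ {G e H} → OOGraph.IsMax G e → ¬ IsIsthmus G e → ¬ OOGraph.IsLoop G e →
             (m : Contraction G ｛ e ｝ H) → ∀ O →
             Forcing (isGood H (EdgeEmbedding.restrict (Contraction.edges m) O)) (λ t → isGood G (_[_≔_] {G} O e ⟦ t ⟧))
  cycle-T2 {G} {e} {H} mx ni nl m O = T2⇒forcing {g = λ t → isGood G (_[_≔_] {G} O e ⟦ t ⟧)}
    (isGood-cong P G (extend-oriented d O +)) (isGood-cong P G (extend-oriented d O -))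
    (isGood-cong P G (extend-unoriented d O)) (isGood-cong P G (extend-bioriented d O))
    (T2 G e mx ni nl H m (EdgeEmbedding.restrict d O))
    where d = Contraction.edges m

  module _ (n : ℕ) (φ : Fin (suc n) → Letter) (inj : Injective _≡_ _≡_ (key ∘ φ)) where
    private
      G = wordGraph n φ inj
    open OOGraph G

    natural-path : Path graph zero (tabulate (nat n φ)) zero
    natural-path = subst₂ (λ u v → Path graph u (tabulate (nat n φ)) v) (src-nat n φ zero)
      (trans (tgt-nat n φ (fromℕ n)) (next-fromℕ n))
      (path-tabulate n (nat n φ) (λ i → trans (tgt-nat n φ (inject₁ i)) (trans (next-inject₁ i) (sym (src-nat n φ (suc i))))))

    cycle-natural : IsCycle G (tabulate (nat n φ))
    cycle-natural = (zero , natural-path) , (λ ()) ,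
      subst Unique (sym (map-tabulate (nat n φ) proj₁)) (Uniqueₚ.tabulate⁺ id) ,
      subst Unique (sym (trans (map-tabulate (nat n φ) src) (tabulate-cong (src-nat n φ)))) (Uniqueₚ.tabulate⁺ id)

    -- Only `nat n φ (next i)` and the reverse of `nat n φ i` leave the vertex `next i`, and the
    -- reverse would repeat the edge `i`.
    natural-follows : ∀ {u as} → Path graph u as u → Unique (map proj₁ as) → ∀ i → nat n φ i ∈ˡ as → nat n φ (next i) ∈ˡ as
    natural-follows p un i m with next-arc {graph} p un m
    ... | (j , t) , c∈ , srcc , alt with sign-cases (dir (φ j)) t
    ...   | inj₁ refl = subst (λ k → nat n φ k ∈ˡ _) (trans (sym (src-nat n φ j)) (trans srcc (tgt-nat n φ i))) c∈
    ...   | inj₂ refl with next-injective {i = j} {i} (trans (sym (trans (src-opp {graph} (nat n φ j)) (tgt-nat n φ j))) (trans srcc (tgt-nat n φ i)))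
    ...     | refl with alt
    ...       | inj₁ eq = contradiction (sym (cong proj₂ eq)) s≢opp
    ...       | inj₂ ne = contradiction refl ne

    natural-all : ∀ {u as} → Path graph u as u → Unique (map proj₁ as) → ∀ i → nat n φ i ∈ˡ as → ∀ j → nat n φ j ∈ˡ as
    natural-all {as = as} p un = next-closed (λ j → nat n φ j ∈ˡ as) (natural-follows p un)

    compat-of : ∀ D m (O : Fourientation) i → D * dir (φ i) ≡ m → (i , m) ∈ᶠ O →
                Compat D (letter {G} (key ∘ φ) O (nat n φ i))
    compat-of D m O i eq here∈ with status O i in st
    ... | bioriented = inert refl
    ... | unoriented = contradiction (trans (sym here∈) (trans (sym (has-status-at {G} O i m)) (cong (λ t → has t m) st))) λ ()
    ... | oriented t with sign-cases m t
    ...   | inj₁ refl = aligned (cong or (sym eq))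
    ...   | inj₂ refl = contradiction (trans (sym here∈) (trans (sym (has-status-at {G} O i m)) (trans (cong (λ t → has t m) st) (differ m)))) λ ()
      where
      differ : ∀ s → has (oriented (opposite s)) s ≡ false
      differ + = refl
      differ - = refl

    -- By `natural-all` a cycle in this graph uses every edge in the sense of its first arc, so a
    -- potential cycle follows the word or its mirror image.
    cycle-natural-bad : ∀ O → Bad G O → ∃[ D ] (∀ i → Compat D (letter {G} (key ∘ φ) O (nat n φ i)))
    cycle-natural-bad O bad with T1 G O bad
    ... | Cy , pot = direction (arcs (Cycle.walk Cy)) refl
      where
      L = arcs (Cycle.walk Cy)
      p = walk-path {G} (Cycle.walk Cy)
      un = Cycle.distinctEdges Cy
      direction : ∀ l → l ≡ L → ∃[ D ] (∀ i → Compat D (letter {G} (key ∘ φ) O (nat n φ i)))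
      direction [] eq = contradiction (sym eq) (Cycle.nonempty Cy)
      direction ((i , s) ∷ l) eq with sign-cases (dir (φ i)) s
      ... | inj₁ refl = + , λ j → compat-of + _ O j refl (pot _ (natural-all p un i (subst (nat n φ i ∈ˡ_) eq (here refl)) j))
      ... | inj₂ refl = - , λ j → compat-of - _ O j refl (pot _ (back j
              (natural-all (path-reverse {graph} p) (↭-Unique (↭-sym (map-proj₁-mirror {G} L)) un) i
                (subst (_∈ˡ reverse (map opp L)) (opp-opp (nat n φ i)) (mirror-∈ {G} (subst (opp (nat n φ i) ∈ˡ_) eq (here refl)))) j)))
        where
        back : ∀ j → nat n φ j ∈ˡ reverse (map opp L) → opp (nat n φ j) ∈ˡ L
        back j m with ∈-map⁻ opp (Anyₚ.reverse⁻ m)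
        ... | b , b∈ , eq′ = subst (_∈ˡ L) (trans (sym (opp-opp b)) (cong opp (sym eq′))) b∈

  module _ (n : ℕ) (φ : Fin (suc (suc n)) → Letter) (inj : Injective _≡_ _≡_ (key ∘ φ)) (inj′ : Injective _≡_ _≡_ (key ∘ φ ∘ suc)) where
    private
      G = wordGraph (suc n) φ inj
      H = wordGraph n (φ ∘ suc) inj′
    open OOGraph G

    cycle-tail-minor : ¬ IsIsthmus G zero × ¬ IsLoop zero ×
      (Σ[ m ∈ Contraction G ｛ zero ｝ H ] (∀ i → EdgeEmbedding.ι (Contraction.edges m) i ≡ suc i))
    cycle-tail-minor = isthmus (natural-path (suc n) φ inj) (proj₁ (proj₂ (proj₂ (cycle-natural (suc n) φ inj)))) , not-loop , contraction , λ _ → refl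
      where
      e₀ : 𝔼
      e₀ = nat (suc n) φ zero
      isthmus : Path graph zero (tabulate (nat (suc n) φ)) zero → Unique (map proj₁ (tabulate (nat (suc n) φ))) → ¬ IsIsthmus G zero
      isthmus (step eq p) (ne ∷ _) = not-isthmus {G} e₀ _ (subst (Path graph (tgt e₀) _) (sym eq) p) (λ m → All.lookup ne m refl)
      tail≢head : ∀ s → tl (suc n) s zero ≢ hd (suc n) s zero
      tail≢head + ()
      tail≢head - ()
      not-loop : ¬ IsLoop zero
      not-loop = tail≢head (dir (φ zero))
      π : Fin (suc (suc n)) → Fin (suc n)
      π zero = zero
      π (suc i) = i
      π-next : ∀ x → next x ≡ π (next (suc x))
      π-next x with view x
      ... | ‵fromℕ     = refl
      ... | ‵inject₁ j = refl
      Merged : Fin (suc (suc n)) → Fin (suc (suc n)) → Set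
      Merged = Joined ｛ zero ｝
      one : Merged zero (suc zero)
      one = ((e₀ , src-nat (suc n) φ zero , tgt-nat (suc n) φ zero) , refl) ◅ ε
      one⁻ : Merged (suc zero) zero
      one⁻ = ((opp e₀ , trans (src-opp {graph} e₀) (tgt-nat (suc n) φ zero) , trans (tgt-opp {graph} e₀) (src-nat (suc n) φ zero)) , refl) ◅ ε
      merged : ∀ u v → π u ≡ π v → Merged u v
      merged zero zero _ = ε
      merged zero (suc v) refl = one
      merged (suc u) zero refl = one⁻
      merged (suc u) (suc v) refl = ε
      π-ends : ∀ s → π (tl (suc n) s zero) ≡ π (hd (suc n) s zero)
      π-ends + = refl
      π-ends - = refl
      same : ∀ a → proj₁ a ∈ ｛ zero ｝ → π (src a) ≡ π (tgt a)
      same (_ , +) refl = π-ends (dir (φ zero))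
      same (_ , -) refl = sym (π-ends (dir (φ zero)))
      contraction : Contraction G ｛ zero ｝ H
      contraction = record
        { edges = record
          { ι = suc
          ; ι-injective = λ { refl → refl }
          ; ι-image = suc-image
          ; ι-order = λ _ _ → ⇔-refl }
        ; π = π
        ; π-surjective = λ y → suc y , λ { refl → refl }
        ; π-fibres = λ u v → mk⇔ (merged u v) (joined-same {G} π same)
        ; tail-comm = λ x → tl-π (dir (φ (suc x))) x
        ; head-comm = λ x → hd-π (dir (φ (suc x))) x }
        where
        tl-π : ∀ s x → tl n s x ≡ π (tl (suc n) s (suc x))
        tl-π + x = refl
        tl-π - x = π-next x
        hd-π : ∀ s x → hd n s x ≡ π (hd (suc n) s (suc x))
        hd-π + x = π-next x
        hd-π - x = refl

  theory : Theory
  theory = record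
    { Circ = IsCycle
    ; circ-unique = λ (_ , _ , u , _) → u
    ; circ-rotate = λ {G} → cycle-rotate {G}
    ; circ-mirror = λ {G} → cycle-mirror {G}
    ; natural = cycle-natural
    ; same-edges = λ {G} → same-cycle {G}
    ; good⇔ = cycle-good⇔
    ; natural-bad = cycle-natural-bad
    ; Minor = λ G e H → Contraction G ｛ e ｝ H
    ; minor-edges = Contraction.edges
    ; T2 = cycle-T2
    ; tail-minor = cycle-tail-minor
    }

-- A cycle, the rim, with a chord

apart : ∀ {A B : Set} (g : A → B) xs {ys} → Unique (map g (xs ++ ys)) → ∀ {a c} → a ∈ˡ xs → c ∈ˡ ys → a ≢ c
apart g (x ∷ xs) (ne ∷ u) (here refl) c∈ refl = All.lookup ne (∈-map⁺ g (∈-++⁺ʳ xs c∈)) refl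
apart g (x ∷ xs) (_ ∷ u) (there a∈) c∈ = apart g xs u a∈ c∈

module _ {G : OOGraph} where
  open OOGraph G

  Incident : E → V → Set
  Incident x w = tail x ≡ w ⊎ head x ≡ w

  incident-src : ∀ a → Incident (proj₁ a) (src a)
  incident-src (e , +) = inj₁ refl
  incident-src (e , -) = inj₂ refl

  incident-tgt : ∀ a → Incident (proj₁ a) (tgt a)
  incident-tgt (e , +) = inj₂ refl
  incident-tgt (e , -) = inj₁ refl

  incident⇒ : ∀ a {w} → Incident (proj₁ a) w → src a ≡ w ⊎ tgt a ≡ w
  incident⇒ (e , +) h = h
  incident⇒ (e , -) (inj₁ p) = inj₂ p
  incident⇒ (e , -) (inj₂ p) = inj₁ p

  loop-arc : ∀ a → src a ≡ tgt a → IsLoop (proj₁ a)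
  loop-arc (e , +) h = h
  loop-arc (e , -) h = sym h

  -- A trail that arrives at `w` along `x` has to go on along another edge, since `x` is not a loop;
  -- if it departs along `x`, the reversed trail is used.
  meets : ∀ {u bs} → Path graph u bs u → Unique (map proj₁ bs) → ∀ {x w} → x ∈ˡ map proj₁ bs → ¬ IsLoop x → Incident x w →
          ∃[ y ] y ∈ˡ map proj₁ bs × y ≢ x × Incident y w
  meets {bs = bs} p un x∈ ¬loop inc with ∈-map⁻ proj₁ x∈
  ... | c , c∈ , refl with incident⇒ c inc
  ...   | inj₂ refl with next-arc {graph} p un c∈
  ...     | b , b∈ , eq , inj₁ refl = contradiction (loop-arc b eq) ¬loop
  ...     | b , b∈ , eq , inj₂ ne = proj₁ b , ∈-map⁺ proj₁ b∈ , ne , subst (Incident (proj₁ b)) eq (incident-src b)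
  meets {bs = bs} p un x∈ ¬loop inc | c , c∈ , refl | inj₁ refl
      with next-arc {graph} (path-reverse {graph} p) (↭-Unique (↭-sym (map-proj₁-mirror {G} bs)) un) (mirror-∈ {G} c∈)
  ...     | b , b∈ , eq , inj₁ refl = contradiction (loop-arc b eq) ¬loop
  ...     | b , b∈ , eq , inj₂ ne = proj₁ b , Perm.∈-resp-↭ (map-proj₁-mirror {G} bs) (∈-map⁺ proj₁ b∈) , ne ,
              subst (Incident (proj₁ b)) (trans eq (tgt-opp {graph} c)) (incident-src b)

module _ {G : OrientedGraph} where
  open OrientedGraph G

  path-last : ∀ {u a as v} → Path G u (a ∷ as) v → ∃[ c ] c ∈ˡ a ∷ as × tgt c ≡ v
  path-last (step _ []) = _ , here refl , refl
  path-last (step _ p@(step _ _)) with path-last p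
  ... | c , c∈ , eq = c , there c∈ , eq

open Words cyclePolarity cycleShape using (tl; hd; letter; word; ⟦_⟧; mk; mk-st)

-- Edge 0 is the chord from `u` to `v`, and edge `suc i` the rim edge leaving vertex `i`. The
-- maximum edge will be `suc zero`; at least two rim edges ensure that none is a loop.
module ChordGraph (n : ℕ) (φ : Fin (suc (suc n)) → Letter) (b : Letter) (u v : Fin (suc (suc n))) where

  κ′ : Fin (suc (suc (suc n))) → ℕ
  κ′ zero    = key b
  κ′ (suc i) = key (φ i)

  ends : Sign → Fin (suc (suc n)) × Fin (suc (suc n))
  ends + = u , v
  ends - = v , u

  tail′ head′ : Fin (suc (suc (suc n))) → Fin (suc (suc n))
  tail′ zero    = proj₁ (ends (dir b))
  tail′ (suc i) = tl (suc n) (dir (φ i)) i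
  head′ zero    = proj₂ (ends (dir b))
  head′ (suc i) = hd (suc n) (dir (φ i)) i

  chorded : OrientedGraph
  chorded = record { #V = suc (suc n) ; #E = suc (suc (suc n)) ; nonEmpty = _ ; tail = tail′ ; head = head′ }

  open OrientedGraph chorded

  rim : Fin (suc (suc n)) → 𝔼
  rim i = suc i , dir (φ i)

  β : 𝔼
  β = zero , dir b

  src-rim : ∀ i → src (rim i) ≡ i
  src-rim i with dir (φ i) in eq
  ... | + rewrite eq = refl
  ... | - rewrite eq = refl

  tgt-rim : ∀ i → tgt (rim i) ≡ next i
  tgt-rim i with dir (φ i) in eq
  ... | + rewrite eq = refl
  ... | - rewrite eq = refl

  src-β : src β ≡ u
  src-β with dir b in eq
  ... | + rewrite eq = refl
  ... | - rewrite eq = refl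

  tgt-β : tgt β ≡ v
  tgt-β with dir b in eq
  ... | + rewrite eq = refl
  ... | - rewrite eq = refl

  rim-path : Path chorded zero (tabulate rim) zero
  rim-path = subst₂ (λ u v → Path chorded u (tabulate rim) v) (src-rim zero)
    (trans (tgt-rim (fromℕ (suc n))) (next-fromℕ (suc n)))
    (path-tabulate (suc n) rim (λ i → trans (tgt-rim (inject₁ i)) (trans (next-inject₁ i) (sym (src-rim (suc i))))))

  conn : ∀ x y → Walk x y
  conn = Shape.reach cycleShape (suc n) Arc (λ i → rim i , src-rim i , tgt-rim i)
    (λ i → opp (rim i) , trans (src-opp {chorded} (rim i)) (tgt-rim i) , trans (tgt-opp {chorded} (rim i)) (src-rim i))

  O′ : Fin (suc (suc (suc n))) × Sign → Bool
  O′ (zero  , s) = has ⟦ mark b ⟧ s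
  O′ (suc i , s) = has ⟦ mark (φ i) ⟧ s

  -- Contracting the first rim edge, which joins the vertices 0 and 1.
  pred′ : Fin (suc (suc n)) → Fin (suc n)
  pred′ zero    = zero
  pred′ (suc i) = i

  skip : Fin (suc (suc n)) → Fin (suc (suc (suc n)))
  skip zero    = zero
  skip (suc i) = suc (suc i)

  contracted : OrientedGraph
  contracted = record { #V = suc n ; #E = suc (suc n) ; nonEmpty = _ ; tail = pred′ ∘ tail′ ∘ skip ; head = pred′ ∘ head′ ∘ skip }

  rim₀-ends : ∀ s → pred′ (tl (suc n) s zero) ≡ pred′ (hd (suc n) s zero)
  rim₀-ends + = refl
  rim₀-ends - = refl

  project : ∀ {x y} → Walk x y → OrientedGraph.Walk contracted (pred′ x) (pred′ y)
  project ε = ε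
  project {y = y} (((suc zero , +) , refl , refl) ◅ w) = subst (λ z → OrientedGraph.Walk contracted z (pred′ y)) (sym (rim₀-ends (dir (φ zero)))) (project w)
  project {y = y} (((suc zero , -) , refl , refl) ◅ w) = subst (λ z → OrientedGraph.Walk contracted z (pred′ y)) (rim₀-ends (dir (φ zero))) (project w)
  project (((zero , +) , refl , refl) ◅ w) = ((zero , +) , refl , refl) ◅ project w
  project (((zero , -) , refl , refl) ◅ w) = ((zero , -) , refl , refl) ◅ project w
  project (((suc (suc i) , +) , refl , refl) ◅ w) = ((suc i , +) , refl , refl) ◅ project w
  project (((suc (suc i) , -) , refl , refl) ◅ w) = ((suc i , -) , refl , refl) ◅ project w

  module Keyed (inj : Injective _≡_ _≡_ κ′) where
    G : OOGraph
    G = keyed chorded κ′ inj conn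

    skip-injective : Injective _≡_ _≡_ skip
    skip-injective {zero} {zero} _ = refl
    skip-injective {suc i} {suc j} refl = refl

    H : OOGraph
    H = keyed contracted (κ′ ∘ skip) (skip-injective ∘ inj) (λ x y → project (conn (suc x) (suc y)))

    contraction : Contraction G ｛ suc zero ｝ H
    contraction = record
      { edges = record
        { ι = skip
        ; ι-injective = skip-injective
        ; ι-image = λ e → mk⇔ (λ { (zero , refl) () ; (suc x , refl) () }) (image e)
        ; ι-order = λ _ _ → ⇔-refl }
      ; π = pred′
      ; π-surjective = λ y → suc y , λ { refl → refl }
      ; π-fibres = λ x y → mk⇔ (merged x y) (joined-same {G} pred′ same)
      ; tail-comm = λ _ → refl
      ; head-comm = λ _ → refl }
      where
      image : ∀ e → e ∈ ∁ ｛ suc zero ｝ → ∃[ x ] skip x ≡ e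
      image zero h = zero , refl
      image (suc zero) h = contradiction refl h
      image (suc (suc x)) h = suc x , refl
      merged : ∀ x y → pred′ x ≡ pred′ y → OOGraph.Joined G ｛ suc zero ｝ x y
      merged zero zero _ = ε
      merged zero (suc y) refl = ((rim zero , src-rim zero , tgt-rim zero) , refl) ◅ ε
      merged (suc x) zero refl = ((opp (rim zero) , trans (src-opp {chorded} (rim zero)) (tgt-rim zero) ,
        trans (tgt-opp {chorded} (rim zero)) (src-rim zero)) , refl) ◅ ε
      merged (suc x) (suc y) refl = ε
      same : ∀ a → proj₁ a ∈ ｛ suc zero ｝ → pred′ (src a) ≡ pred′ (tgt a)
      same (_ , +) refl = rim₀-ends (dir (φ zero))
      same (_ , -) refl = sym (rim₀-ends (dir (φ zero)))

    rim-not-loop : ∀ i → ¬ OOGraph.IsLoop G (suc i)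
    rim-not-loop i = distinct (dir (φ i))
      where
      distinct : ∀ s → tl (suc n) s i ≢ hd (suc n) s i
      distinct + eq = next≢ i (sym eq)
      distinct - eq = next≢ i eq

    -- The rim runs through e₀ and `π` from 0 to `u`, through `q ∷ α` to `v`, and through `ω` back
    -- to 0. The chord replaces `q ∷ α` in the second circuit; reversed, it closes `q ∷ α` to the
    -- third.
    module Circuits (π : List 𝔼) (q : 𝔼) (α : List 𝔼) (ω : List 𝔼)
      (N≡ : tabulate rim ≡ rim zero ∷ π ++ (q ∷ α) ++ ω)
      (path-π : Path chorded zero (rim zero ∷ π) u)
      (path-α : Path chorded u (q ∷ α) v)
      (path-ω : Path chorded v ω zero) where

      e₀ : 𝔼
      e₀ = rim zero

      N : List 𝔼
      N = e₀ ∷ π ++ (q ∷ α) ++ ω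

      rim∈N : ∀ i → rim i ∈ˡ N
      rim∈N i = subst (rim i ∈ˡ_) N≡ (∈-tabulate⁺ {f = rim} i)

      is-rim : ∀ {a} → a ∈ˡ N → ∃[ i ] a ≡ rim i
      is-rim {a} m = ∈-tabulate⁻ {f = rim} (subst (a ∈ˡ_) (sym N≡) m)

      N-edges : Unique (map proj₁ N)
      N-edges = subst (λ l → Unique (map proj₁ l)) N≡ (subst Unique (sym (map-tabulate rim proj₁)) (Uniqueₚ.tabulate⁺ {f = proj₁ ∘ rim} λ { refl → refl }))

      N-srcs : Unique (map src N)
      N-srcs = subst (λ l → Unique (map src l)) N≡ (subst Unique (sym (trans (map-tabulate rim src) (tabulate-cong src-rim))) (Uniqueₚ.tabulate⁺ id))

      src-unique : ∀ {a c} → a ∈ˡ N → c ∈ˡ N → src a ≡ src c → a ≡ c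
      src-unique a∈ c∈ eq with is-rim a∈ | is-rim c∈
      ... | i , refl | j , refl = cong rim (trans (sym (src-rim i)) (trans eq (src-rim j)))

      tgt-unique : ∀ {a c} → a ∈ˡ N → c ∈ˡ N → tgt a ≡ tgt c → a ≡ c
      tgt-unique a∈ c∈ eq with is-rim a∈ | is-rim c∈
      ... | i , refl | j , refl = cong rim (next-injective (trans (sym (tgt-rim i)) (trans eq (tgt-rim j))))

      -- `ω` may be empty; the rim arc `r` leaving `v` is then `e₀` itself.
      closing : ∃[ r ] ∃[ ρ ] ω ++ [ e₀ ] ≡ r ∷ ρ
      closing = go ω
        where
        go : ∀ ω → ∃[ r ] ∃[ ρ ] ω ++ [ e₀ ] ≡ r ∷ ρ
        go [] = e₀ , [] , refl
        go (x ∷ ω) = x , ω ++ [ e₀ ] , refl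

      r : 𝔼
      r = proj₁ closing
      ρ : List 𝔼
      ρ = proj₁ (proj₂ closing)
      closing≡ : ω ++ [ e₀ ] ≡ r ∷ ρ
      closing≡ = proj₂ (proj₂ closing)

      path-ρ : Path chorded v (r ∷ ρ) (tgt e₀)
      path-ρ = subst (λ l → Path chorded v l (tgt e₀)) closing≡ (path-++ path-ω (step (src-rim zero) []))

      src-q : src q ≡ u
      src-q = path-start path-α
      src-r : src r ≡ v
      src-r = path-start path-ρ

      ring : N ↭ π ++ (q ∷ α) ++ (r ∷ ρ)
      ring = ↭-trans (Perm.++-comm [ e₀ ] (π ++ (q ∷ α) ++ ω)) (↭-reflexive (trans (++-assoc π ((q ∷ α) ++ ω) [ e₀ ])
        (cong (π ++_) (trans (++-assoc (q ∷ α) ω [ e₀ ]) (cong ((q ∷ α) ++_) closing≡)))))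

      ring-edges : Unique (map proj₁ (π ++ (q ∷ α) ++ (r ∷ ρ)))
      ring-edges = ↭-Unique (Perm.map⁺ proj₁ ring) N-edges

      αρ-edges : Unique (map proj₁ ((q ∷ α) ++ (r ∷ ρ)))
      αρ-edges = unique-++ʳ (map proj₁ π) (subst Unique (map-++ proj₁ π _) ring-edges)

      ρ-edges : Unique (map proj₁ (r ∷ ρ))
      ρ-edges = unique-++ʳ (map proj₁ (q ∷ α)) (subst Unique (map-++ proj₁ (q ∷ α) _) αρ-edges)

      ring∈ : ∀ {a} → a ∈ˡ π ++ (q ∷ α) ++ (r ∷ ρ) → a ∈ˡ N
      ring∈ = Perm.∈-resp-↭ (↭-sym ring)

      π∈ : ∀ {a} → a ∈ˡ π → a ∈ˡ N
      π∈ m = ring∈ (∈-++⁺ˡ m)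
      α∈ : ∀ {a} → a ∈ˡ q ∷ α → a ∈ˡ N
      α∈ m = ring∈ (∈-++⁺ʳ π (∈-++⁺ˡ m))
      ρ∈ : ∀ {a} → a ∈ˡ r ∷ ρ → a ∈ˡ N
      ρ∈ m = ring∈ (∈-++⁺ʳ π (∈-++⁺ʳ (q ∷ α) m))
      q∈ : q ∈ˡ N
      q∈ = α∈ (here refl)
      r∈ : r ∈ˡ N
      r∈ = ρ∈ (here refl)

      q≢r : q ≢ r
      q≢r = apart proj₁ (q ∷ α) αρ-edges (here refl) (here refl)

      u≢v : u ≢ v
      u≢v eq = q≢r (src-unique q∈ r∈ (trans src-q (trans eq (sym src-r))))

      Internal : 𝔼 → Set
      Internal c = src c ≢ u × src c ≢ v

      internal : ∀ {c} → c ∈ˡ N → c ≢ q → c ≢ r → Internal c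
      internal m c≢q c≢r = (λ eq → c≢q (src-unique m q∈ (trans eq (sym src-q)))) , (λ eq → c≢r (src-unique m r∈ (trans eq (sym src-r))))

      head-apart : ∀ {x : 𝔼} {xs c} → Unique (map proj₁ (x ∷ xs)) → c ∈ˡ xs → c ≢ x
      head-apart u m refl = apart proj₁ [ _ ] u (here refl) m refl

      internal-π : ∀ c → c ∈ˡ π → Internal c
      internal-π c m = internal (π∈ m) (apart proj₁ π ring-edges m (here refl)) (apart proj₁ π ring-edges m (∈-++⁺ʳ (q ∷ α) (here refl)))
      internal-α : ∀ c → c ∈ˡ α → Internal c
      internal-α c m = internal (α∈ (there m)) (head-apart αρ-edges (∈-++⁺ˡ m)) (apart proj₁ (q ∷ α) αρ-edges (there m) (here refl))
      internal-ρ : ∀ c → c ∈ˡ ρ → Internal c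
      internal-ρ c m = internal (ρ∈ (there m)) (λ eq → apart proj₁ (q ∷ α) αρ-edges (here refl) (there m) (sym eq)) (head-apart ρ-edges m)

      β-not-loop : ¬ OOGraph.IsLoop G zero
      β-not-loop = distinct (dir b)
        where
        distinct : ∀ s → proj₁ (ends s) ≢ proj₂ (ends s)
        distinct + = u≢v
        distinct - = u≢v ∘ sym

      incident-β : ∀ {w} → Incident {G} zero w → w ≡ u ⊎ w ≡ v
      incident-β inc with incident⇒ {G} β inc
      ... | inj₁ eq = inj₁ (trans (sym eq) src-β)
      ... | inj₂ eq = inj₂ (trans (sym eq) tgt-β)

      module _ {x : V} {bs : List 𝔼} (p : Path chorded x bs x) (un : Unique (map proj₁ bs)) where

        Uses : E → Set
        Uses y = y ∈ˡ map proj₁ bs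

        a-not-loop : ∀ {a} → a ∈ˡ N → ¬ OOGraph.IsLoop G (proj₁ a)
        a-not-loop m with is-rim m
        ... | i , refl = rim-not-loop i

        around : ∀ {a c} → a ∈ˡ N → c ∈ˡ N → tgt a ≡ src c → ∀ y → Incident {G} y (src c) →
                 (y ≡ zero × (src c ≡ u ⊎ src c ≡ v)) ⊎ y ≡ proj₁ a ⊎ y ≡ proj₁ c
        around a∈ c∈ eq zero inc = inj₁ (refl , incident-β inc)
        around a∈ c∈ eq (suc j) inc with incident⇒ {G} (rim j) inc
        ... | inj₁ s = inj₂ (inj₂ (cong proj₁ (src-unique (rim∈N j) c∈ s)))
        ... | inj₂ t = inj₂ (inj₁ (cong proj₁ (tgt-unique (rim∈N j) a∈ (trans t (sym eq)))))

        -- Away from the ends of the chord, `a` and `c` are the only edges at their common vertex,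
        -- so by `meets` a closed trail uses both or neither.
        link : ∀ {a c} → a ∈ˡ N → c ∈ˡ N → tgt a ≡ src c → Internal c → Uses (proj₁ a) ⇔ Uses (proj₁ c)
        link {a} {c} a∈ c∈ eq (c≢u , c≢v) = mk⇔ fwd bwd
          where
          fwd : Uses (proj₁ a) → Uses (proj₁ c)
          fwd h with meets {G} p un h (a-not-loop a∈) (subst (Incident {G} (proj₁ a)) eq (incident-tgt {G} a))
          ... | y , y∈ , y≢a , inc with around a∈ c∈ eq y inc
          ...   | inj₁ (_ , inj₁ e) = contradiction e c≢u
          ...   | inj₁ (_ , inj₂ e) = contradiction e c≢v
          ...   | inj₂ (inj₁ e) = contradiction e y≢a
          ...   | inj₂ (inj₂ refl) = y∈
          bwd : Uses (proj₁ c) → Uses (proj₁ a)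
          bwd h with meets {G} p un h (a-not-loop c∈) (incident-src {G} c)
          ... | y , y∈ , y≢c , inc with around a∈ c∈ eq y inc
          ...   | inj₁ (_ , inj₁ e) = contradiction e c≢u
          ...   | inj₁ (_ , inj₂ e) = contradiction e c≢v
          ...   | inj₂ (inj₁ refl) = y∈
          ...   | inj₂ (inj₂ e) = contradiction e y≢c

        chain : ∀ {y a l z} → Path chorded y (a ∷ l) z → (∀ c → c ∈ˡ a ∷ l → c ∈ˡ N) → (∀ c → c ∈ˡ l → Internal c) →
                ∀ c → c ∈ˡ l → Uses (proj₁ a) ⇔ Uses (proj₁ c)
        chain (step _ q@(step eq _)) ⊆N int c (here refl) = link (⊆N _ (here refl)) (⊆N _ (there (here refl))) (sym eq) (int _ (here refl))
        chain (step _ q@(step eq _)) ⊆N int c (there m) =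
          ⇔-trans (link (⊆N _ (here refl)) (⊆N _ (there (here refl))) (sym eq) (int _ (here refl)))
            (chain q (λ c m → ⊆N c (there m)) (λ c m → int c (there m)) c m)

        -- Absence of e₀ spreads along the rim to `π` and `ω`, by `link`. At `u` only the chord and
        -- `q` remain, so the trail uses both or neither; being nonempty, it uses the chord and all
        -- of `q ∷ α`.
        module Avoiding (e∉ : ¬ Uses (suc zero)) (bs≢[] : bs ≢ []) where

          ∉π : ∀ c → c ∈ˡ π → ¬ Uses (proj₁ c)
          ∉π c m h = e∉ (from (chain path-π (λ { c (here refl) → here refl ; c (there m) → π∈ m }) internal-π c m) h)

          ∉ρ : ∀ c → c ∈ˡ r ∷ ρ → ¬ Uses (proj₁ c)
          ∉ρ c m h = e∉ (reach (subst (e₀ ∈ˡ_) closing≡ (∈-++⁺ʳ ω (here refl))) (starts c m h))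
            where
            starts : ∀ c → c ∈ˡ r ∷ ρ → Uses (proj₁ c) → Uses (proj₁ r)
            starts c (here refl) h = h
            starts c (there m) h = from (chain path-ρ (λ _ → ρ∈) internal-ρ c m) h
            reach : ∀ {c} → c ∈ˡ r ∷ ρ → Uses (proj₁ r) → Uses (proj₁ c)
            reach (here refl) h = h
            reach (there m) h = to (chain path-ρ (λ _ → ρ∈) internal-ρ _ m) h

          last : ∃[ l ] l ∈ˡ e₀ ∷ π × tgt l ≡ u
          last = path-last path-π

          ∉last : ¬ Uses (proj₁ (proj₁ last))
          ∉last with proj₁ (proj₂ last)
          ... | here eq = λ h → e∉ (subst Uses (cong proj₁ eq) h)
          ... | there m = ∉π _ m

          last∈ : proj₁ last ∈ˡ N
          last∈ with proj₁ (proj₂ last)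
          ... | here eq = here eq
          ... | there m = π∈ m

          at-u : ∀ y → Uses y → Incident {G} y (src q) → y ≡ zero ⊎ y ≡ proj₁ q
          at-u y y∈ inc with around last∈ q∈ (trans (proj₂ (proj₂ last)) (sym src-q)) y inc
          ... | inj₁ (eq , _) = inj₁ eq
          ... | inj₂ (inj₁ refl) = contradiction y∈ ∉last
          ... | inj₂ (inj₂ eq) = inj₂ eq

          q⇒β : Uses (proj₁ q) → Uses zero
          q⇒β h with meets {G} p un h (a-not-loop q∈) (incident-src {G} q)
          ... | y , y∈ , y≢q , inc with at-u y y∈ inc
          ...   | inj₁ refl = y∈
          ...   | inj₂ eq = contradiction eq y≢q

          β⇒q : Uses zero → Uses (proj₁ q)
          β⇒q h with meets {G} p un h β-not-loop (subst (Incident {G} zero) (trans src-β (sym src-q)) (incident-src {G} β))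
          ... | y , y∈ , y≢β , inc with at-u y y∈ inc
          ...   | inj₁ eq = contradiction eq y≢β
          ...   | inj₂ refl = y∈

          q⇔α : ∀ c → c ∈ˡ q ∷ α → Uses (proj₁ q) ⇔ Uses (proj₁ c)
          q⇔α c (here refl) = ⇔-refl
          q⇔α c (there m) = chain path-α (λ _ → α∈) internal-α c m

          classify : ∀ y → Uses y → y ≡ zero ⊎ ∃[ c ] c ∈ˡ q ∷ α × y ≡ proj₁ c
          classify zero h = inj₁ refl
          classify (suc j) h with ∈-++⁻ π (Perm.∈-resp-↭ ring (rim∈N j))
          ... | inj₁ m = contradiction h (∉π _ m)
          ... | inj₂ m with ∈-++⁻ (q ∷ α) m
          ...   | inj₁ m′ = inj₂ (rim j , m′ , refl)
          ...   | inj₂ m′ = contradiction h (∉ρ _ m′)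

          some : ∃[ y ] Uses y
          some = go bs refl
            where
            go : ∀ l → l ≡ bs → ∃[ y ] Uses y
            go [] eq = contradiction (sym eq) bs≢[]
            go (a ∷ l) eq = proj₁ a , subst (λ l → proj₁ a ∈ˡ map proj₁ l) eq (here refl)

          uses-q : Uses (proj₁ q)
          uses-q with classify (proj₁ some) (proj₂ some)
          ... | inj₁ eq = β⇒q (subst Uses eq (proj₂ some))
          ... | inj₂ (c , m , eq) = from (q⇔α c m) (subst Uses eq (proj₂ some))

          exactly : ∀ y → Uses y ⇔ y ∈ˡ map proj₁ ((q ∷ α) ++ [ opp β ])
          exactly y = mk⇔ fwd bwd
            where
            fwd : Uses y → y ∈ˡ map proj₁ ((q ∷ α) ++ [ opp β ])
            fwd h with classify y h
            ... | inj₁ refl = ∈-map⁺ proj₁ (∈-++⁺ʳ (q ∷ α) (here {x = opp β} refl))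
            ... | inj₂ (c , m , refl) = ∈-map⁺ proj₁ (∈-++⁺ˡ m)
            bwd : y ∈ˡ map proj₁ ((q ∷ α) ++ [ opp β ]) → Uses y
            bwd m with ∈-map⁻ proj₁ m
            ... | c , c∈ , refl with ∈-++⁻ (q ∷ α) c∈
            ...   | inj₁ h = to (q⇔α c h) uses-q
            ...   | inj₂ (here refl) = q⇒β uses-q

      e₀π : List 𝔼
      e₀π = e₀ ∷ π

      circ₁ : IsCycle G (e₀ ∷ π ++ (q ∷ α) ++ ω)
      circ₁ = (zero , path-++ path-π (path-++ path-α path-ω)) , (λ ()) , N-edges , N-srcs

      circ₂ : IsCycle G (e₀ ∷ π ++ β ∷ ω)
      circ₂ = (zero , path-++ path-π (step src-β (subst (λ w → Path chorded w ω zero) (sym tgt-β) path-ω))) , (λ ()) , edges , srcs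
        where
        p : N ↭ (q ∷ α) ++ (e₀π ++ ω)
        p = ↭-trans (Perm.++-comm e₀π ((q ∷ α) ++ ω)) (↭-trans (↭-reflexive (++-assoc (q ∷ α) ω e₀π))
              (Perm.++⁺ˡ (q ∷ α) (Perm.++-comm ω e₀π)))
        rest : Unique (map proj₁ (e₀π ++ ω))
        rest = unique-++ʳ (map proj₁ (q ∷ α)) (subst Unique (map-++ proj₁ (q ∷ α) _) (↭-Unique (Perm.map⁺ proj₁ p) N-edges))
        β∉ : All (zero ≢_) (map proj₁ (e₀π ++ ω))
        β∉ = Allₚ.map⁺ (All.tabulate λ {a} m eq → not-zero a (Perm.∈-resp-↭ (↭-sym p) (∈-++⁺ʳ (q ∷ α) m)) eq)
          where
          not-zero : ∀ a → a ∈ˡ N → zero ≢ proj₁ a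
          not-zero a m eq with is-rim m
          not-zero a m () | i , refl
        edges : Unique (map proj₁ (e₀ ∷ π ++ β ∷ ω))
        edges = ↭-Unique (Perm.map⁺ proj₁ (↭-sym (Perm.shift β e₀π ω))) (β∉ ∷ rest)
        p′ : N ↭ α ++ (e₀π ++ q ∷ ω)
        p′ = ↭-trans (Perm.++⁺ˡ e₀π (↭-sym (Perm.shift q α ω)))
               (↭-trans (Perm.++-comm e₀π (α ++ q ∷ ω)) (↭-trans (↭-reflexive (++-assoc α (q ∷ ω) e₀π))
                 (Perm.++⁺ˡ α (Perm.++-comm (q ∷ ω) e₀π))))
        -- The chord starts where `q` does, so these are the sources of the rim arcs without those
        -- of `α`.
        srcs : Unique (map src (e₀ ∷ π ++ β ∷ ω))
        srcs = subst Unique (trans (map-++ src e₀π (q ∷ ω)) (trans (cong (λ s → map src e₀π ++ s ∷ map src ω) (trans src-q (sym src-β)))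
                 (sym (map-++ src e₀π (β ∷ ω)))))
               (unique-++ʳ (map src α) (subst Unique (map-++ src α _) (↭-Unique (Perm.map⁺ src p′) N-srcs)))

      circ₃ : IsCycle G ((q ∷ α) ++ [ opp β ])
      circ₃ = (u , path-++ path-α (step (trans (src-opp {chorded} β) tgt-β)
                  (subst (λ w → Path chorded (tgt (opp β)) [] w) (trans (tgt-opp {chorded} β) src-β) []))) , (λ ()) , edges , srcs
        where
        p : N ↭ (π ++ ρ) ++ ((q ∷ α) ++ [ r ])
        p = ↭-trans ring (↭-trans (Perm.++⁺ˡ π (↭-trans (↭-reflexive (sym (++-assoc (q ∷ α) [ r ] ρ))) (Perm.++-comm ((q ∷ α) ++ [ r ]) ρ)))
              (↭-reflexive (sym (++-assoc π ρ _))))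
        α-edges : Unique (map proj₁ (q ∷ α))
        α-edges = unique-++ˡ (q ∷ α) αρ-edges
          where
          unique-++ˡ : ∀ xs {ys : List 𝔼} → Unique (map proj₁ (xs ++ ys)) → Unique (map proj₁ xs)
          unique-++ˡ [] _ = []
          unique-++ˡ (x ∷ xs) (ne ∷ u) = Allₚ.map⁺ (Allₚ.++⁻ˡ xs (Allₚ.map⁻ ne)) ∷ unique-++ˡ xs u
        β∉ : All (zero ≢_) (map proj₁ (q ∷ α))
        β∉ = Allₚ.map⁺ (All.tabulate λ {a} m eq → not-zero a (α∈ m) eq)
          where
          not-zero : ∀ a → a ∈ˡ N → zero ≢ proj₁ a
          not-zero a m eq with is-rim m
          not-zero a m () | i , refl
        edges : Unique (map proj₁ ((q ∷ α) ++ [ opp β ]))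
        edges = ↭-Unique (Perm.map⁺ proj₁ (Perm.++-comm [ opp β ] (q ∷ α))) (β∉ ∷ α-edges)
        -- The reversed chord starts at `v`, which is the source of `r`.
        srcs : Unique (map src ((q ∷ α) ++ [ opp β ]))
        srcs = subst Unique (trans (map-++ src (q ∷ α) [ r ]) (trans (cong (λ s → map src (q ∷ α) ++ [ s ])
                  (trans src-r (sym (trans (src-opp {chorded} β) tgt-β)))) (sym (map-++ src (q ∷ α) [ opp β ]))))
               (unique-++ʳ (map src (π ++ ρ)) (subst Unique (map-++ src (π ++ ρ) _) (↭-Unique (Perm.map⁺ src p) N-srcs)))

      rim₀-not-isthmus : ¬ IsIsthmus G (suc zero)
      rim₀-not-isthmus = go (path-++ path-π (path-++ path-α path-ω)) N-edges
        where
        go : Path chorded zero (e₀ ∷ π ++ (q ∷ α) ++ ω) zero → Unique (map proj₁ N) → ¬ IsIsthmus G (suc zero)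
        go (step eq p) (ne ∷ _) = not-isthmus {G} e₀ _ (subst (Path chorded (tgt e₀) _) (sym eq) p) (λ m → All.lookup ne m refl)

module CycleTheta (P : FourientationProperty) (tutte : IsTutteCycleProperty P) where
  open CircuitTheory P cyclePolarity cycleShape using (module Theory)
  open CycleTheory P tutte using (theory)
  open Theory theory using (Theta)

  -- The word of the rim without its maximum letter is presented as `t ∷ T`, which shows the two rim
  -- edges that the chord graph requires.
  theta′ : ∀ k d L₁ a₀ L₂ b L₃ t T → L₁ ++ (a₀ ∷ L₂) ++ L₃ ≡ t ∷ T →
           (L₁ ++ (a₀ ∷ L₂) ++ b ∷ L₃) ≺ k → UniqueKeys (L₁ ++ (a₀ ∷ L₂) ++ b ∷ L₃) → Theta k d L₁ (a₀ ∷ L₂) b L₃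
  theta′ k d L₁ a₀ L₂ b L₃ t T T≡ lt uk = result
    where
    L : List Letter
    L = ⟨ k , d , free ⟩ ∷ t ∷ T
    p : L₁ ++ (a₀ ∷ L₂) ++ b ∷ L₃ ↭ b ∷ t ∷ T
    p = ↭-trans (↭-reflexive (sym (++-assoc L₁ (a₀ ∷ L₂) (b ∷ L₃)))) (↭-trans (Perm.shift b (L₁ ++ a₀ ∷ L₂) L₃)
          (prep b (↭-reflexive (trans (++-assoc L₁ (a₀ ∷ L₂) L₃) T≡))))
    lt′ : (b ∷ t ∷ T) ≺ k
    lt′ = Perm.All-resp-↭ p lt
    u′ : UniqueKeys (b ∷ t ∷ T)
    u′ = ↭-UniqueKeys p uk
    all-keys : UniqueKeys (b ∷ L)
    all-keys with u′ | lt′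
    ... | ne ∷ un | b<k ∷ lt″ = ((λ eq → ℕ.<⇒≢ b<k eq) ∷ ne) ∷ (Allₚ.map⁺ (All.map (λ z<k k≡z → ℕ.<⇒≢ z<k (sym k≡z)) lt″) ∷ un)
    n : ℕ
    n = length T
    φ : Fin (suc (suc n)) → Letter
    φ = lookup L
    all-lookup : ∀ {i j} → key (lookup (b ∷ L) i) ≡ key (lookup (b ∷ L) j) → i ≡ j
    all-lookup = lookup-injective key (b ∷ L) all-keys

    -- The vertices u and v are only known once the rim has been split into
    -- arcs, which is therefore done in a chord graph with dummy ends.
    module Rim (u v : Fin (suc (suc n))) where
      open ChordGraph n φ b u v public
      lett : Fin (suc (suc (suc n))) × Sign → Letter
      lett (e , s) = ⟨ κ′ e , s , mk (status′ (O′ (e , +)) (O′ (e , -))) ⟩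
      word-rim : map lett (tabulate (rim ∘ suc)) ≡ L₁ ++ (a₀ ∷ L₂) ++ L₃
      word-rim = trans (map-tabulate (rim ∘ suc) lett) (trans (tabulate-cong (λ i →
        cong (λ m → ⟨ key (φ (suc i)) , dir (φ (suc i)) , m ⟩) (trans (cong mk (status-has ⟦ mark (φ (suc i)) ⟧)) (mk-st (mark (φ (suc i)))))))
        (trans (tabulate-lookup (t ∷ T)) (sym T≡)))

    module R₀ = Rim zero zero

    result : Theta k d L₁ (a₀ ∷ L₂) b L₃
    result with map-split R₀.lett (tabulate (R₀.rim ∘ suc)) L₁ R₀.word-rim
    ... | π , rest , e₁ , w₁ , eq with map-split R₀.lett rest (a₀ ∷ L₂) eq
    ...   | q ∷ α , ω , e₂ , w₂ , w₃ = build (split (R₀.rim-path))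
      where
      N≡ : tabulate R₀.rim ≡ R₀.rim zero ∷ π ++ (q ∷ α) ++ ω
      N≡ = cong (R₀.rim zero ∷_) (trans e₁ (cong (π ++_) e₂))
      split : Path R₀.chorded zero (tabulate R₀.rim) zero →
        ∃[ u ] ∃[ v ] Path R₀.chorded zero (R₀.rim zero ∷ π) u × Path R₀.chorded u (q ∷ α) v × Path R₀.chorded v ω zero
      split p with path-split (R₀.rim zero ∷ π) (subst (λ l → Path R₀.chorded zero l zero) N≡ p)
      ... | u , p₁ , p₂ with path-split (q ∷ α) p₂
      ...   | v , p₃ , p₄ = u , v , p₁ , p₃ , p₄
      -- The two chord graphs differ only in the ends of edge `zero`, which these paths avoid.
      transfer : ∀ u v {x y l} → All (λ a → proj₁ a ≢ zero) l → Path R₀.chorded x l y → Path (Rim.chorded u v) x l y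
      transfer u v [] [] = []
      transfer u v {l = (zero , _) ∷ _} (ne ∷ _) (step _ _) = contradiction refl ne
      transfer u v {l = (suc i , +) ∷ _} (_ ∷ a) (step e p) = step e (transfer u v a p)
      transfer u v {l = (suc i , -) ∷ _} (_ ∷ a) (step e p) = step e (transfer u v a p)
      rim-only : All (λ a → proj₁ a ≢ zero) (R₀.rim zero ∷ π ++ (q ∷ α) ++ ω)
      rim-only = subst (All _) N≡ (Allₚ.tabulate⁺ {f = R₀.rim} λ i ())
      build : ∃[ u ] ∃[ v ] Path R₀.chorded zero (R₀.rim zero ∷ π) u × Path R₀.chorded u (q ∷ α) v × Path R₀.chorded v ω zero →
              Theta k d L₁ (a₀ ∷ L₂) b L₃
      build (u , v , p₁ , p₂ , p₃) = record
        { G = G ; κ = κ′ ; edgeKey = λ _ _ → ⇔-refl ; O = O′ ; e = suc zero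
        ; max = is-max
        ; ¬isthmus = rim₀-not-isthmus
        ; ¬loop = rim-not-loop zero
        ; minor = contraction
        ; π = π ; α = q ∷ α ; ω = ω ; β = β
        ; key-e = refl
        ; word-π = w₁ ; word-α = w₂ ; word-ω = w₃
        ; letter-β = cong (λ m → ⟨ key b , dir b , m ⟩) (trans (cong mk (status-has ⟦ mark b ⟧)) (mk-st (mark b)))
        ; circ₁ = circ₁ ; circ₂ = circ₂ ; circ₃ = circ₃
        ; circ₃-only = λ bs ((_ , p) , ne , un , _) e∉ → Avoiding.exactly p un e∉ ne
        }
        where
        open Rim u v
        inj : Injective _≡_ _≡_ κ′
        inj {i} {j} eq = all-lookup (trans (sym (κ′≡ i)) (trans eq (κ′≡ j)))
          where
          κ′≡ : ∀ i → κ′ i ≡ key (lookup (b ∷ L) i)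
          κ′≡ zero = refl
          κ′≡ (suc i) = refl
        open Keyed inj
        open Circuits π q α ω N≡
          (transfer u v (Allₚ.++⁻ˡ (R₀.rim zero ∷ π) rim-only) p₁)
          (transfer u v (Allₚ.++⁻ˡ (q ∷ α) (Allₚ.++⁻ʳ (R₀.rim zero ∷ π) rim-only)) p₂)
          (transfer u v (Allₚ.++⁻ʳ (q ∷ α) (Allₚ.++⁻ʳ (R₀.rim zero ∷ π) rim-only)) p₃)
        is-max : OOGraph.IsMax G (suc zero)
        is-max zero _ = All.head lt′
        is-max (suc zero) ne = contradiction refl ne
        is-max (suc (suc i)) _ = All.lookup (All.tail lt′) (∈-lookup i)

  theta : ∀ k d P A b Q → A ≢ [] → (P ++ A ++ b ∷ Q) ≺ k → UniqueKeys (P ++ A ++ b ∷ Q) → Theta k d P A b Q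
  theta k d P [] b Q ne lt u = contradiction refl ne
  theta k d P (a ∷ A) b Q ne lt u with P ++ (a ∷ A) ++ Q in eq
  ... | t ∷ T = theta′ k d P a A b Q t T eq lt u
  ... | [] = contradiction (trans (sym (Perm.↭-length (Perm.shift a P (A ++ Q)))) (cong length eq)) λ ()

-- Simple cycles inside closed trails.

module _ {G : OOGraph} where
  open OOGraph G

  unique-edge : ∀ {as : List 𝔼} → Unique (map proj₁ as) → ∀ {a b} → a ∈ˡ as → b ∈ˡ as → proj₁ a ≡ proj₁ b → a ≡ b
  unique-edge (ne ∷ u) (here refl) (here refl) eq = refl
  unique-edge (ne ∷ u) (here refl) (there b∈) eq = contradiction eq (All.lookup ne (∈-map⁺ proj₁ b∈))
  unique-edge (ne ∷ u) (there a∈) (here refl) eq = contradiction (sym eq) (All.lookup ne (∈-map⁺ proj₁ a∈))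
  unique-edge (ne ∷ u) (there a∈) (there b∈) eq = unique-edge u a∈ b∈ eq

  -- The end `v` heads the list of vertices: when an arc leaving `v` closes the path to a cycle, the
  -- list becomes its list of sources.
  record SimplePath (u : V) (as : List 𝔼) (v : V) : Set where
    field
      trail    : List 𝔼
      path     : Path graph u trail v
      within   : ∀ b → b ∈ˡ trail → b ∈ˡ as
      edges    : Unique (map proj₁ trail)
      vertices : Unique (v ∷ map src trail)

  -- Arcs are prepended one at a time. If the new start is already on the trail, only the part of
  -- the trail from there on is kept.
  loop-erase : ∀ {u as v} → Path graph u as v → Unique (map proj₁ as) → SimplePath u as v
  loop-erase [] _ = record { trail = [] ; path = [] ; within = λ _ () ; edges = [] ; vertices = [] ∷ [] }
  loop-erase {u} {a ∷ as} {v} (step refl p) (a∉ ∷ un) = extend-by (src a ≟ v) (DecMem._∈?_ _≟_ (src a) (map src trail))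
    where
    open SimplePath (loop-erase p un)
    extend-by : Dec (src a ≡ v) → Dec (src a ∈ˡ map src trail) → SimplePath (src a) (a ∷ as) v
    extend-by (yes refl) _ = record { trail = [] ; path = [] ; within = λ _ () ; edges = [] ; vertices = [] ∷ [] }
    extend-by (no ne) (no ∉trail) = record
      { trail = a ∷ trail ; path = step refl path
      ; within = λ { b (here eq) → here eq ; b (there m) → there (within b m) }
      ; edges = Allₚ.map⁺ (All.tabulate (λ m → All.lookup a∉ (∈-map⁺ proj₁ (within _ m)))) ∷ edges
      ; vertices = ((λ eq → ne (sym eq)) ∷ AllPairs.head vertices) ∷ (All.tabulate (λ m eq → ∉trail (subst (_∈ˡ map src trail) (sym eq) m)) ∷ AllPairs.tail vertices) }
    extend-by (no _) (yes u∈) with ∈-map⁻ src u∈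
    ... | c , c∈ , eq with ∈-∃++ c∈
    ...   | xs , ys , split with path-split {graph} xs (subst (λ l → Path graph (tgt a) l v) split path)
    ...     | w , _ , q = record
      { trail = c ∷ ys
      ; path = subst (λ x → Path graph x (c ∷ ys) v) (trans (sym (path-start q)) (sym eq)) q
      ; within = λ b m → there (within b (subst (b ∈ˡ_) (sym split) (∈-++⁺ʳ xs m)))
      ; edges = unique-++ʳ (map proj₁ xs) (subst Unique (trans (cong (map proj₁) split) (map-++ proj₁ xs (c ∷ ys))) edges)
      ; vertices = suffix vertices }
      where
      suffix : Unique (v ∷ map src trail) → Unique (v ∷ map src (c ∷ ys))
      suffix (h ∷ t) = Allₚ.++⁻ʳ (map src xs) (subst (All _) eq′ h) ∷ unique-++ʳ (map src xs) (subst Unique eq′ t)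
        where
        eq′ : map src trail ≡ map src xs ++ map src (c ∷ ys)
        eq′ = trans (cong (map src) split) (map-++ src xs (c ∷ ys))

  -- With `a` rotated to the front, only the way back from its target to its source is loop-erased,
  -- so `a` itself survives.
  simple-subcycle : ∀ {u as} → Path graph u as u → Unique (map proj₁ as) → ∀ a → a ∈ˡ as →
    ∃[ bs ] IsCycle G bs × a ∈ˡ bs × (∀ b → b ∈ˡ bs → b ∈ˡ as)
  simple-subcycle p un a a∈ with ∈-∃++ a∈
  ... | xs , ys , refl with path-rotate {graph} xs p | ↭-Unique (Perm.map⁺ proj₁ (Perm.++-comm xs (a ∷ ys))) un
  ...   | _ , step refl q | ne ∷ un′ = a ∷ trail ,
          ((src a , step refl path) , (λ ()) , Allₚ.map⁺ (All.tabulate (λ m → All.lookup ne (∈-map⁺ proj₁ (within _ m)))) ∷ edges , vertices) ,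
          here refl , inside-as
    where
    open SimplePath (loop-erase q un′)
    inside-as : ∀ b → b ∈ˡ a ∷ trail → b ∈ˡ xs ++ a ∷ ys
    inside-as b (here eq) = ∈-++⁺ʳ xs (here eq)
    inside-as b (there m) = Perm.∈-resp-↭ (Perm.++-comm (a ∷ ys) xs) (there (within b m))

-- The classification of Tutte cycle properties.

module CycleFinal (P : FourientationProperty) (tutte : IsTutteCycleProperty P) where
  open FourientationProperty P
  open CircuitTheory P cyclePolarity cycleShape
  open CycleTheory P tutte
  open CycleTheta P tutte using (theta)
  open WordRules theory theta using (rules)
  open Transfer P cyclePolarity cycleShape theory

  cycleObjects : Objects
  cycleObjects = record
    { Ob = Cycle
    ; 𝔼Ob = λ Cy → Cycle.𝔼Cy Cy
    ; 𝔼Ob? = λ {G} Cy a → DecMem._∈?_ (OOGraph._≟𝔼_ G) a (OOGraph.arcs G (Cycle.walk Cy))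
    ; anArc = λ {G} Cy → an-arc (OOGraph.arcs G (Cycle.walk Cy)) (Cycle.nonempty Cy)
    ; of-circ = λ {G} c → let Cy , eq = toCycle {G} c in Cy , λ a → mk⇔ (subst (a ∈ˡ_) eq) (subst (a ∈ˡ_) (sym eq))
    ; one-way = λ {G} Cy p q → cong proj₂ (unique-edge {G} (Cycle.distinctEdges Cy) p q refl)
    ; sub = λ {G} Cy a a∈ → simple-subcycle {G} (walk-path {G} (Cycle.walk Cy)) (Cycle.distinctEdges Cy) a a∈
    ; Pot = λ {G} O Cy → PotentialCycle G O Cy
    ; pot⇔ = λ {G} O Cy → mk⇔ (λ pot e s m → fwd {G} O e s (pot (e , s) m)) (λ h a m → bwd {G} O (proj₁ a) (proj₂ a) (h _ _ m))
    }
    where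
    an-arc : ∀ {A : Set} (l : List A) → l ≢ [] → ∃[ a ] a ∈ˡ l
    an-arc [] ne = contradiction refl ne
    an-arc (a ∷ l) _ = a , here refl
    fwd : ∀ {G} O e s → let open OOGraph G in (e , s) ∈ᶠ O → status O e ≡ bioriented ⊎ status O e ≡ oriented s
    fwd {G} O e s h with OOGraph.status G O e | has-status-at {G} O e s
    ... | bioriented | eq = inj₁ refl
    ... | unoriented | eq = contradiction (trans (sym h) (sym eq)) λ ()
    fwd {G} O e + h | oriented + | eq = inj₂ refl
    fwd {G} O e - h | oriented - | eq = inj₂ refl
    fwd {G} O e + h | oriented - | eq = contradiction (trans (sym h) (sym eq)) λ ()
    fwd {G} O e - h | oriented + | eq = contradiction (trans (sym h) (sym eq)) λ ()
    bwd : ∀ {G} O e s → let open OOGraph G in status O e ≡ bioriented ⊎ status O e ≡ oriented s → (e , s) ∈ᶠ O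
    bwd {G} O e s h with OOGraph.status G O e | has-status-at {G} O e s
    bwd O e s (inj₁ refl) | _ | eq = sym eq
    bwd O e + (inj₂ refl) | _ | eq = sym eq
    bwd O e - (inj₂ refl) | _ | eq = sym eq

  open Goodness cycleObjects rules
  open Consequences f rules using (classification; X; X-blocked)

  cycle-classification : IsMinEdgeCycleProperty P ⊎ IsCycleWeird P ⊎ IsCycleCoWeird P
  cycle-classification with classification
  ... | inj₁ (δ , std) = inj₁ (X ∘ Polarity.mk cyclePolarity , δ , X-blocked , λ G O → min-edge-good G O (X ∘ Polarity.mk cyclePolarity) δ (λ _ → refl) std)
  ... | inj₂ (- , std) = inj₂ (inj₁ λ G O → weird-good G O - std)
  ... | inj₂ (+ , std) = inj₂ (inj₂ λ G O → weird-good G O + std)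

theorem2p17 : (∀ (P : FourientationProperty) → IsTutteCutProperty P →
    IsMinEdgeCutProperty P ⊎ IsCutWeird P ⊎ IsCutCoWeird P)
    × (∀ (P : FourientationProperty) → IsTutteCycleProperty P →
    IsMinEdgeCycleProperty P ⊎ IsCycleWeird P ⊎ IsCycleCoWeird P)
theorem2p17 = CutFinal.cut-classification , CycleFinal.cycle-classification
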